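{- Let $\epsilon,\delta\in(0,1)$. There exists a 1-pass Streaming algorithm that, for an instance $(M=(V,I),z)$ of the Robust Matroid Center (RMC) problem, with $M$ of rank $k$ and $V$ of doubling dimension $D$, computes a $(3+\epsilon)$-approximate solution using working memory of size $$O\Big(\tfrac1\delta\log\tfrac1\delta\; k(k+z)\,\big(28(2+\delta)/\epsilon\big)^D\Big).$$
   Context: $V$ is a finite set of points from a metric space with distance $d$, and $d(i,S)=\min_{c\in S}d(i,c)$. RMC problem: given a matroid $M=(V,I)$ on $V$ ($I$ is the family of independent sets) and an integer $0\le z<|V|$, find $S\in I$ minimizing $$r(S,V,z)=\min_{X\subseteq V:\,|X|\ge |V|-z}\ \max_{i\in X} d(i,S).$$ An $\alpha$-approximate solution is a set $S\in I$ whose cost is at most $\alpha$ times the minimum cost. Standing assumptions: constant-time oracles are available to compute distances between elements of $V$ and to check the independence of a subset of $V$; $k$ is known to the algorithm; $\{j\}\in I$ for every $j\in V$. Doubling dimension: the ball of radius $r$ centered at $i\in V$ is the set of points of $V$ at distance at most $r$ from $i$; the doubling dimension of $V$ is the smallest $D$ such that every ball of radius $r$ centered at a point of $V$ is contained in the union of at most $2^D$ balls of radius $r/2$ centered at points of $V$. The algorithm does not know $D$. Streaming model: the computation is performed by a single processor with a limited working memory (measured in number of points/words), and the input points are provided as a continuous stream; a pass is one sequential scan of the stream. -}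

module Defs where

open import Level using (suc; _⊔_)
open import Algebra.Bundles using (CommutativeRing; Semiring)
import Algebra.Definitions.RawSemiring as RawSemiringDefs
open import Data.Bool.Base using (Bool; true; false)
open import Data.Fin.Base using (Fin)
open import Data.Fin.Subset using (Subset; ⊥; ⁅_⁆; ∣_∣; _∈_; _∉_; _⊆_; _∪_; ⋃)
open import Data.List.Base using (List; []; _∷_; map; length; lookup; _∷ʳ_)
open import Data.List.Relation.Unary.All using (All)
open import Data.List.Relation.Unary.Any using (Any)
open import Data.Nat.Base as ℕ using (ℕ; NonZero)
open import Data.Product using (∃; _×_; _,_)
open import Data.Sum.Base using (_⊎_; inj₁; inj₂)
open import Function.Metric.Structures using (IsGeneralMetric)
open import Relation.Binary.Core using (Rel)
open import Relation.Binary.PropositionalEquality.Core using (_≡_)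
open import Relation.Binary.Structures using (IsDecTotalOrder)
import Relation.Binary.Construct.NonStrictToStrict as ToStrict
open import Relation.Nullary using (¬_; Dec; does)

-- Stands in for ℝ.  Up to isomorphism the Archimedean ordered fields are
-- exactly the subfields of ℝ.

record ArchimedeanField c ℓ₁ ℓ₂ : Set (suc (c ⊔ ℓ₁ ⊔ ℓ₂)) where
  infix  4 _≤_
  infix  8 _⁻¹
  field
    commutativeRing : CommutativeRing c ℓ₁

  open CommutativeRing commutativeRing public
    using (Carrier; _≈_; _+_; _*_; -_; _-_; 0#; 1#; semiring)
  open RawSemiringDefs (Semiring.rawSemiring semiring) public
    using (_^_) renaming (_×_ to _ℕ×_)

  fromℕ : ℕ → Carrier
  fromℕ n = n ℕ× 1#

  field
    _≤_             : Rel Carrier ℓ₂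
    isDecTotalOrder : IsDecTotalOrder _≈_ _≤_
    +-monoˡ-≤       : ∀ {x y} z → x ≤ y → x + z ≤ y + z
    *-nonNegative   : ∀ {x y} → 0# ≤ x → 0# ≤ y → 0# ≤ x * y
    0≉1             : ¬ (0# ≈ 1#)
    -- The value of 0# ⁻¹ is unspecified.
    _⁻¹             : Carrier → Carrier
    *-inverseʳ      : ∀ {x} → ¬ (x ≈ 0#) → x * x ⁻¹ ≈ 1#
    archimedean     : ∀ x → ∃ λ n → x ≤ fromℕ n

  open IsDecTotalOrder isDecTotalOrder public using (_≤?_)
  open ToStrict _≈_ _≤_ public using (_<_)

record Matroid (n : ℕ) : Set₁ where
  field
    Indep      : Subset n → Set
    indep?     : ∀ S → Dec (Indep S)
    ∅-indep    : Indep ⊥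
    hereditary : ∀ {S T} → S ⊆ T → Indep T → Indep S
    exchange   : ∀ {S T} → Indep S → Indep T → ∣ S ∣ ℕ.< ∣ T ∣ →
                 ∃ λ x → x ∈ T × x ∉ S × Indep (S ∪ ⁅ x ⁆)

  IsRank : ℕ → Set
  IsRank k = (∃ λ S → Indep S × ∣ S ∣ ≡ k) × (∀ S → Indep S → ∣ S ∣ ℕ.≤ k)

module RMC {c ℓ₁ ℓ₂} (𝓡 : ArchimedeanField c ℓ₁ ℓ₂) where

  open ArchimedeanField 𝓡

  -- The point set V is Fin n; only the metric induced on V matters.

  record Metric (n : ℕ) : Set (c ⊔ ℓ₁ ⊔ ℓ₂) where
    field
      d        : Fin n → Fin n → Carrier
      isMetric : IsGeneralMetric _≡_ _≈_ _≤_ 0# _+_ d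

  IsMin : ∀ {p} → (Carrier → Set p) → Carrier → Set (c ⊔ ℓ₂ ⊔ p)
  IsMin P x = P x × (∀ y → P y → x ≤ y)

  IsMax : ∀ {p} → (Carrier → Set p) → Carrier → Set (c ⊔ ℓ₂ ⊔ p)
  IsMax P x = P x × (∀ y → P y → y ≤ x)

  module _ {n : ℕ} (V : Metric n) where

    open Metric V

    -- IsDist i S x says d(i,S) = x, and similarly for the next two.  No x
    -- satisfies IsDist i ∅ x: the distance to ∅ is infinite.

    IsDist : Fin n → Subset n → Carrier → Set (c ⊔ ℓ₁ ⊔ ℓ₂)
    IsDist i S = IsMin λ x → ∃ λ j → j ∈ S × x ≈ d i j

    IsRadius : Subset n → Subset n → Carrier → Set (c ⊔ ℓ₁ ⊔ ℓ₂)
    IsRadius X S = IsMax λ x → ∃ λ i → i ∈ X × IsDist i S x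

    IsCost : ℕ → Subset n → Carrier → Set (c ⊔ ℓ₁ ⊔ ℓ₂)
    IsCost z S = IsMin λ x → ∃ λ X → n ℕ.∸ z ℕ.≤ ∣ X ∣ × IsRadius X S x

    IsOptimum : Matroid n → ℕ → Carrier → Set (c ⊔ ℓ₁ ⊔ ℓ₂)
    IsOptimum M z = IsMin λ x → ∃ λ S → Matroid.Indep M S × IsCost z S x

    IsApproxSolution : Carrier → Matroid n → ℕ → Subset n → Set (c ⊔ ℓ₁ ⊔ ℓ₂)
    IsApproxSolution α M z S =
      Matroid.Indep M S ×
      ∃ λ x → ∃ λ opt → IsCost z S x × IsOptimum M z opt × x ≤ α * opt

    InBall : Fin n → Carrier → Fin n → Set ℓ₂
    InBall i r j = d j i ≤ r

    HalfBallCover : ℕ → Set (c ⊔ ℓ₂)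
    HalfBallCover Λ = ∀ i r → ∃ λ cs → length cs ℕ.≤ Λ ×
      (∀ j → InBall i r j → Any (λ i′ → InBall i′ (r * fromℕ 2 ⁻¹) j) cs)

    -- The doubling dimension D is the least real with HalfBallCover 2^D.
    -- Numbers of balls being integers, 2^D is the least such integer, so
    -- D = log₂ Λ when Λ satisfies the following.

    IsDoublingConstant : ℕ → Set (c ⊔ ℓ₂)
    IsDoublingConstant Λ =
      HalfBallCover Λ × (∀ Λ′ → HalfBallCover Λ′ → Λ ℕ.≤ Λ′)

  -- y ≤ a · x^D for the real exponent D = log₂ Λ, where 0 ≤ y, 0 ≤ a and
  -- 1 ≤ x: as x^D is the infimum of x^(p/q) over the rationals p/q ≥ D, it
  -- means y ≤ a · x^(p/q) whenever Λ ≤ 2^(p/q).  For an integer D and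
  -- Λ = 2^D the case p/q = D/1 implies all the others.

  infix 4 _≤_·_^log₂_
  _≤_·_^log₂_ : Carrier → Carrier → Carrier → ℕ → Set ℓ₂
  y ≤ a · x ^log₂ Λ = ∀ p q .{{_ : NonZero q}} → Λ ℕ.^ q ℕ.≤ 2 ℕ.^ p →
    y ^ q ≤ a ^ q * x ^ p

  -- L = ⌈log₂ x⌉ for 1 ≤ x
  IsCeilLog₂ : Carrier → ℕ → Set ℓ₂
  IsCeilLog₂ x L = x ≤ fromℕ 2 ^ L × (∀ L′ → x ≤ fromℕ 2 ^ L′ → L ℕ.≤ L′)

  ----------------------------------------------------------------------
  -- A streaming machine.  Its memory consists of points, reals and
  -- integers.  Points are opaque: a program sees how many points and reals
  -- are stored, but addresses them by their positions only and learns
  -- about them through one oracle query or real comparison at a time,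
  -- whose answer is a single bit.  All other control information,
  -- including the program counter, is in the integer memory.

  data Operation (p s : ℕ) : Set c where
    -- appends the next input point to the memory, if there is one; the bit
    -- returned tells whether there was
    read        : Operation p s
    keepPoints  : List (Fin p) → Operation p s
    keepReals   : List (Fin s) → Operation p s
    -- the next six append a real to the memory
    constant    : Carrier → Operation p s
    distance    : Fin p → Fin p → Operation p s
    add sub mul div : Fin s → Fin s → Operation p s
    compare     : Fin s → Fin s → Operation p s
    independent : List (Fin p) → Operation p s
    skip        : Operation p s
    halt        : List (Fin p) → Operation p s

  -- An operation and the new integer memory, given the bit returned by the
  -- operation.
  Program : Set c
  Program = (p s : ℕ) → List ℕ → Operation p s × (Bool → List ℕ)

  record Config (n : ℕ) : Set c where
    constructor ⟨_,_,_,_⟩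
    field
      input  : List (Fin n)
      points : List (Fin n)
      reals  : List Carrier
      words  : List ℕ

  initial : ∀ {n} → List (Fin n) → Config n
  initial stream = ⟨ stream , [] , [] , [] ⟩

  toSubset : ∀ {n} → List (Fin n) → Subset n
  toSubset is = ⋃ (map ⁅_⁆ is)

  module _ {n : ℕ} (V : Metric n) (M : Matroid n) (prog : Program) where

    open Metric V
    open Matroid M
    open Config

    -- inj₁ is the output on halting.  Operations that have no answer to
    -- give return true.
    step : Config n → List (Fin n) ⊎ Config n
    step ⟨ is , ps , rs , ws ⟩ with prog (length ps) (length rs) ws
    ... | op , next = perform op is
      where
      point = lookup ps
      real  = lookup rs

      push : Carrier → List (Fin n) ⊎ Config n
      push x = inj₂ ⟨ is , ps , rs ∷ʳ x , next true ⟩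

      perform : Operation (length ps) (length rs) → List (Fin n) →
                List (Fin n) ⊎ Config n
      perform read []         = inj₂ ⟨ [] , ps , rs , next false ⟩
      perform read (i ∷ is′)  = inj₂ ⟨ is′ , ps ∷ʳ i , rs , next true ⟩
      perform (keepPoints as) _ = inj₂ ⟨ is , map point as , rs , next true ⟩
      perform (keepReals as)  _ = inj₂ ⟨ is , ps , map real as , next true ⟩
      perform (constant x)    _ = push x
      perform (distance a b)  _ = push (d (point a) (point b))
      perform (add a b)       _ = push (real a + real b)
      perform (sub a b)       _ = push (real a - real b)
      perform (mul a b)       _ = push (real a * real b)
      perform (div a b)       _ = push (real a * real b ⁻¹)
      perform (compare a b)   _ =
        inj₂ ⟨ is , ps , rs , next (does (real a ≤? real b)) ⟩
      perform (independent as) _ =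
        inj₂ ⟨ is , ps , rs , next (does (indep? (toSubset (map point as)))) ⟩
      perform skip            _ = inj₂ ⟨ is , ps , rs , next true ⟩
      perform (halt as)       _ = inj₁ (map point as)

    -- b bounds the value of each integer word.
    Fits : (m b : ℕ) → Config n → Set
    Fits m b cfg =
      length (points cfg) ℕ.+ length (reals cfg) ℕ.+ length (words cfg) ℕ.≤ m
      × All (ℕ._≤ b) (words cfg)

    -- The run from a configuration halts with the given output, and all
    -- configurations in it fit.
    data Run (m b : ℕ) : Config n → List (Fin n) → Set c where
      stop : ∀ {cfg out} → Fits m b cfg → step cfg ≡ inj₁ out →
             Run m b cfg out
      go   : ∀ {cfg cfg′ out} → Fits m b cfg → step cfg ≡ inj₂ cfg′ →
             Run m b cfg′ out → Run m b cfg out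

{-# OPTIONS --safe #-}
module Submission where

-- Let μ be a scale that never exceeds twice the optimum.  A stored point p is
-- given up when some independent set of other stored points within μ/8 of it
-- forms a dependent set with p; the weight of p passes to one of them.  The
-- scale is raised, at least to its double, when there are more than k + z
-- stored points at pairwise distances above 2μ; their least distance is then
-- the new scale.  It is at most twice the optimum, as two of these points have
-- the same center in an optimal solution.  The errors of the successive scales
-- form a geometric series, so every point read is within μ/4 of the stored
-- point carrying its weight, and it can be exchanged for one of the stored
-- points within μ/4 in any independent set.  Exchanging the centers of an
-- optimal solution one at a time gives a solution among the stored points, and
-- the best of these has a cost of at most opt + 3μ/4 ≤ 3 opt on all points.
--
-- When the scale cannot be raised, k + z balls of radius 2μ cover the stored
-- points, hence (k + z) Λ⁵ balls of radius μ/16 do, and the stored points in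
-- each of the latter are independent.  So k (k + z) Λ⁵ points are stored, where
-- Λ⁵ = 32^D ≤ (28 (2 + δ) / ε)^D.  Running time being free, every choice is made by
-- exhaustive search, which only needs to remember the current candidate.

-- The bounds reproduce themselves: an entry not yet examined at the current scale has its points
-- within μ/8 and an examined one within μ/4. Giving up a point adds one eighth, and a scale at
-- least twice as large turns a quarter into an eighth. The scale is kept as a pair of points u, v
-- in memory with μ = d(u,v). So it starts at 0 with u = v, it takes finitely many values, which
-- bounds the number of raises, and no real has to survive from one query to the next. For the same
-- reason a candidate solution carries a pair of points whose distance is its radius. As a program
-- sees positions and not points, it enumerates lists of positions; the queries it poses are defined
-- uniformly over both, so that a question about positions can be read as one about points. What
-- spans a point is recorded for every point of the stream, with distances measured from that point
-- itself, since the optimal centers may have been given up long before the stream ends.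

open import Defs
open import Algebra.Bundles using (CommutativeRing)
import Algebra.Properties.Ring as RingProperties
import Algebra.Properties.Semiring.Mult as SMult
import Algebra.Solver.Ring.NaturalCoefficients.Default as NatSolver
open import Data.Bool.Base using (Bool; true; false; not; if_then_else_)
open import Data.Empty using (⊥-elim) renaming (⊥ to False)
open import Data.Fin.Base as Fin using (Fin)
open import Data.Fin.Subset using (Subset; ⊥; ⁅_⁆; ∣_∣; _∈_; _∉_; _⊆_; _∪_; ∁; ⋃; Nonempty) renaming (_-_ to _∖_; ⊤ to full)
open import Data.Fin.Subset.Properties
  using ( x∈p∪q⁻; x∈p∪q⁺; x∈⁅x⁆; x∈⁅y⁆⇒x≡y; ∉⊥; _∈?_; x∈p∧x≢y⇒x∈p-y; x∈p⇒∣p-x∣<∣p∣; p⊂q⇒∣p∣<∣q∣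
        ; p⊆q⇒∣p∣≤∣q∣; x∈∁p⇒x∉p; x∉p⇒x∈∁p; ∣∁p∣≡n∸∣p∣; ∣⊥∣≡0; ∣⊤∣≡n; ∣⁅x⁆∣≡1; p─⊥≡p; p─q⊆p; nonempty?
        ; Empty-unique )
open import Data.List.Base
  using ( List; []; _∷_; map; length; filter; filterᵇ; allFin; _++_; concat; concatMap; take; drop; replicate; lookup
        ; _∷ʳ_; cartesianProduct )
import Data.List.Extrema as Extrema
import Data.List.Membership.Propositional as Membership
open import Data.List.Membership.Propositional using () renaming (_∈_ to _∈ˡ_; _∉_ to _∉ˡ_)
open import Data.List.Membership.Propositional.Properties
  using ( ∈-allFin; ∈-filter⁺; ∈-filter⁻; ∈-++⁺ˡ; ∈-++⁺ʳ; ∈-++⁻; ∈-map⁺; ∈-map⁻; ∈-cartesianProduct⁺ )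
import Data.List.Properties as Listₚ
open import Data.List.Relation.Binary.Permutation.Propositional using (_↭_; ↭-refl; ↭-sym; ↭-trans; ↭-reflexive)
import Data.List.Relation.Binary.Permutation.Propositional as Permutation
import Data.List.Relation.Binary.Permutation.Propositional.Properties as Permₚ
import Data.List.Relation.Binary.Permutation.Setoid.Properties as Permₛ
open import Data.List.Relation.Unary.All as All using (All; []; _∷_)
import Data.List.Relation.Unary.All.Properties as Allₚ
open import Data.List.Relation.Unary.AllPairs as AllPairs using (AllPairs; []; _∷_)
import Data.List.Relation.Unary.AllPairs.Properties as AllPairsₚ
open import Data.List.Relation.Unary.Any as Any using (Any; here; there)
import Data.List.Relation.Unary.Any.Properties as Anyₚ
open import Data.List.Relation.Unary.Unique.Propositional using (Unique)
import Data.List.Relation.Unary.Unique.Propositional.Properties as Uniqueₚ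
open import Data.Maybe.Base as Maybe using (Maybe; just; nothing; fromMaybe)
open import Data.Nat.Base as ℕ using (ℕ; zero; suc)
import Data.Nat.Properties as ℕₚ
open import Data.Nat.Solver using (module +-*-Solver)
open import Data.Product as Product using (∃; _×_; _,_; proj₁; proj₂)
open import Data.Sum.Base using (_⊎_; inj₁; inj₂)
open import Data.Unit.Base using (⊤; tt)
open import Data.Vec.Base using () renaming ([] to []ᵥ; _∷_ to _∷ᵥ_; there to thereᵥ)
open import Function.Base using (_∘_; id)
open import Function.Metric.Structures using (IsGeneralMetric)
open import Level using (Level; _⊔_; Lift; lift)
open import Relation.Binary.Bundles using (TotalOrder; Poset)
open import Relation.Binary.Construct.Closure.ReflexiveTransitive using (Star; _◅_; _◅◅_) renaming (ε to nil)
open import Relation.Binary.PropositionalEquality as ≡ using (_≡_; _≢_; cong; cong₂; refl)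
import Relation.Binary.Reasoning.PartialOrder as PosetReasoning
open import Relation.Binary.Structures using (IsDecTotalOrder)
open import Relation.Nullary using (¬_; Dec; yes; no; does; ¬?)
open import Relation.Nullary.Decidable
  using (_×-dec_; decidable-stable; dec-true; dec-false; toWitness; fromWitness; T?; ⌊_⌋)
open import Relation.Unary using (Pred; Decidable)

private
  variable
    p q : Level
    A B : Set
    n : ℕ

-- Ordered fields

module OrderedField {c ℓ₁ ℓ₂ : Level} (𝓡 : ArchimedeanField c ℓ₁ ℓ₂) where

  open ArchimedeanField 𝓡
  open CommutativeRing commutativeRing public
    using ( commutativeSemiring; ring; +-comm; +-assoc; +-identityˡ; +-identityʳ; +-cong
          ; *-comm; *-identityˡ; *-identityʳ; *-congˡ; *-congʳ; *-cong; *-assoc; zeroʳ; distribʳ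
          ; -‿inverseʳ; -‿inverseˡ; distribˡ )
  open IsDecTotalOrder isDecTotalOrder public
    using (module Eq)
    renaming (refl to ≤-refl; reflexive to ≤-reflexive; trans to ≤-trans; antisym to ≤-antisym;
              total to ≤-total; isTotalOrder to ≤-isTotalOrder; isPartialOrder to ≤-isPartialOrder)
  open NatSolver commutativeSemiring public
    using (solve; _:=_; _:+_; _:*_)

  ≤-totalOrder : TotalOrder c ℓ₁ ℓ₂
  ≤-totalOrder = record { isTotalOrder = ≤-isTotalOrder }

  ≤-poset : Poset c ℓ₁ ℓ₂
  ≤-poset = record { isPartialOrder = ≤-isPartialOrder }

  module ≤-Reasoning = PosetReasoning ≤-poset
  open ≤-Reasoning

  ≰⇒≥ : ∀ {x y} → ¬ (x ≤ y) → y ≤ x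
  ≰⇒≥ {x} {y} x≰y with ≤-total x y
  ... | inj₁ x≤y = ⊥-elim (x≰y x≤y)
  ... | inj₂ y≤x = y≤x

  +-mono-≤ : ∀ {x y u v} → x ≤ y → u ≤ v → x + u ≤ y + v
  +-mono-≤ {x} {y} {u} {v} x≤y u≤v = begin
    x + u  ≤⟨ +-monoˡ-≤ u x≤y ⟩
    y + u  ≈⟨ +-comm y u ⟩
    u + y  ≤⟨ +-monoˡ-≤ y u≤v ⟩
    v + y  ≈⟨ +-comm v y ⟩
    y + v  ∎

  0≤y-x : ∀ {x y} → x ≤ y → 0# ≤ y - x
  0≤y-x {x} {y} x≤y = begin
    0#     ≈⟨ -‿inverseʳ x ⟨
    x - x  ≤⟨ +-monoˡ-≤ (- x) x≤y ⟩
    y - x  ∎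

  y-x+x≈y : ∀ x y → (y - x) + x ≈ y
  y-x+x≈y x y = Eq.trans (+-assoc y (- x) x)
    (Eq.trans (+-cong Eq.refl (-‿inverseˡ x)) (+-identityʳ y))

  *-monoˡ-≤ : ∀ {x y} z → 0# ≤ z → x ≤ y → x * z ≤ y * z
  *-monoˡ-≤ {x} {y} z 0≤z x≤y = begin
    x * z                    ≈⟨ +-identityˡ (x * z) ⟨
    0# + x * z               ≤⟨ +-monoˡ-≤ (x * z) (*-nonNegative (0≤y-x x≤y) 0≤z) ⟩
    (y - x) * z + x * z      ≈⟨ distribʳ z (y - x) x ⟨
    ((y - x) + x) * z        ≈⟨ *-congʳ (y-x+x≈y x y) ⟩
    y * z                    ∎

  *-monoʳ-≤ : ∀ {x y} z → 0# ≤ z → x ≤ y → z * x ≤ z * y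
  *-monoʳ-≤ {x} {y} z 0≤z x≤y = begin
    z * x  ≈⟨ *-comm z x ⟩
    x * z  ≤⟨ *-monoˡ-≤ z 0≤z x≤y ⟩
    y * z  ≈⟨ *-comm y z ⟩
    z * y  ∎

  *-mono-≤ : ∀ {x y u v} → 0# ≤ x → 0# ≤ v → x ≤ y → u ≤ v → x * u ≤ y * v
  *-mono-≤ {x} {y} {u} {v} 0≤x 0≤v x≤y u≤v = begin
    x * u  ≤⟨ *-monoʳ-≤ x 0≤x u≤v ⟩
    x * v  ≤⟨ *-monoˡ-≤ v 0≤v x≤y ⟩
    y * v  ∎

  0≤1 : 0# ≤ 1#
  0≤1 with ≤-total 0# 1#
  ... | inj₁ 0≤1 = 0≤1
  -- Here -1 is nonnegative, and 1 is its square.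
  ... | inj₂ 1≤0 = begin
    0#             ≤⟨ *-nonNegative 0≤-1 0≤-1 ⟩
    - 1# * - 1#    ≈⟨ -x*y≈ ⟩
    1#             ∎
    where
    open RingProperties ring
    0≤-1 : 0# ≤ - 1#
    0≤-1 = ≤-trans (0≤y-x 1≤0) (≤-reflexive (+-identityˡ (- 1#)))
    -x*y≈ : - 1# * - 1# ≈ 1#
    -x*y≈ = Eq.trans (-1*x≈-x (- 1#)) (-‿involutive 1#)

  1≰0 : ¬ (1# ≤ 0#)
  1≰0 1≤0 = 0≉1 (≤-antisym 0≤1 1≤0)

  0≤fromℕ : ∀ n → 0# ≤ fromℕ n
  0≤fromℕ zero    = ≤-refl
  0≤fromℕ (suc n) = begin
    0#            ≈⟨ +-identityˡ 0# ⟨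
    0# + 0#       ≤⟨ +-mono-≤ 0≤1 (0≤fromℕ n) ⟩
    1# + fromℕ n  ∎

  fromℕ-mono : ∀ {m n} → m ℕ.≤ n → fromℕ m ≤ fromℕ n
  fromℕ-mono {n = n} ℕ.z≤n = 0≤fromℕ n
  fromℕ-mono (ℕ.s≤s m≤n)   = +-mono-≤ ≤-refl (fromℕ-mono m≤n)

  fromℕ-* : ∀ m n → fromℕ (m ℕ.* n) ≈ fromℕ m * fromℕ n
  fromℕ-* = SMult.×1-homo-* semiring

  fromℕ-1 : fromℕ 1 ≈ 1#
  fromℕ-1 = +-identityʳ 1#

  fromℕ-^ : ∀ m n → fromℕ (m ℕ.^ n) ≈ fromℕ m ^ n
  fromℕ-^ m zero    = fromℕ-1
  fromℕ-^ m (suc n) = Eq.trans (fromℕ-* m (m ℕ.^ n)) (*-congˡ (fromℕ-^ m n))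

  1≤fromℕ-suc : ∀ n → 1# ≤ fromℕ (suc n)
  1≤fromℕ-suc n = ≤-trans (≤-reflexive (Eq.sym fromℕ-1)) (fromℕ-mono {1} {suc n} (ℕ.s≤s ℕ.z≤n))

  fromℕ≉0 : ∀ n → ¬ (fromℕ (suc n) ≈ 0#)
  fromℕ≉0 n eq = 1≰0 (≤-trans (1≤fromℕ-suc n) (≤-reflexive eq))

  0≤^ : ∀ {x} n → 0# ≤ x → 0# ≤ x ^ n
  0≤^ zero    0≤x = 0≤1
  0≤^ (suc n) 0≤x = *-nonNegative 0≤x (0≤^ n 0≤x)

  ^-mono-≤ : ∀ {x y} n → 0# ≤ x → x ≤ y → x ^ n ≤ y ^ n
  ^-mono-≤ zero    0≤x x≤y = ≤-refl
  ^-mono-≤ (suc n) 0≤x x≤y =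
    *-mono-≤ 0≤x (0≤^ n (≤-trans 0≤x x≤y)) x≤y (^-mono-≤ n 0≤x x≤y)

  ⁻¹-nonneg : ∀ {x} → 0# < x → 0# ≤ x ⁻¹
  ⁻¹-nonneg {x} (0≤x , 0≉x) with ≤-total 0# (x ⁻¹)
  ... | inj₁ 0≤i = 0≤i
  ... | inj₂ i≤0 = ⊥-elim (1≰0 (begin
    1#        ≈⟨ *-inverseʳ (λ eq → 0≉x (Eq.sym eq)) ⟨
    x * x ⁻¹  ≤⟨ *-monoʳ-≤ x 0≤x i≤0 ⟩
    x * 0#    ≈⟨ zeroʳ x ⟩
    0#        ∎))

  1≤⁻¹ : ∀ {x} → 0# < x → x ≤ 1# → 1# ≤ x ⁻¹
  1≤⁻¹ {x} 0<x@(_ , 0≉x) x≤1 = begin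
    1#         ≈⟨ *-inverseʳ (λ eq → 0≉x (Eq.sym eq)) ⟨
    x * x ⁻¹   ≤⟨ *-monoˡ-≤ (x ⁻¹) (⁻¹-nonneg 0<x) x≤1 ⟩
    1# * x ⁻¹  ≈⟨ *-identityˡ (x ⁻¹) ⟩
    x ⁻¹       ∎

  0<fromℕ : ∀ n → 0# < fromℕ (suc n)
  0<fromℕ n = 0≤fromℕ (suc n) , λ eq → fromℕ≉0 n (Eq.sym eq)

  fromℕ-*-cancelˡ-≤ : ∀ n {x y} → fromℕ (suc n) * x ≤ fromℕ (suc n) * y → x ≤ y
  fromℕ-*-cancelˡ-≤ n {x} {y} le = begin
    x                    ≈⟨ undo x ⟨
    (i * (N * x))        ≤⟨ *-monoʳ-≤ i (⁻¹-nonneg (0<fromℕ n)) le ⟩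
    (i * (N * y))        ≈⟨ undo y ⟩
    y                    ∎
    where
    N = fromℕ (suc n)
    i = N ⁻¹
    undo : ∀ t → i * (N * t) ≈ t
    undo t = Eq.trans (Eq.sym (*-assoc i N t))
      (Eq.trans (*-congʳ (Eq.trans (*-comm i N) (*-inverseʳ (fromℕ≉0 n)))) (*-identityˡ t))

  fromℕ-double : ∀ n x → fromℕ (n ℕ.+ n) * x ≈ fromℕ n * x + fromℕ n * x
  fromℕ-double n x = Eq.trans (*-congʳ (SMult.×-homo-+ semiring 1# n n)) (distribʳ x (fromℕ n) (fromℕ n))

  fromℕ-1-* : ∀ x → fromℕ 1 * x ≈ x
  fromℕ-1-* x = Eq.trans (*-congʳ fromℕ-1) (*-identityˡ x)

  fromℕ-2-* : ∀ x → fromℕ 2 * x ≈ x + x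
  fromℕ-2-* x = Eq.trans (fromℕ-double 1 x) (+-cong (fromℕ-1-* x) (fromℕ-1-* x))

  halve-≤ : ∀ {x y} → x + x ≤ y + y → x ≤ y
  halve-≤ {x} {y} le = fromℕ-*-cancelˡ-≤ 1 (begin
    fromℕ 2 * x  ≈⟨ fromℕ-2-* x ⟩
    x + x        ≤⟨ le ⟩
    y + y        ≈⟨ fromℕ-2-* y ⟨
    fromℕ 2 * y  ∎)

  half+half : ∀ x → x * fromℕ 2 ⁻¹ + x * fromℕ 2 ⁻¹ ≈ x
  half+half x = begin-equality
    x * h + x * h      ≈⟨ fromℕ-2-* (x * h) ⟨
    fromℕ 2 * (x * h)  ≈⟨ solve 3 (λ a b c → a :* (b :* c) := b :* (a :* c)) Eq.refl (fromℕ 2) x h ⟩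
    x * (fromℕ 2 * h)  ≈⟨ *-congˡ (*-inverseʳ (fromℕ≉0 1)) ⟩
    x * 1#             ≈⟨ *-identityʳ x ⟩
    x                  ∎
    where h = fromℕ 2 ⁻¹

  ≤-+ˡ : ∀ {x y} → 0# ≤ y → x ≤ x + y
  ≤-+ˡ {x} {y} 0≤y = begin
    x       ≈⟨ +-identityʳ x ⟨
    x + 0#  ≤⟨ +-mono-≤ ≤-refl 0≤y ⟩
    x + y   ∎

-- Subsets and matroids

-- Unfolds to toSubset, which depends on the choice of a field.
set : List (Fin n) → Subset n
set xs = ⋃ (map ⁅_⁆ xs)

∈-set⁺ : ∀ {x : Fin n} {xs} → x ∈ˡ xs → x ∈ set xs
∈-set⁺ {x = x} {y ∷ xs} (here ≡.refl) = x∈p∪q⁺ (inj₁ (x∈⁅x⁆ x))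
∈-set⁺ {x = x} {y ∷ xs} (there x∈)    = x∈p∪q⁺ (inj₂ (∈-set⁺ x∈))

∈-set⁻ : ∀ {x : Fin n} xs → x ∈ set xs → x ∈ˡ xs
∈-set⁻ []       x∈ = ⊥-elim (∉⊥ x∈)
∈-set⁻ (y ∷ xs) x∈ with x∈p∪q⁻ ⁅ y ⁆ (set xs) x∈
... | inj₁ x∈y  = here (x∈⁅y⁆⇒x≡y y x∈y)
... | inj₂ x∈xs = there (∈-set⁻ xs x∈xs)

length-Unique-≤ : ∀ {xs : List (Fin n)} {S} → Unique xs → (∀ {x} → x ∈ˡ xs → x ∈ S) → length xs ℕ.≤ ∣ S ∣
length-Unique-≤ {xs = []}     _        _   = ℕ.z≤n
length-Unique-≤ {xs = x ∷ xs} {S} (x∉ ∷ u) xs⊆ = ℕₚ.≤-trans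
  (ℕ.s≤s (length-Unique-≤ u λ y∈ →
    x∈p∧x≢y⇒x∈p-y (xs⊆ (there y∈)) (All.lookup x∉ y∈ ∘ ≡.sym)))
  (x∈p⇒∣p-x∣<∣p∣ (xs⊆ (here ≡.refl)))

∣p∣<∣p∪⁅x⁆∣ : ∀ {S : Subset n} {x} → x ∉ S → ∣ S ∣ ℕ.< ∣ S ∪ ⁅ x ⁆ ∣
∣p∣<∣p∪⁅x⁆∣ {x = x} x∉ = p⊂q⇒∣p∣<∣q∣ ((x∈p∪q⁺ ∘ inj₁) , x , x∈p∪q⁺ (inj₂ (x∈⁅x⁆ x)) , x∉)

∣p∣≤1+∣p∖x∣ : ∀ (S : Subset n) x → ∣ S ∣ ℕ.≤ suc ∣ S ∖ x ∣
∣p∣≤1+∣p∖x∣ (true  ∷ᵥ S) Fin.zero    = ℕ.s≤s (ℕₚ.≤-reflexive (≡.cong ∣_∣ (≡.sym (p─⊥≡p S))))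
∣p∣≤1+∣p∖x∣ (false ∷ᵥ S) Fin.zero    = ℕₚ.m≤n⇒m≤1+n (ℕₚ.≤-reflexive (≡.cong ∣_∣ (≡.sym (p─⊥≡p S))))
∣p∣≤1+∣p∖x∣ (true  ∷ᵥ S) (Fin.suc x) = ℕ.s≤s (∣p∣≤1+∣p∖x∣ S x)
∣p∣≤1+∣p∖x∣ (false ∷ᵥ S) (Fin.suc x) = ∣p∣≤1+∣p∖x∣ S x

x∉p∖x : ∀ (S : Subset n) x → x ∉ S ∖ x
x∉p∖x (true  ∷ᵥ S) Fin.zero    ()
x∉p∖x (false ∷ᵥ S) Fin.zero    ()
x∉p∖x (_     ∷ᵥ S) (Fin.suc x) (thereᵥ x∈) = x∉p∖x S x x∈

∣set∣≤length : ∀ (xs : List (Fin n)) {S : Subset n} → (∀ {x} → x ∈ S → x ∈ˡ xs) → ∣ S ∣ ℕ.≤ length xs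
∣set∣≤length {n} [] {S} S⊆ = ℕₚ.≤-trans (p⊆q⇒∣p∣≤∣q∣ {q = ⊥} λ x∈ → case (S⊆ x∈)) (ℕₚ.≤-reflexive (∣⊥∣≡0 n))
  where
  case : ∀ {x} → x ∈ˡ [] → x ∈ ⊥
  case ()
∣set∣≤length (x ∷ xs) {S} S⊆ = ℕₚ.≤-trans (∣p∣≤1+∣p∖x∣ S x) (ℕ.s≤s (∣set∣≤length xs λ {y} y∈ → tail y∈ (S⊆ (p─q⊆p S ⁅ x ⁆ y∈))))
  where
  tail : ∀ {y} → y ∈ S ∖ x → y ∈ˡ x ∷ xs → y ∈ˡ xs
  tail y∈ (here ≡.refl) = ⊥-elim (x∉p∖x S x y∈)
  tail y∈ (there y∈xs)  = y∈xs

allSubsets : ∀ n → List (Subset n)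
allSubsets zero    = []ᵥ ∷ []
allSubsets (suc n) = map (true ∷ᵥ_) (allSubsets n) ++ map (false ∷ᵥ_) (allSubsets n)

∈-allSubsets : ∀ (S : Subset n) → S ∈ˡ allSubsets n
∈-allSubsets []ᵥ          = here ≡.refl
∈-allSubsets (true  ∷ᵥ S) = ∈-++⁺ˡ (∈-map⁺ _ (∈-allSubsets S))
∈-allSubsets (false ∷ᵥ S) = ∈-++⁺ʳ (map _ (allSubsets _)) (∈-map⁺ _ (∈-allSubsets S))

module _ {n : ℕ} (M : Matroid n) where
  open Matroid M

  -- Says that y lies in the closure of A, in a form that is transitive
  -- without any of the matroid axioms.
  Exchangeable : Fin n → Pred (Fin n) p → Set p
  Exchangeable y A = ∀ S → y ∉ S → Indep (S ∪ ⁅ y ⁆) → ∃ λ q → A q × q ∉ S × Indep (S ∪ ⁅ q ⁆)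

  exchangeable-refl : ∀ {y} {A : Pred (Fin n) p} → A y → Exchangeable y A
  exchangeable-refl Ay S y∉ ind = _ , Ay , y∉ , ind

  exchangeable-trans : ∀ {y} {A : Pred (Fin n) p} {B : Pred (Fin n) q} →
    Exchangeable y A → (∀ {x} → A x → Exchangeable x B) → Exchangeable y B
  exchangeable-trans ex A⇒ S y∉ ind with ex S y∉ ind
  ... | x , Ax , x∉ , ind′ = A⇒ Ax S x∉ ind′

  indep-⊆ : ∀ {xs ys} → (∀ {x} → x ∈ˡ xs → x ∈ˡ ys) → Indep (set ys) → Indep (set xs)
  indep-⊆ {xs} xs⊆ys = hereditary λ x∈ → ∈-set⁺ (xs⊆ys (∈-set⁻ xs x∈))

  -- Enlarge `J` by elements of S + p until it has more elements than `S`. The element p is never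
  -- taken, because J + p is dependent, so the result lies in J ∪ S. An exchange from it into the
  -- smaller set `S` adds an element outside `S`, which is therefore in `J`. Each round adds an
  -- element, so that |S| + 1 rounds are enough.
  dependent⇒exchangeable : ∀ {p J} → Indep (set J) → ¬ Indep (set (p ∷ J)) → Exchangeable p (_∈ˡ J)
  dependent⇒exchangeable {p} {J} J-ind pJ-dep S p∉S Sp-ind =
    conclude (augment (suc ∣ S ∣) (set J) id (x∈p∪q⁺ ∘ inj₁) J-ind (ℕₚ.m≤m+n (suc ∣ S ∣) _))
    where
    augment : ∀ fuel T → set J ⊆ T → T ⊆ set J ∪ S → Indep T → suc ∣ S ∣ ℕ.≤ fuel ℕ.+ ∣ T ∣ →
              ∃ λ T → T ⊆ set J ∪ S × Indep T × ∣ S ∣ ℕ.< ∣ T ∣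
    augment zero T _ T⊆ T-ind big = T , T⊆ , T-ind , big
    augment (suc fuel) T J⊆ T⊆ T-ind big with ∣ S ∣ ℕₚ.<? ∣ T ∣
    ... | yes lt = T , T⊆ , T-ind , lt
    ... | no ≮ with exchange T-ind Sp-ind (ℕₚ.≤-<-trans (ℕₚ.≮⇒≥ ≮) (∣p∣<∣p∪⁅x⁆∣ p∉S))
    ...   | x , x∈Sp , x∉T , Tx-ind with x∈p∪q⁻ S ⁅ p ⁆ x∈Sp
    -- The set T contains `J`, so adding p to it would make J + p independent.
    ...     | inj₂ x∈p = ⊥-elim (pJ-dep (hereditary pJ⊆ Tx-ind))
      where
      x≡p = x∈⁅y⁆⇒x≡y p x∈p
      pJ⊆ : set (p ∷ J) ⊆ T ∪ ⁅ x ⁆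
      pJ⊆ y∈ with x∈p∪q⁻ ⁅ p ⁆ (set J) y∈
      ... | inj₁ y∈p = x∈p∪q⁺ (inj₂ (≡.subst (λ t → _ ∈ ⁅ t ⁆) (≡.sym x≡p) y∈p))
      ... | inj₂ y∈J = x∈p∪q⁺ (inj₁ (J⊆ y∈J))
    ...     | inj₁ x∈S = augment fuel (T ∪ ⁅ x ⁆) (x∈p∪q⁺ ∘ inj₁ ∘ J⊆) Tx⊆ Tx-ind
        (ℕₚ.≤-trans big (ℕₚ.≤-trans (ℕₚ.≤-reflexive (≡.sym (ℕₚ.+-suc fuel ∣ T ∣))) (ℕₚ.+-monoʳ-≤ fuel (∣p∣<∣p∪⁅x⁆∣ x∉T))))
      where
      Tx⊆ : T ∪ ⁅ x ⁆ ⊆ set J ∪ S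
      Tx⊆ y∈ with x∈p∪q⁻ T ⁅ x ⁆ y∈
      ... | inj₁ y∈T = T⊆ y∈T
      ... | inj₂ y∈x = x∈p∪q⁺ (inj₂ (≡.subst (_∈ S) (≡.sym (x∈⁅y⁆⇒x≡y x y∈x)) x∈S))
    conclude : (∃ λ T → T ⊆ set J ∪ S × Indep T × ∣ S ∣ ℕ.< ∣ T ∣) →
               ∃ λ q → q ∈ˡ J × q ∉ S × Indep (S ∪ ⁅ q ⁆)
    conclude (T , T⊆ , T-ind , lt) with exchange (hereditary (x∈p∪q⁺ ∘ inj₁) Sp-ind) T-ind lt
    ... | q , q∈T , q∉S , Sq-ind with x∈p∪q⁻ (set J) S (T⊆ q∈T)
    ...   | inj₁ q∈J = q , ∈-set⁻ J q∈J , q∉S , Sq-ind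
    ...   | inj₂ q∈S = ⊥-elim (q∉S q∈S)

  -- The set `D` collects the replacements made so far. Each exchange takes place in the presence of
  -- `D` and of the elements still to be replaced, and its result lies outside both; this preserves
  -- independence and keeps the remaining elements out of the new `D`.
  exchange-all : ∀ {A : Fin n → Pred (Fin n) p} D os → Unique os → (∀ {o} → o ∈ˡ os → o ∉ D) →
    (∀ {o} → o ∈ˡ os → Exchangeable o (A o)) → Indep (D ∪ set os) →
    ∃ λ S → Indep (D ∪ set S) × All (λ o → Any (A o) S) os × All (λ q → Any (λ o → A o q) os) S
  exchange-all D [] _ _ _ ind = [] , ind , [] , []
  exchange-all {A = A} D (o ∷ os) (o∉os ∷ u) os∉D ex ind
    with ex (here ≡.refl) (D ∪ set os) o∉ (hereditary ⊆₁ ind)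
    where
    o∉ : o ∉ D ∪ set os
    o∉ o∈ with x∈p∪q⁻ D (set os) o∈
    ... | inj₁ o∈D  = os∉D (here ≡.refl) o∈D
    ... | inj₂ o∈os = All.lookup o∉os (∈-set⁻ os o∈os) ≡.refl
    ⊆₁ : (D ∪ set os) ∪ ⁅ o ⁆ ⊆ D ∪ (⁅ o ⁆ ∪ set os)
    ⊆₁ x∈ with x∈p∪q⁻ (D ∪ set os) ⁅ o ⁆ x∈
    ... | inj₂ x∈o = x∈p∪q⁺ (inj₂ (x∈p∪q⁺ (inj₁ x∈o)))
    ... | inj₁ x∈Dos with x∈p∪q⁻ D (set os) x∈Dos
    ...   | inj₁ x∈D  = x∈p∪q⁺ (inj₁ x∈D)
    ...   | inj₂ x∈os = x∈p∪q⁺ (inj₂ (x∈p∪q⁺ (inj₂ x∈os)))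
  ... | q , Aoq , q∉ , ind′
    with exchange-all {A = A} (D ∪ ⁅ q ⁆) os u os∉Dq (ex ∘ there) (hereditary ⊆₂ ind′)
    where
    os∉Dq : ∀ {o′} → o′ ∈ˡ os → o′ ∉ D ∪ ⁅ q ⁆
    os∉Dq o′∈ o′∈Dq with x∈p∪q⁻ D ⁅ q ⁆ o′∈Dq
    ... | inj₁ o′∈D = os∉D (there o′∈) o′∈D
    ... | inj₂ o′∈q with ≡.refl ← x∈⁅y⁆⇒x≡y q o′∈q = q∉ (x∈p∪q⁺ (inj₂ (∈-set⁺ o′∈)))
    ⊆₂ : (D ∪ ⁅ q ⁆) ∪ set os ⊆ (D ∪ set os) ∪ ⁅ q ⁆
    ⊆₂ x∈ with x∈p∪q⁻ (D ∪ ⁅ q ⁆) (set os) x∈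
    ... | inj₂ x∈os = x∈p∪q⁺ (inj₁ (x∈p∪q⁺ (inj₂ x∈os)))
    ... | inj₁ x∈Dq with x∈p∪q⁻ D ⁅ q ⁆ x∈Dq
    ...   | inj₁ x∈D = x∈p∪q⁺ (inj₁ (x∈p∪q⁺ (inj₁ x∈D)))
    ...   | inj₂ x∈q = x∈p∪q⁺ (inj₂ x∈q)
  ... | S , S-ind , os⇒S , S⇒os =
    q ∷ S , hereditary ⊆₃ S-ind , here Aoq ∷ All.map there os⇒S , here Aoq ∷ All.map there S⇒os
    where
    ⊆₃ : D ∪ (⁅ q ⁆ ∪ set S) ⊆ (D ∪ ⁅ q ⁆) ∪ set S
    ⊆₃ x∈ with x∈p∪q⁻ D (⁅ q ⁆ ∪ set S) x∈
    ... | inj₁ x∈D = x∈p∪q⁺ (inj₁ (x∈p∪q⁺ (inj₁ x∈D)))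
    ... | inj₂ x∈qS with x∈p∪q⁻ ⁅ q ⁆ (set S) x∈qS
    ...   | inj₁ x∈q = x∈p∪q⁺ (inj₁ (x∈p∪q⁺ (inj₂ x∈q)))
    ...   | inj₂ x∈S = x∈p∪q⁺ (inj₂ x∈S)

  independent-exchange : ∀ {A : Fin n → Pred (Fin n) p} {S} → Indep S →
    (∀ {o} → o ∈ S → Exchangeable o (A o)) →
    ∃ λ S′ → Indep (set S′) × (∀ {o} → o ∈ S → Any (A o) S′) × All (λ q → ∃ λ o → A o q) S′
  independent-exchange {A = A} {S} ind ex
    with exchange-all {A = A} ⊥ os (Uniqueₚ.filter⁺ (_∈? S) (Uniqueₚ.allFin⁺ n)) (λ _ → ∉⊥)
           (λ o∈ → ex (proj₂ (∈-filter⁻ (_∈? S) {xs = allFin n} o∈))) (hereditary ⊆₁ ind)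
    where
    os = filter (_∈? S) (allFin n)
    ⊆₁ : ⊥ ∪ set os ⊆ S
    ⊆₁ x∈ with x∈p∪q⁻ ⊥ (set os) x∈
    ... | inj₁ x∈⊥  = ⊥-elim (∉⊥ x∈⊥)
    ... | inj₂ x∈os = proj₂ (∈-filter⁻ (_∈? S) {xs = allFin n} (∈-set⁻ os x∈os))
  ... | S′ , S′-ind , os⇒ , ⇒os =
    S′ , hereditary (x∈p∪q⁺ ∘ inj₂) S′-ind , (λ {o} o∈ → All.lookup os⇒ (∈-filter⁺ (_∈? S) (∈-allFin o) o∈)) ,
    All.map (λ h → proj₁ (Any.satisfied h) , proj₂ (Any.satisfied h)) ⇒os

-- Double counting: `total` counts each x once for every c that covers it, hence at least once.
length≤-cover : ∀ {R : B → Pred A q} (R? : ∀ c → Decidable (R c)) cs k xs →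
  All (λ x → Any (λ c → R c x) cs) xs → (∀ c → length (filter (R? c) xs) ℕ.≤ k) → length xs ℕ.≤ length cs ℕ.* k
length≤-cover {B = B} {A = A} {R = R} R? cs k xs covered small =
  ℕₚ.≤-trans (go xs covered) (total≤ cs)
  where
  total : List B → List A → ℕ
  total []       xs = 0
  total (c ∷ cs) xs = length (filter (R? c) xs) ℕ.+ total cs xs
  total≤ : ∀ cs → total cs xs ℕ.≤ length cs ℕ.* k
  total≤ []       = ℕ.z≤n
  total≤ (c ∷ cs) = ℕₚ.+-mono-≤ (small c) (total≤ cs)
  weak : ∀ c x xs → length (filter (R? c) xs) ℕ.≤ length (filter (R? c) (x ∷ xs))
  weak c x xs with R? c x
  ... | yes _ = ℕₚ.n≤1+n _
  ... | no  _ = ℕₚ.≤-refl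
  total-weak : ∀ cs x xs → total cs xs ℕ.≤ total cs (x ∷ xs)
  total-weak []       x xs = ℕ.z≤n
  total-weak (c ∷ cs) x xs = ℕₚ.+-mono-≤ (weak c x xs) (total-weak cs x xs)
  total-< : ∀ {cs x} xs → Any (λ c → R c x) cs → suc (total cs xs) ℕ.≤ total cs (x ∷ xs)
  total-< {c ∷ cs} {x} xs (here Rcx) with R? c x
  ... | yes _  = ℕ.s≤s (ℕₚ.+-monoʳ-≤ (length (filter (R? c) xs)) (total-weak cs x xs))
  ... | no ¬R  = ⊥-elim (¬R Rcx)
  total-< {c ∷ cs} {x} xs (there any) = ℕₚ.≤-trans
    (ℕₚ.≤-reflexive (≡.sym (ℕₚ.+-suc (length (filter (R? c) xs)) (total cs xs))))
    (ℕₚ.+-mono-≤ (weak c x xs) (total-< xs any))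
  go : ∀ xs → All (λ x → Any (λ c → R c x) cs) xs → length xs ℕ.≤ total cs xs
  go []       []          = ℕ.z≤n
  go (x ∷ xs) (any ∷ all) = ℕₚ.≤-trans (ℕ.s≤s (go xs all)) (total-< xs any)

-- Costs, packings and coverings

module Extremum {c ℓ₁ ℓ₂ : Level} (𝓡 : ArchimedeanField c ℓ₁ ℓ₂) where

  open ArchimedeanField 𝓡
  open OrderedField 𝓡
  open RMC 𝓡
  open Extrema ≤-totalOrder

  module _ {r} {P : Pred A p} (P? : Decidable P) {R : A → Carrier → Set r}
           (value : ∀ {a} → P a → ∃ (R a)) (unique : ∀ {a x y} → R a x → R a y → x ≤ y)
           (xs : List A) (complete : ∀ a → a ∈ˡ xs) {a₀ : A} (Pa₀ : P a₀) where

    private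
      key : A → Carrier
      key a with P? a
      ... | yes Pa = proj₁ (value Pa)
      -- A filler: the search runs over elements satisfying `P` only, starting with `a₀`.
      ... | no _   = 0#

      key-R : ∀ {a} → P a → R a (key a)
      key-R {a} Pa with P? a
      ... | yes Pa′ = proj₂ (value Pa′)
      ... | no ¬Pa  = ⊥-elim (¬Pa Pa)

      candidates = filter P? xs

    minimum : ∃ λ x → IsMin (λ x → ∃ λ a → P a × R a x) x
    minimum = key best , (best , P-best , key-R P-best) , least
      where
      best = argmin key a₀ candidates
      P-best = argmin-all key {xs = candidates} Pa₀ (Allₚ.all-filter P? xs)
      least : ∀ y → (∃ λ a → P a × R a y) → key best ≤ y
      least y (a , Pa , Ray) = ≤-trans
        (All.lookup (f[argmin]≤f[xs] {f = key} a₀ candidates) (∈-filter⁺ P? (complete a) Pa))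
        (unique (key-R Pa) Ray)

    maximum : ∃ λ x → IsMax (λ x → ∃ λ a → P a × R a x) x
    maximum = key best , (best , P-best , key-R P-best) , greatest
      where
      best = argmax key a₀ candidates
      P-best = argmax-all key {xs = candidates} Pa₀ (Allₚ.all-filter P? xs)
      greatest : ∀ y → (∃ λ a → P a × R a y) → y ≤ key best
      greatest y (a , Pa , Ray) = ≤-trans (unique Ray (key-R Pa))
        (All.lookup (f[xs]≤f[argmax] {f = key} a₀ candidates) (∈-filter⁺ P? (complete a) Pa))

module MetricGeometry {c ℓ₁ ℓ₂ : Level} (𝓡 : ArchimedeanField c ℓ₁ ℓ₂) {n : ℕ} (V : RMC.Metric 𝓡 n) where

  open ArchimedeanField 𝓡
  open OrderedField 𝓡
  open ≤-Reasoning
  open RMC 𝓡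
  open Extremum 𝓡
  open Metric V public
  open IsGeneralMetric isMetric public using (triangle; ≈⇒0) renaming (nonNegative to 0≤d; sym to d-sym)

  d-swap : ∀ {x y t} → d x y ≤ t → d y x ≤ t
  d-swap {x} {y} = ≤-trans (≤-reflexive (d-sym y x))

  d-self : ∀ x {t} → 0# ≤ t → d x x ≤ t
  d-self x = ≤-trans (≤-reflexive (≈⇒0 ≡.refl))

  d-via : ∀ {x} y {z s t} → d x y ≤ s → d y z ≤ t → d x z ≤ s + t
  d-via {x} y {z} le₁ le₂ = ≤-trans (triangle x y z) (+-mono-≤ le₁ le₂)

  IsDist-exists : ∀ i {S} → Nonempty S → ∃ (IsDist V i S)
  IsDist-exists i {S} (_ , j∈) = minimum (_∈? S) {R = λ j x → x ≈ d i j} (λ {j} _ → d i j , Eq.refl)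
    (λ x≈ y≈ → ≤-reflexive (Eq.trans x≈ (Eq.sym y≈))) (allFin n) ∈-allFin j∈

  IsDist-unique : ∀ i {S x y} → IsDist V i S x → IsDist V i S y → x ≤ y
  IsDist-unique i (_ , x≤) (y∈ , _) = x≤ _ y∈

  IsRadius-exists : ∀ {X S} → Nonempty X → Nonempty S → ∃ (IsRadius V X S)
  IsRadius-exists {X} {S} (_ , i∈) S≢∅ = maximum (_∈? X) {R = λ i → IsDist V i S} (λ {i} _ → IsDist-exists i S≢∅)
    (λ {i} → IsDist-unique i) (allFin n) ∈-allFin i∈

  IsRadius-unique : ∀ X S {x y} → IsRadius V X S x → IsRadius V X S y → x ≤ y
  IsRadius-unique X S (x∈ , _) (_ , ≤y) = ≤y _ x∈

  Covers : Subset n → Carrier → Subset n → Set ℓ₂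
  Covers S ρ X = ∀ {i} → i ∈ X → ∃ λ j → j ∈ S × d i j ≤ ρ

  IsRadius⇒Covers : ∀ {X S x} → IsRadius V X S x → Covers S x X
  IsRadius⇒Covers {X} {S} {x} ((_ , _ , (s , s∈ , _) , _) , greatest) {i} i∈
    with IsDist-exists i (s , s∈)
  ... | y , y-dist@((j , j∈ , y≈) , _) =
    j , j∈ , ≤-trans (≤-reflexive (Eq.sym y≈)) (greatest y (i , i∈ , y-dist))

  Covers⇒IsRadius≤ : ∀ {X S x ρ} → IsRadius V X S x → Covers S ρ X → x ≤ ρ
  Covers⇒IsRadius≤ ((i , i∈ , _ , least) , _) cov with cov i∈
  ... | j , j∈ , le = ≤-trans (least _ (j , j∈ , Eq.refl)) le

  module _ (z : ℕ) (z<n : z ℕ.< n) where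

    private
      large? : Decidable {A = Subset n} λ X → n ℕ.∸ z ℕ.≤ ∣ X ∣
      large? X = n ℕ.∸ z ℕₚ.≤? ∣ X ∣

    large⇒nonempty : ∀ (X : Subset n) → n ℕ.∸ z ℕ.≤ ∣ X ∣ → Nonempty X
    large⇒nonempty X le with nonempty? X
    ... | yes X≢∅ = X≢∅
    ... | no  X≡∅ = ⊥-elim (ℕₚ.<⇒≱ (ℕₚ.m<n⇒0<n∸m z<n)
      (ℕₚ.≤-trans le (ℕₚ.≤-reflexive (≡.trans (≡.cong ∣_∣ (Empty-unique X≡∅)) (∣⊥∣≡0 n)))))

    large⇒∣∁∣≤z : ∀ (X : Subset n) → n ℕ.∸ z ℕ.≤ ∣ X ∣ → ∣ ∁ X ∣ ℕ.≤ z
    large⇒∣∁∣≤z X large = ℕₚ.≤-trans (ℕₚ.≤-reflexive (∣∁p∣≡n∸∣p∣ X))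
      (ℕₚ.≤-trans (ℕₚ.∸-monoʳ-≤ n large) (ℕₚ.≤-reflexive (ℕₚ.m∸[m∸n]≡n (ℕₚ.<⇒≤ z<n))))

    IsCost-exists : ∀ {S} (X : Subset n) → n ℕ.∸ z ℕ.≤ ∣ X ∣ → Nonempty S → ∃ (IsCost V z S)
    IsCost-exists {S} X large S≢∅ = minimum large? {R = λ X → IsRadius V X S}
      (λ {X} l → IsRadius-exists (large⇒nonempty X l) S≢∅) (λ {X} → IsRadius-unique X S)
      (allSubsets n) ∈-allSubsets {X} large

    IsCost-unique : ∀ S {x y} → IsCost V z S x → IsCost V z S y → x ≤ y
    IsCost-unique S (_ , x≤) (y∈ , _) = x≤ _ y∈

    IsCost⇒Covers : ∀ {S x} → IsCost V z S x → ∃ λ (X : Subset n) → n ℕ.∸ z ℕ.≤ ∣ X ∣ × Covers S x X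
    IsCost⇒Covers {S} {x} ((X , large , rad) , _) = X , large , λ {i} → IsRadius⇒Covers {X} {S} {x} rad {i}

    IsCost⇒nonempty : ∀ {S x} → IsCost V z S x → Nonempty S
    IsCost⇒nonempty ((_ , _ , (_ , _ , (s , s∈ , _) , _) , _) , _) = s , s∈

    Covers⇒IsCost≤ : ∀ {S x ρ} (X : Subset n) → IsCost V z S x → n ℕ.∸ z ℕ.≤ ∣ X ∣ → Covers S ρ X → x ≤ ρ
    Covers⇒IsCost≤ {S} {x} {ρ} X cost large cov =
      ≤-trans (proj₂ cost _ (X , large , proj₂ radius)) (Covers⇒IsRadius≤ {X} {S} {_} {ρ} (proj₂ radius) cov)
      where
      radius : ∃ (IsRadius V X S)
      radius = IsRadius-exists {X} {S} (large⇒nonempty X large) (IsCost⇒nonempty {S} {x} cost)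

    -- The empty set has no cost, its distances being infinite. So the search is over nonempty
    -- independent sets, and this loses no competitor.
    IsOptimum-exists : ∀ (M : Matroid n) {S} (X : Subset n) → n ℕ.∸ z ℕ.≤ ∣ X ∣ →
      Matroid.Indep M S → Nonempty S → ∃ (IsOptimum V M z)
    IsOptimum-exists M {S} X large ind S≢∅ =
      _ , optimum (proj₂ (minimum (λ S → Matroid.indep? M S ×-dec nonempty? S) {R = λ S → IsCost V z S}
        (λ {S} (_ , S≢∅) → IsCost-exists {S} X large S≢∅) (λ {S} → IsCost-unique S)
        (allSubsets n) ∈-allSubsets {S} (ind , S≢∅)))
      where
      optimum : ∀ {x} → IsMin (λ x → ∃ λ S → (Matroid.Indep M S × Nonempty S) × IsCost V z S x) x →
        IsOptimum V M z x
      optimum ((S , (S-ind , _) , cost) , least) =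
        (S , S-ind , cost) , λ y (T , T-ind , T-cost) → least y (T , (T-ind , IsCost⇒nonempty {T} {y} T-cost) , T-cost)

    -- If ν > 2ρ, then no two points of xs in X share a center in S, and at
    -- most z points lie outside X.
    packing-bound : ∀ S (X : Subset n) {ρ k ν} xs → ∣ S ∣ ℕ.≤ k → n ℕ.∸ z ℕ.≤ ∣ X ∣ → Covers S ρ X →
      AllPairs (λ x y → ν ≤ d x y) xs → ¬ (ν ≤ 0#) → k ℕ.+ z ℕ.< length xs → ν ≤ ρ + ρ
    packing-bound S X {ρ} {k} {ν} xs |S|≤k large cov sep ν≰0 long with ν ≤? (ρ + ρ)
    ... | yes ν≤ = ν≤
    ... | no ν≰  = ⊥-elim (ℕₚ.<⇒≱ long (ℕₚ.≤-trans (split xs) (ℕₚ.+-mono-≤ inside outside)))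
      where
      -- A repeated entry would be at distance 0 from itself, which a positive ν excludes.
      -- Distinctness is what allows the entries outside `X` to be counted.
      xs-unique : Unique xs
      xs-unique = AllPairs.map (λ { ν≤ ≡.refl → ν≰0 (≤-trans ν≤ (≤-reflexive (≈⇒0 ≡.refl))) }) sep
      split : ∀ xs → length xs ℕ.≤ length (filter (_∈? X) xs) ℕ.+ length (filter (¬? ∘ (_∈? X)) xs)
      split [] = ℕ.z≤n
      split (x ∷ xs) with x ∈? X
      ... | yes _ = ℕ.s≤s (split xs)
      ... | no  _ = ℕₚ.≤-trans (ℕ.s≤s (split xs)) (ℕₚ.≤-reflexive (≡.sym (ℕₚ.+-suc _ _)))
      centers : ∀ ys → All (_∈ X) ys → AllPairs (λ x y → ν ≤ d x y) ys →
        ∃ λ cs → length ys ℕ.≤ length cs × Unique cs × All (λ c → c ∈ S × Any (λ y → d y c ≤ ρ) ys) cs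
      centers [] _ _ = [] , ℕ.z≤n , [] , []
      centers (y ∷ ys) (y∈ ∷ ys∈) (y-sep ∷ ys-sep) with cov y∈ | centers ys ys∈ ys-sep
      ... | s , s∈ , y-s | cs , long , u , cs-ok =
        s ∷ cs , ℕ.s≤s long , All.map s≢ cs-ok ∷ u ,
        (s∈ , here y-s) ∷ All.map (λ (c∈ , any) → c∈ , there any) cs-ok
        where
        s≢ : ∀ {c} → c ∈ S × Any (λ y → d y c ≤ ρ) ys → s ≢ c
        s≢ (_ , any) ≡.refl with Allₚ.All¬⇒¬Any (All.map (λ ν≤ y′-s → ν≰ (≤-trans ν≤ (d-via s y-s (d-swap y′-s)))) y-sep)
        ... | ¬any = ¬any any
      inside : length (filter (_∈? X) xs) ℕ.≤ k
      inside with centers (filter (_∈? X) xs) (Allₚ.all-filter (_∈? X) xs) (AllPairsₚ.filter⁺ (_∈? X) sep)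
      ... | cs , long , u , ok = ℕₚ.≤-trans long (ℕₚ.≤-trans (length-Unique-≤ u (λ c∈ → proj₁ (All.lookup ok c∈))) |S|≤k)
      outside : length (filter (¬? ∘ (_∈? X)) xs) ℕ.≤ z
      outside = ℕₚ.≤-trans
        (length-Unique-≤ {S = ∁ X} (Uniqueₚ.filter⁺ (¬? ∘ (_∈? X)) xs-unique)
          (λ x∈ → x∉p⇒x∈∁p (proj₂ (∈-filter⁻ (¬? ∘ (_∈? X)) {xs = xs} x∈))))
        (large⇒∣∁∣≤z X large)

  -- This is r / 2^j. The halving comes before the recursive call so that it follows the recursion
  -- of `cover-balls-iterated`.
  halvings : ℕ → Carrier → Carrier
  halvings zero    r = r
  halvings (suc j) r = halvings j (r * fromℕ 2 ⁻¹)

  module _ {Λ : ℕ} (cover : HalfBallCover V Λ) where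

    cover-balls : ∀ (P : Pred (Fin n) p) cs r → (∀ {x} → P x → Any (λ c → InBall V c r x) cs) →
      ∃ λ cs′ → length cs′ ℕ.≤ length cs ℕ.* Λ × (∀ {x} → P x → Any (λ c → InBall V c (r * fromℕ 2 ⁻¹) x) cs′)
    cover-balls P cs r covered = concatMap half cs , lengths cs , λ Px → Anyₚ.concat⁺ (Anyₚ.map⁺ (Any.map (λ {c} x∈ → proj₂ (proj₂ (cover c r)) _ x∈) (covered Px)))
      where
      half = λ c → proj₁ (cover c r)
      lengths : ∀ cs → length (concatMap half cs) ℕ.≤ length cs ℕ.* Λ
      lengths [] = ℕ.z≤n
      lengths (c ∷ cs) = ℕₚ.≤-trans (ℕₚ.≤-reflexive (Listₚ.length-++ (half c)))
        (ℕₚ.+-mono-≤ (proj₁ (proj₂ (cover c r))) (lengths cs))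

    cover-balls-iterated : ∀ j (P : Pred (Fin n) p) cs r → (∀ {x} → P x → Any (λ c → InBall V c r x) cs) →
      ∃ λ cs′ → length cs′ ℕ.≤ length cs ℕ.* Λ ℕ.^ j × (∀ {x} → P x → Any (λ c → InBall V c (halvings j r) x) cs′)
    cover-balls-iterated zero P cs r covered = cs , ℕₚ.≤-reflexive (≡.sym (ℕₚ.*-identityʳ _)) , covered
    cover-balls-iterated (suc j) P cs r covered with cover-balls P cs r covered
    ... | cs₁ , len₁ , covered₁ with cover-balls-iterated j P cs₁ (r * fromℕ 2 ⁻¹) covered₁
    ...   | cs₂ , len₂ , covered₂ = cs₂ , ℕₚ.≤-trans len₂ (ℕₚ.≤-trans (ℕₚ.*-monoˡ-≤ (Λ ℕ.^ j) len₁)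
      (ℕₚ.≤-reflexive (ℕₚ.*-assoc (length cs) Λ (Λ ℕ.^ j)))) , covered₂

    -- A ball of radius 0 contains its center, so that at least one ball is needed to cover it.
    1≤cover : Fin n → 1 ℕ.≤ Λ
    1≤cover i with cover i 0#
    ... | cs , len , covered with cs | covered i (d-self i ≤-refl)
    ...   | _ ∷ _ | _ = ℕₚ.≤-trans (ℕ.s≤s ℕ.z≤n) len

-- The program

-- cmp false α a b c d asks whether α · d(a,b) ≤ d(c,d), and cmp true whether
-- α · d(a,b) < d(c,d); ind true asks for independence, ind false for
-- dependence.
data Query (A : Set) : Set where
  cmp : Bool → ℕ → A → A → A → A → Query A
  ind : Bool → List A → Query A

mapQuery : (A → B) → Query A → Query B
mapQuery g (cmp s α a b c d) = cmp s α (g a) (g b) (g c) (g d)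
mapQuery g (ind e xs)        = ind e (map g xs)

-- Never succeeds, as ∅ is independent.
fail : List (Query A)
fail = ind false [] ∷ []

-- The digits act as a characteristic vector. Every nonzero digit means membership, as the
-- enumeration of candidates also produces digits above 1.
select : List ℕ → List A → List A
select (zero  ∷ fs) (x ∷ xs) = select fs xs
select (suc _ ∷ fs) (x ∷ xs) = x ∷ select fs xs
select _            _        = []

get : List A → ℕ → Maybe A
get []       _       = nothing
get (x ∷ xs) zero    = just x
get (x ∷ xs) (suc i) = get xs i

nth : A → List A → ℕ → A
nth x₀ xs i = fromMaybe x₀ (get xs i)

pairs : List A → List (A × A)
pairs []       = []
pairs (x ∷ xs) = map (x ,_) xs ++ pairs xs

-- The value nothing of an assignment marks an outlier.

assigned : List A → List (Maybe A) → List (A × A)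
assigned (p ∷ ps) (just s  ∷ σ) = (p , s) ∷ assigned ps σ
assigned (p ∷ ps) (nothing ∷ σ) = assigned ps σ
assigned _        _             = []

outlierWeight : List ℕ → List (Maybe A) → ℕ
outlierWeight (w ∷ ws) (just _  ∷ σ) = outlierWeight ws σ
outlierWeight (w ∷ ws) (nothing ∷ σ) = w ℕ.+ outlierWeight ws σ
outlierWeight _        _             = 0

-- The memory holds points u ∷ v ∷ P with weights ws for P.  The current
-- scale is d(u,v).  Every phase searches all lists of as many digits as there
-- are points, a digit being a position in memory or one past its end:
-- · ins a tries to discard the point at position a of P, looking for an
--   independent set of nearby points before it that spans it;
-- · rai looks for more than k + z points whose pairwise distances are at least
--   d(x,y), where d(x,y) exceeds twice the scale;
-- · fin best looks for a solution of smaller radius d(x,y) than best.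
data Phase : Set where
  ins : ℕ → Phase
  rai : Phase
  fin : List ℕ → Phase

insChecks : A → A → List A → List A → List (Query A)
-- The position is past the last entry: every candidate has to fail, so that the search ends and the
-- phase becomes `rai`.
insChecks u v []      J = fail
insChecks u v (p ∷ _) J = ind true J ∷ ind false (p ∷ J) ∷ map (λ q → cmp false 8 p q u v) J

-- The number of selected points is visible to the program and costs no query. The first query is
-- strict, so that the new scale is positive and larger than the old one even if that is 0.
raiChecks : ℕ → A → A → A → A → List A → List (Query A)
raiChecks s u v x y S =
  if s ℕ.<ᵇ length S then cmp true 2 u v x y ∷ map (λ (a , b) → cmp false 1 x y a b) (pairs S) else fail

-- With no incumbent there is nothing to ask: every feasible candidate is an improvement.
better : A → List A → A → A → List ℕ → List (Query A)
better u pts x y (i ∷ j ∷ _) = cmp true 1 x y (nth u pts i) (nth u pts j) ∷ []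
better u pts x y _           = []

-- The candidate itself names its radius by the pair x, y. Two candidates can then be compared by a
-- single query, and the incumbent is stored in integer words alone. The outlier budget is a test on
-- integers and needs no query.
finChecks : ℕ → List (Query A) → A → A → List A → List ℕ → List (Maybe A) → List (Query A)
finChecks z improvement x y P ws σ =
  if outlierWeight ws σ ℕ.≤ᵇ z
  then ind true (map proj₂ (assigned P σ)) ∷ improvement ++ map (λ (p , s) → cmp false 1 p s x y) (assigned P σ)
  else fail

-- In every phase a candidate has two leading digits and one digit for each entry of P. In `ins` the
-- leading digits are ignored; the common shape allows one search procedure for all phases.
checks : (k z : ℕ) → List A → Phase → List ℕ → List ℕ → List (Query A)
checks k z pts@(u ∷ v ∷ P) (ins a)    ws (_ ∷ _ ∷ fs) = insChecks u v (drop a P) (select fs (take a P))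
checks k z pts@(u ∷ v ∷ P) rai        ws (i ∷ j ∷ fs) =
  raiChecks (k ℕ.+ z) u v (nth u pts i) (nth u pts j) (select fs P)
checks k z pts@(u ∷ v ∷ P) (fin best) ws (i ∷ j ∷ fs) =
  finChecks z (better u pts (nth u pts i) (nth u pts j) best) (nth u pts i) (nth u pts j) P ws (map (get pts) fs)
checks k z _ _ _ _ = fail

solution : List A → List ℕ → List A
solution pts@(u ∷ v ∷ P) (_ ∷ _ ∷ fs) = map proj₂ (assigned P (map (get pts) fs))
solution _               _            = []

-- Naturality of the queries

module _ (g : A → B) where

  map-select : ∀ fs xs → map g (select fs xs) ≡ select fs (map g xs)
  map-select []           xs       = refl
  map-select (zero  ∷ fs) []       = refl
  map-select (suc _ ∷ fs) []       = refl
  map-select (zero  ∷ fs) (x ∷ xs) = map-select fs xs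
  map-select (suc _ ∷ fs) (x ∷ xs) = cong (g x ∷_) (map-select fs xs)

  get-map : ∀ xs i → get (map g xs) i ≡ Maybe.map g (get xs i)
  get-map []       i       = refl
  get-map (x ∷ xs) zero    = refl
  get-map (x ∷ xs) (suc i) = get-map xs i

  nth-map : ∀ x₀ xs i → nth (g x₀) (map g xs) i ≡ g (nth x₀ xs i)
  nth-map x₀ xs i rewrite get-map xs i with get xs i
  ... | just _  = refl
  ... | nothing = refl

  map-get-map : ∀ xs is → map (get (map g xs)) is ≡ map (Maybe.map g) (map (get xs) is)
  map-get-map xs is = ≡.trans (Listₚ.map-cong (get-map xs) is) (Listₚ.map-∘ is)

  pairs-map : ∀ xs → pairs (map g xs) ≡ map (Product.map g g) (pairs xs)
  pairs-map []       = refl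
  pairs-map (x ∷ xs) = ≡.trans
    (cong₂ _++_ (≡.trans (≡.sym (Listₚ.map-∘ xs)) (Listₚ.map-∘ xs)) (pairs-map xs))
    (≡.sym (Listₚ.map-++ (Product.map g g) (map (x ,_) xs) (pairs xs)))

  assigned-map : ∀ ps σ → assigned (map g ps) (map (Maybe.map g) σ) ≡ map (Product.map g g) (assigned ps σ)
  assigned-map []       []            = refl
  assigned-map []       (_ ∷ _)       = refl
  assigned-map (p ∷ ps) []            = refl
  assigned-map (p ∷ ps) (just s  ∷ σ) = cong (_ ∷_) (assigned-map ps σ)
  assigned-map (p ∷ ps) (nothing ∷ σ) = assigned-map ps σ

  outlierWeight-map : ∀ ws (σ : List (Maybe A)) → outlierWeight ws (map (Maybe.map g) σ) ≡ outlierWeight ws σ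
  outlierWeight-map []       []            = refl
  outlierWeight-map []       (_ ∷ _)       = refl
  outlierWeight-map (w ∷ ws) []            = refl
  outlierWeight-map (w ∷ ws) (just s  ∷ σ) = outlierWeight-map ws σ
  outlierWeight-map (w ∷ ws) (nothing ∷ σ) = cong (w ℕ.+_) (outlierWeight-map ws σ)

  map-proj₂-assigned : ∀ ps σ →
    map proj₂ (assigned (map g ps) (map (Maybe.map g) σ)) ≡ map g (map proj₂ (assigned ps σ))
  map-proj₂-assigned ps σ = ≡.trans (cong (map proj₂) (assigned-map ps σ))
    (≡.trans (≡.sym (Listₚ.map-∘ (assigned ps σ))) (Listₚ.map-∘ (assigned ps σ)))

  solution-map : ∀ pts fs → solution (map g pts) fs ≡ map g (solution pts fs)
  solution-map []          _            = refl
  solution-map (_ ∷ [])    _            = refl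
  solution-map (_ ∷ _ ∷ _) []           = refl
  solution-map (_ ∷ _ ∷ _) (_ ∷ [])     = refl
  solution-map pts@(u ∷ v ∷ P) (_ ∷ _ ∷ fs) rewrite map-get-map pts fs = map-proj₂-assigned P (map (get pts) fs)

  insChecks-map : ∀ u v Q J → insChecks (g u) (g v) (map g Q) (map g J) ≡ map (mapQuery g) (insChecks u v Q J)
  insChecks-map u v []      J = refl
  insChecks-map u v (p ∷ _) J = cong (λ t → ind true (map g J) ∷ ind false (map g (p ∷ J)) ∷ t)
    (≡.trans (≡.sym (Listₚ.map-∘ J)) (Listₚ.map-∘ J))

  raiChecks-map : ∀ s u v x y S →
    raiChecks s (g u) (g v) (g x) (g y) (map g S) ≡ map (mapQuery g) (raiChecks s u v x y S)
  raiChecks-map s u v x y S rewrite Listₚ.length-map g S with s ℕ.<ᵇ length S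
  ... | false = refl
  ... | true  = cong (cmp true 2 (g u) (g v) (g x) (g y) ∷_)
    (≡.trans (cong (map _) (pairs-map S)) (≡.trans (≡.sym (Listₚ.map-∘ (pairs S))) (Listₚ.map-∘ (pairs S))))

  better-map : ∀ u pts x y best → better (g u) (map g pts) (g x) (g y) best ≡ map (mapQuery g) (better u pts x y best)
  better-map u pts x y []          = refl
  better-map u pts x y (_ ∷ [])    = refl
  better-map u pts x y (i ∷ j ∷ _) rewrite nth-map u pts i | nth-map u pts j = refl

  finChecks-map : ∀ z imp x y P ws σ →
    finChecks z (map (mapQuery g) imp) (g x) (g y) (map g P) ws (map (Maybe.map g) σ)
      ≡ map (mapQuery g) (finChecks z imp x y P ws σ)
  finChecks-map z imp x y P ws σ rewrite outlierWeight-map ws σ with outlierWeight ws σ ℕ.≤ᵇ z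
  ... | false = refl
  ... | true  = cong₂ _∷_ (cong (ind true) (map-proj₂-assigned P σ))
    (≡.trans (cong (map (mapQuery g) imp ++_)
      (≡.trans (cong (map _) (assigned-map P σ))
        (≡.trans (≡.sym (Listₚ.map-∘ (assigned P σ))) (Listₚ.map-∘ (assigned P σ)))))
      (≡.sym (Listₚ.map-++ (mapQuery g) imp _)))

  -- The program poses its queries about positions, whereas the invariants speak of points. With g
  -- the lookup of a position in memory, this identifies the two.
  checks-map : ∀ k z pts ph ws fs → checks k z (map g pts) ph ws fs ≡ map (mapQuery g) (checks k z pts ph ws fs)
  checks-map k z []          _       ws _        = refl
  checks-map k z (_ ∷ [])    _       ws _        = refl
  checks-map k z (_ ∷ _ ∷ _) (ins _) ws []       = refl
  checks-map k z (_ ∷ _ ∷ _) (ins _) ws (_ ∷ []) = refl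
  checks-map k z (_ ∷ _ ∷ _) rai     ws []       = refl
  checks-map k z (_ ∷ _ ∷ _) rai     ws (_ ∷ []) = refl
  checks-map k z (_ ∷ _ ∷ _) (fin _) ws []       = refl
  checks-map k z (_ ∷ _ ∷ _) (fin _) ws (_ ∷ []) = refl
  checks-map k z (u ∷ v ∷ P) (ins a) ws (_ ∷ _ ∷ fs)
    rewrite Listₚ.drop-map {f = g} a P | Listₚ.take-map {f = g} a P | ≡.sym (map-select fs (take a P)) =
    insChecks-map u v (drop a P) (select fs (take a P))
  checks-map k z pts@(u ∷ v ∷ P) rai ws (i ∷ j ∷ fs)
    rewrite nth-map u pts i | nth-map u pts j | ≡.sym (map-select fs P) =
    raiChecks-map (k ℕ.+ z) u v (nth u pts i) (nth u pts j) (select fs P)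
  checks-map k z pts@(u ∷ v ∷ P) (fin best) ws (i ∷ j ∷ fs)
    rewrite nth-map u pts i | nth-map u pts j | better-map u pts (nth u pts i) (nth u pts j) best | map-get-map pts fs =
    finChecks-map z (better u pts (nth u pts i) (nth u pts j) best) (nth u pts i) (nth u pts j) P ws (map (get pts) fs)

-- Counts down through the lists of digits at most B, least significant first.
decrement : ℕ → List ℕ → Maybe (List ℕ)
decrement B []           = nothing
decrement B (suc x ∷ xs) = just (x ∷ xs)
decrement B (zero  ∷ xs) = Maybe.map (B ∷_) (decrement B xs)

Decrement : ℕ → List ℕ → List ℕ → Set
Decrement B xs ys = decrement B xs ≡ just ys

decrement-length : ∀ B xs {ys} → Decrement B xs ys → length ys ≡ length xs
decrement-length B (suc x ∷ xs) refl = refl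
decrement-length B (zero  ∷ xs) eq with decrement B xs in eq′
decrement-length B (zero  ∷ xs) refl | just ys = cong suc (decrement-length B xs eq′)

decrement-≤ : ∀ B xs {ys} → All (ℕ._≤ B) xs → Decrement B xs ys → All (ℕ._≤ B) ys
decrement-≤ B (suc x ∷ xs) (x< ∷ xs≤) refl = ℕₚ.<⇒≤ x< ∷ xs≤
decrement-≤ B (zero  ∷ xs) (_  ∷ xs≤) eq with decrement B xs in eq′
decrement-≤ B (zero  ∷ xs) (_  ∷ xs≤) refl | just ys = ℕₚ.≤-refl ∷ decrement-≤ B xs xs≤ eq′

decrement-zeros : ∀ B l → decrement B (replicate l 0) ≡ nothing
decrement-zeros B zero    = refl
decrement-zeros B (suc l) rewrite decrement-zeros B l = refl

-- Induction on the number of digits: for each value of the higher digits the lowest one runs from B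
-- down to 0 and then borrows.
countdown : ∀ B ys → All (ℕ._≤ B) ys → Star (Decrement B) (replicate (length ys) B) ys
countdown B []       []         = nil
countdown B (y ∷ ys) (y≤ ∷ ys≤) = tail (countdown B ys ys≤)
  where
  lower : ∀ {n m xs} → m ℕ.≤′ n → Star (Decrement B) (n ∷ xs) (m ∷ xs)
  lower (ℕ.≤′-reflexive refl) = nil
  lower (ℕ.≤′-step m≤n)       = refl ◅ lower m≤n
  tail : ∀ {xs} → Star (Decrement B) xs ys → Star (Decrement B) (B ∷ xs) (y ∷ ys)
  tail nil = lower (ℕₚ.≤⇒≤′ y≤)
  tail {xs} (step ◅ steps) = lower (ℕₚ.≤⇒≤′ ℕ.z≤n) ◅◅ (borrow xs step ◅ tail steps)
    where
    borrow : ∀ xs {xs′} → Decrement B xs xs′ → Decrement B (zero ∷ xs) (B ∷ xs′)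
    borrow xs eq rewrite eq = refl

-- The field `position` is the index of the next check of `candidate`; `dirty` tells that the reals
-- left by a comparison have to be cleared. An empty `candidate` means that the search is exhausted.
record State : Set where
  constructor state
  field
    phase     : Phase
    weights   : List ℕ
    candidate : List ℕ
    position  : ℕ
    dirty     : ℕ

code arg : Phase → ℕ
code (ins _) = 0
code rai     = 1
code (fin _) = 2
arg (ins a) = a
arg _       = 0

incumbent : Phase → List ℕ
incumbent (fin best) = best
incumbent _          = []

phaseOf : ℕ → ℕ → List ℕ → Phase
phaseOf 0 a best = ins a
phaseOf 1 a best = rai
phaseOf _ a best = fin best

-- Six header words come first. The two lengths among them delimit the weights and the incumbent,
-- and the candidate is whatever remains.
encode : State → List ℕ
encode (state ph ws cand c d) =
  code ph ∷ arg ph ∷ c ∷ d ∷ length ws ∷ length (incumbent ph) ∷ ws ++ incumbent ph ++ cand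

decode : List ℕ → State
decode (co ∷ a ∷ c ∷ d ∷ lw ∷ lb ∷ rest) =
  state (phaseOf co a (take lb (drop lw rest))) (take lw rest) (drop lb (drop lw rest)) c d
decode _ = state rai [] [] 0 0

take-length-++ : ∀ (xs ys : List A) → take (length xs) (xs ++ ys) ≡ xs
take-length-++ []       ys = refl
take-length-++ (x ∷ xs) ys = cong (x ∷_) (take-length-++ xs ys)

drop-length-++ : ∀ (xs ys : List A) → drop (length xs) (xs ++ ys) ≡ ys
drop-length-++ []       ys = refl
drop-length-++ (x ∷ xs) ys = drop-length-++ xs ys

decode-encode : ∀ S → decode (encode S) ≡ S
decode-encode (state ph ws cand c d)
  rewrite take-length-++ ws (incumbent ph ++ cand) | drop-length-++ ws (incumbent ph ++ cand)
        | take-length-++ (incumbent ph) cand | drop-length-++ (incumbent ph) cand = phase-eq ph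
  where
  phase-eq : ∀ ph → state (phaseOf (code ph) (arg ph) (incumbent ph)) ws cand c d ≡ state ph ws cand c d
  phase-eq (ins _) = refl
  phase-eq rai     = refl
  phase-eq (fin _) = refl

addToFirst : List ℕ → ℕ → List ℕ → List ℕ
addToFirst (zero  ∷ fs) w (x ∷ xs) = x ∷ addToFirst fs w xs
addToFirst (suc _ ∷ fs) w (x ∷ xs) = x ℕ.+ w ∷ xs
addToFirst _            w xs       = xs

mergeWeights : List ℕ → List ℕ → List ℕ → List ℕ
mergeWeights fs ws₁ []         = ws₁
mergeWeights fs ws₁ (w ∷ ws₂) = addToFirst fs w ws₁ ++ ws₂

fresh : ℕ → Phase → List ℕ → List ℕ
fresh N ph ws = encode (state ph ws (replicate N N) 0 0)

-- Instructions

module Algorithm {c ℓ₁ ℓ₂ : Level} (𝓡 : ArchimedeanField c ℓ₁ ℓ₂) where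

  open ArchimedeanField 𝓡 using (fromℕ)
  open RMC 𝓡

  Instruction : ℕ → ℕ → Set c
  Instruction N s = Operation N s × (Bool → List ℕ)

  idle : ∀ {N s} → Instruction N s
  idle = skip , λ _ → []

  found : ∀ {N s} → List (Fin N) → Phase → List ℕ → List ℕ → Instruction N s
  -- The position `a` stays as it is: the next entry moves into the place of the discarded one.
  found {N} pts (ins a) ws cand =
    keepPoints (take (2 ℕ.+ a) pts ++ drop (3 ℕ.+ a) pts) ,
    λ _ → fresh (ℕ.pred N) (ins a) (mergeWeights (drop 2 cand) (take a ws) (drop a ws))
  -- At a new scale all entries have to be examined again, hence `ins 0`.
  found {N} pts@(u ∷ v ∷ P) rai ws (i ∷ j ∷ _) =
    keepPoints (nth u pts i ∷ nth u pts j ∷ P) , λ _ → fresh N (ins 0) ws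
  found {N} pts (fin best) ws cand = skip , λ _ → fresh N (fin cand) ws
  found _ _ _ _ = idle

  exhausted : ∀ {N s} → List (Fin N) → Phase → List ℕ → Instruction N s
  exhausted {N} pts (ins a)    ws =
    skip , λ _ → fresh N (if a ℕ.<ᵇ length ws then ins (suc a) else rai) ws
  -- The scale is unchanged, so only the new point, which is the last entry, has to be examined. At
  -- the end of the stream the final search starts without an incumbent.
  exhausted {N} pts rai        ws = read , λ where
    true  → fresh (suc N) (ins (length ws)) (ws ++ 1 ∷ [])
    false → fresh N (fin []) ws
  exhausted {N} pts (fin best) ws = halt (solution pts best) , λ _ → []

  advance : ℕ → State → ℕ → Bool → List ℕ
  advance N (state ph ws cand c _) d true  = encode (state ph ws cand (suc c) d)
  advance N (state ph ws cand c _) d false = encode (state ph ws (fromMaybe [] (decrement N cand)) 0 d)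

  agree : Bool → Bool → Bool
  agree true  b = b
  agree false b = not b

  -- During a comparison the number of stored reals serves as the program counter: each of the first
  -- four instructions appends a real, and the fifth compares the third with the fourth.
  ask : ∀ {N} s → State → Query (Fin N) → Instruction N s
  ask {N} s S (ind e xs)        = independent xs , λ b → advance N S 0 (agree e b)
  ask 0   S (cmp _ α a b c d)   = distance a b , λ _ → encode S
  ask 1   S (cmp _ α a b c d)   = constant (fromℕ α) , λ _ → encode S
  ask 2   S (cmp _ α a b c d)   = mul (Fin.suc Fin.zero) Fin.zero , λ _ → encode S
  ask 3   S (cmp _ α a b c d)   = distance c d , λ _ → encode S
  ask {N} 4 S (cmp false α a b c d) =
    compare (Fin.suc (Fin.suc Fin.zero)) (Fin.suc (Fin.suc (Fin.suc Fin.zero))) , advance N S 1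
  ask {N} 4 S (cmp true  α a b c d) =
    compare (Fin.suc (Fin.suc (Fin.suc Fin.zero))) (Fin.suc (Fin.suc Fin.zero)) , λ b → advance N S 1 (not b)
  ask _   S (cmp _ _ _ _ _ _)   = idle

  dispatch : ∀ {N s} → State → List (Query (Fin N)) → Instruction N s
  dispatch {N} (state ph ws cand c d) []      = found (allFin N) ph ws cand
  dispatch     S                      (q ∷ _) = ask _ S q

  exec : (k z N s : ℕ) → State → Instruction N s
  exec k z N s (state ph ws cand       c (suc _)) = keepReals [] , λ _ → encode (state ph ws cand c 0)
  exec k z N s (state ph ws []         c zero)    = exhausted (allFin N) ph ws
  exec k z N s (state ph ws cand@(_ ∷ _) c zero)  =
    dispatch (state ph ws cand c zero) (drop c (checks k z (allFin N) ph ws cand))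

  algorithm : (k z : ℕ) → Program
  algorithm k z 0 s ws = read , λ _ → []
  -- The first point becomes u, v and the only entry, so that the initial scale is 0.
  algorithm k z 1 s ws = keepPoints (Fin.zero ∷ Fin.zero ∷ Fin.zero ∷ []) , λ _ → fresh 3 (ins 0) (1 ∷ [])
  algorithm k z N@(suc (suc _)) s ws = exec k z N s (decode ws)

-- Runs of the program

length-select : ∀ fs (xs : List A) → length (select fs xs) ℕ.≤ length xs
length-select []           xs       = ℕ.z≤n
length-select (zero  ∷ fs) []       = ℕ.z≤n
length-select (suc _ ∷ fs) []       = ℕ.z≤n
length-select (zero  ∷ fs) (x ∷ xs) = ℕₚ.m≤n⇒m≤1+n (length-select fs xs)
length-select (suc _ ∷ fs) (x ∷ xs) = ℕ.s≤s (length-select fs xs)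

length-pairs : ∀ (xs : List A) → length (pairs xs) ℕ.≤ length xs ℕ.* length xs
length-pairs []       = ℕ.z≤n
length-pairs (x ∷ xs) = begin
  length (map (x ,_) xs ++ pairs xs)  ≡⟨ Listₚ.length-++ (map (x ,_) xs) ⟩
  length (map (x ,_) xs) ℕ.+ length (pairs xs)  ≡⟨ cong (ℕ._+ _) (Listₚ.length-map (x ,_) xs) ⟩
  l ℕ.+ length (pairs xs)             ≤⟨ ℕₚ.+-mono-≤ (ℕₚ.n≤1+n l) (length-pairs xs) ⟩
  suc l ℕ.+ l ℕ.* l                   ≤⟨ ℕₚ.+-monoʳ-≤ (suc l) (ℕₚ.*-monoʳ-≤ l (ℕₚ.n≤1+n l)) ⟩
  suc l ℕ.+ l ℕ.* suc l               ∎
  where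
  open ℕₚ.≤-Reasoning
  l = length xs

length-assigned : ∀ (ps : List A) σ → length (assigned ps σ) ℕ.≤ length ps
length-assigned []       []            = ℕ.z≤n
length-assigned []       (_ ∷ _)       = ℕ.z≤n
length-assigned (p ∷ ps) []            = ℕ.z≤n
length-assigned (p ∷ ps) (just _  ∷ σ) = ℕ.s≤s (length-assigned ps σ)
length-assigned (p ∷ ps) (nothing ∷ σ) = ℕₚ.m≤n⇒m≤1+n (length-assigned ps σ)

-- Needed because the index of the current check is an integer word, whose value is bounded. The
-- square comes from the pairs compared in `rai`.
length-checks : ∀ k z (pts : List A) ph ws fs → let N = length pts in
  length (checks k z pts ph ws fs) ℕ.≤ 3 ℕ.+ N ℕ.+ N ℕ.* N
length-checks k z []          _       ws _        = ℕ.s≤s ℕ.z≤n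
length-checks k z (_ ∷ [])    _       ws _        = ℕ.s≤s ℕ.z≤n
length-checks k z (_ ∷ _ ∷ _) (ins _) ws []       = ℕ.s≤s ℕ.z≤n
length-checks k z (_ ∷ _ ∷ _) (ins _) ws (_ ∷ []) = ℕ.s≤s ℕ.z≤n
length-checks k z (_ ∷ _ ∷ _) rai     ws []       = ℕ.s≤s ℕ.z≤n
length-checks k z (_ ∷ _ ∷ _) rai     ws (_ ∷ []) = ℕ.s≤s ℕ.z≤n
length-checks k z (_ ∷ _ ∷ _) (fin _) ws []       = ℕ.s≤s ℕ.z≤n
length-checks k z (_ ∷ _ ∷ _) (fin _) ws (_ ∷ []) = ℕ.s≤s ℕ.z≤n
length-checks k z (u ∷ v ∷ P) (ins a) ws (_ ∷ _ ∷ fs) with drop a P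
... | []    = ℕ.s≤s ℕ.z≤n
... | p ∷ _ = ℕ.s≤s (ℕ.s≤s (begin
  length (map _ J)      ≡⟨ Listₚ.length-map _ J ⟩
  length J              ≤⟨ length-select fs (take a P) ⟩
  length (take a P)     ≡⟨ Listₚ.length-take a P ⟩
  a ℕ.⊓ length P        ≤⟨ ℕₚ.m⊓n≤n a (length P) ⟩
  length P              ≤⟨ ℕₚ.m≤n+m (length P) 3 ⟩
  3 ℕ.+ length P        ≤⟨ ℕₚ.m≤m+n _ _ ⟩
  3 ℕ.+ length P ℕ.+ _  ∎))
  where
  open ℕₚ.≤-Reasoning
  J = select fs (take a P)
length-checks k z (u ∷ v ∷ P) rai ws (_ ∷ _ ∷ fs) with (k ℕ.+ z) ℕ.<ᵇ length (select fs P)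
... | false = ℕ.s≤s ℕ.z≤n
... | true  = ℕ.s≤s (begin
  length (map _ (pairs S))             ≡⟨ Listₚ.length-map _ (pairs S) ⟩
  length (pairs S)                     ≤⟨ length-pairs S ⟩
  length S ℕ.* length S                ≤⟨ ℕₚ.*-mono-≤ le le ⟩
  N ℕ.* N                              ≤⟨ ℕₚ.m≤n+m (N ℕ.* N) (2 ℕ.+ N) ⟩
  2 ℕ.+ N ℕ.+ N ℕ.* N                  ∎)
  where
  open ℕₚ.≤-Reasoning
  S = select fs P
  N = 2 ℕ.+ length P
  le : length S ℕ.≤ N
  le = ℕₚ.≤-trans (length-select fs P) (ℕₚ.m≤n+m _ 2)
length-checks {A} k z pts@(u ∷ v ∷ P) (fin best) ws (i ∷ j ∷ fs) with outlierWeight ws (map (get pts) fs) ℕ.≤ᵇ z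
... | false = ℕ.s≤s ℕ.z≤n
... | true  = ℕ.s≤s (begin
  length (better u pts x y best ++ map _ τ)          ≡⟨ Listₚ.length-++ (better u pts x y best) ⟩
  length (better u pts x y best) ℕ.+ length (map _ τ) ≤⟨ ℕₚ.+-mono-≤ (length-better best) (ℕₚ.≤-reflexive (Listₚ.length-map _ τ)) ⟩
  1 ℕ.+ length τ                                     ≤⟨ ℕ.s≤s (length-assigned P _) ⟩
  1 ℕ.+ length P                                     ≤⟨ ℕₚ.m≤n+m _ 3 ⟩
  4 ℕ.+ length P                                     ≤⟨ ℕₚ.m≤m+n _ _ ⟩
  2 ℕ.+ N ℕ.+ N ℕ.* N                                ∎)
  where
  open ℕₚ.≤-Reasoning
  N = 2 ℕ.+ length P
  x = nth u pts i
  y = nth u pts j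
  τ = assigned P (map (get pts) fs)
  length-better : ∀ best → length (better u pts x y best) ℕ.≤ 1
  length-better []          = ℕ.z≤n
  length-better (_ ∷ [])    = ℕ.z≤n
  length-better (_ ∷ _ ∷ _) = ℕₚ.≤-refl

drop-suc : ∀ c {xs : List A} {y ys} → drop c xs ≡ y ∷ ys → drop (suc c) xs ≡ ys × c ℕ.< length xs
drop-suc zero    {x ∷ xs} refl = refl , ℕ.s≤s ℕ.z≤n
drop-suc (suc c) {x ∷ xs} eq with drop-suc c {xs} eq
... | eq′ , c< = eq′ , ℕ.s≤s c<

-- prog stands for algorithm k z, of which nothing else is needed.
module Execution {c ℓ₁ ℓ₂ q : Level} (𝓡 : ArchimedeanField c ℓ₁ ℓ₂) {n : ℕ} (V : RMC.Metric 𝓡 n) (M : Matroid n)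
  (k z m b : ℕ) (Post : List (Fin n) → Set q) (prog : RMC.Program 𝓡)
  (prog-exec : ∀ N s S → prog (2 ℕ.+ N) s (encode S) ≡ Algorithm.exec 𝓡 k z (2 ℕ.+ N) s S) where

  open ArchimedeanField 𝓡
  open RMC 𝓡
  open Algorithm 𝓡
  open Metric V
  open Matroid M

  holds : Query (Fin n) → Bool
  holds (cmp false α x y x′ y′) = does (fromℕ α * d x y ≤? d x′ y′)
  holds (cmp true  α x y x′ y′) = not (does (d x′ y′ ≤? fromℕ α * d x y))
  holds (ind e xs)              = agree e (does (indep? (toSubset xs)))

  -- Runs are assembled backwards: a phase is treated as a function that takes the goals of all
  -- configurations it may lead to and returns the goal of the one it starts from.
  Goal : Config n → Set (c ⊔ q)
  Goal cfg = ∃ λ out → Run V M prog m b cfg out × Post out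

  continue : ∀ {cfg cfg′} → Fits V M prog m b cfg → step V M prog cfg ≡ inj₂ cfg′ → Goal cfg′ → Goal cfg
  continue fits eq (out , run , post) = out , go fits eq run , post

  finish : ∀ {cfg out} → Fits V M prog m b cfg → step V M prog cfg ≡ inj₁ out → Post out → Goal cfg
  finish {out = out} fits eq post = out , stop fits eq , post

  module _ {is ps : List (Fin n)} {rs : List Carrier} {ws : List ℕ} {next : Bool → List ℕ} where

    private
      cfg = ⟨ is , ps , rs , ws ⟩

      Fetches : Operation (length ps) (length rs) → Set c
      Fetches op = prog (length ps) (length rs) ws ≡ (op , next)

    -- As `prog` is a variable, `step` does not reduce by itself. This lemma and its companions
    -- rewrite with the fetched instruction once for each operation.
    step-read-[] : is ≡ [] → Fetches read → step V M prog cfg ≡ inj₂ ⟨ [] , ps , rs , next false ⟩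
    step-read-[] refl eq rewrite eq = refl

    step-read-∷ : ∀ {i is′} → is ≡ i ∷ is′ → Fetches read →
      step V M prog cfg ≡ inj₂ ⟨ is′ , ps ∷ʳ i , rs , next true ⟩
    step-read-∷ refl eq rewrite eq = refl

    step-keepPoints : ∀ {as} → Fetches (keepPoints as) →
      step V M prog cfg ≡ inj₂ ⟨ is , map (lookup ps) as , rs , next true ⟩
    step-keepPoints eq rewrite eq = refl

    step-keepReals : ∀ {as} → Fetches (keepReals as) →
      step V M prog cfg ≡ inj₂ ⟨ is , ps , map (lookup rs) as , next true ⟩
    step-keepReals eq rewrite eq = refl

    step-constant : ∀ {x} → Fetches (constant x) → step V M prog cfg ≡ inj₂ ⟨ is , ps , rs ∷ʳ x , next true ⟩
    step-constant eq rewrite eq = refl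

    step-distance : ∀ {i j} → Fetches (distance i j) →
      step V M prog cfg ≡ inj₂ ⟨ is , ps , rs ∷ʳ d (lookup ps i) (lookup ps j) , next true ⟩
    step-distance eq rewrite eq = refl

    step-mul : ∀ {i j} → Fetches (mul i j) →
      step V M prog cfg ≡ inj₂ ⟨ is , ps , rs ∷ʳ (lookup rs i * lookup rs j) , next true ⟩
    step-mul eq rewrite eq = refl

    step-compare : ∀ {i j} → Fetches (compare i j) →
      step V M prog cfg ≡ inj₂ ⟨ is , ps , rs , next (does (lookup rs i ≤? lookup rs j)) ⟩
    step-compare eq rewrite eq = refl

    step-independent : ∀ {as} → Fetches (independent as) →
      step V M prog cfg ≡ inj₂ ⟨ is , ps , rs , next (does (indep? (toSubset (map (lookup ps) as)))) ⟩
    step-independent eq rewrite eq = refl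

    step-skip : Fetches skip → step V M prog cfg ≡ inj₂ ⟨ is , ps , rs , next true ⟩
    step-skip eq rewrite eq = refl

    step-halt : ∀ {as} → Fetches (halt as) → step V M prog cfg ≡ inj₁ (map (lookup ps) as)
    step-halt eq rewrite eq = refl

  Small : ℕ → List ℕ → Set
  Small N xs = length xs ℕ.≤ N × All (ℕ._≤ b) xs

  record Bounded (N : ℕ) (ph : Phase) (ws : List ℕ) : Set where
    field
      -- N points, four reals, six header words and three lists of at most N words: weights,
      -- incumbent and candidate.
      N-room     : 4 ℕ.* N ℕ.+ 10 ℕ.≤ m
      b-room     : 3 ℕ.+ N ℕ.+ N ℕ.* N ℕ.≤ b
      arg≤       : arg ph ℕ.≤ N
      ws-small   : Small N ws
      best-small : Small N (incumbent ph)

  fits : ∀ {is ps rs ph ws cand c d} → Bounded (length ps) ph ws → length rs ℕ.≤ 4 →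
    Small (length ps) cand → c ℕ.≤ 3 ℕ.+ length ps ℕ.+ length ps ℕ.* length ps → d ℕ.≤ 1 →
    Fits V M prog m b ⟨ is , ps , rs , encode (state ph ws cand c d) ⟩
  fits {ps = ps} {rs} {ph} {ws} {cand} bd rs≤ (cand-len , cand≤) c≤ d≤ =
    (begin
      N ℕ.+ length rs ℕ.+ (6 ℕ.+ length (ws ++ incumbent ph ++ cand))
        ≡⟨ cong (λ t → N ℕ.+ length rs ℕ.+ (6 ℕ.+ t))
             (≡.trans (Listₚ.length-++ ws) (cong (length ws ℕ.+_) (Listₚ.length-++ (incumbent ph)))) ⟩
      N ℕ.+ length rs ℕ.+ (6 ℕ.+ (length ws ℕ.+ (length (incumbent ph) ℕ.+ length cand)))
        ≤⟨ ℕₚ.+-mono-≤ (ℕₚ.+-monoʳ-≤ N rs≤) (ℕₚ.+-monoʳ-≤ 6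
             (ℕₚ.+-mono-≤ (proj₁ ws-small) (ℕₚ.+-mono-≤ (proj₁ best-small) cand-len))) ⟩
      N ℕ.+ 4 ℕ.+ (6 ℕ.+ (N ℕ.+ (N ℕ.+ N)))
        ≡⟨ solve 1 (λ N → N :+ con 4 :+ (con 6 :+ (N :+ (N :+ N))) := con 4 :* N :+ con 10) refl N ⟩
      4 ℕ.* N ℕ.+ 10
        ≤⟨ N-room ⟩
      m ∎) ,
    code≤ ph ∷ N≤b arg≤ ∷ ℕₚ.≤-trans c≤ b-room ∷ N≤b′ (ℕₚ.≤-trans d≤ (ℕ.s≤s ℕ.z≤n)) ∷
    N≤b (proj₁ ws-small) ∷ N≤b (proj₁ best-small) ∷
    Allₚ.++⁺ (proj₂ ws-small) (Allₚ.++⁺ (proj₂ best-small) cand≤)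
    where
    open Bounded bd
    open ℕₚ.≤-Reasoning
    open +-*-Solver
    N = length ps
    N≤b′ : ∀ {x} → x ℕ.≤ 3 ℕ.+ N → x ℕ.≤ b
    N≤b′ x≤ = ℕₚ.≤-trans x≤ (ℕₚ.≤-trans (ℕₚ.m≤m+n (3 ℕ.+ N) _) b-room)
    N≤b : ∀ {x} → x ℕ.≤ N → x ℕ.≤ b
    N≤b x≤ = N≤b′ (ℕₚ.≤-trans x≤ (ℕₚ.m≤n+m N 3))
    code≤ : ∀ ph → code ph ℕ.≤ b
    code≤ (ins _) = ℕ.z≤n
    code≤ rai     = N≤b′ (ℕ.s≤s ℕ.z≤n)
    code≤ (fin _) = N≤b′ (ℕ.s≤s (ℕ.s≤s ℕ.z≤n))

  module _ (is : List (Fin n)) (u v : Fin n) (P : List (Fin n)) (ph : Phase) (ws : List ℕ) where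

    private
      ps : List (Fin n)
      ps = u ∷ v ∷ P

      N : ℕ
      N = length ps

      index : List (Fin N)
      index = allFin N

    at : List Carrier → List ℕ → ℕ → ℕ → Config n
    at rs cand c d = ⟨ is , ps , rs , encode (state ph ws cand c d) ⟩

    allFin-lookup : map (lookup ps) index ≡ ps
    allFin-lookup = ≡.trans (Listₚ.map-tabulate id (lookup ps)) (Listₚ.tabulate-lookup ps)

    CheckIndex : List ℕ → List (Query (Fin N))
    CheckIndex cand = checks k z index ph ws cand

    Passes : List ℕ → Set
    Passes cand = All (λ q → holds q ≡ true) (checks k z ps ph ws cand)

    fetch : ∀ {rs : List Carrier} {cand c d instr} → exec k z N (length rs) (state ph ws cand c d) ≡ instr →
      prog N (length rs) (encode (state ph ws cand c d)) ≡ instr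
    fetch {rs} {cand} {c} {d} eq = ≡.trans (prog-exec (length P) (length rs) (state ph ws cand c d)) eq

    module _ (bounded : Bounded N ph ws) where

      open Bounded bounded

      small-digits : ∀ {xs} → length xs ℕ.≤ N → All (ℕ._≤ N) xs → Small N xs
      small-digits len xs≤ = len , All.map (λ x≤ → ℕₚ.≤-trans x≤ (ℕₚ.≤-trans (ℕₚ.m≤n+m N 3)
        (ℕₚ.≤-trans (ℕₚ.m≤m+n (3 ℕ.+ N) _) b-room))) xs≤

      clean : ∀ {rs cand c} → length rs ℕ.≤ 4 → Small N cand → c ℕ.≤ 3 ℕ.+ N ℕ.+ N ℕ.* N →
        Goal (at [] cand c 0) → Goal (at rs cand c 1)
      clean {rs} {cand} {c} rs≤ small c≤ =
        continue {at rs cand c 1} {at [] cand c 0} (fits {is} {ps} {rs} {ph} {ws} {cand} {c} {1} bounded rs≤ small c≤ ℕₚ.≤-refl)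
          (step-keepReals {is} {ps} {rs} {encode (state ph ws cand c 1)} {λ _ → encode (state ph ws cand c 0)} {[]}
            (fetch {rs} {cand} {c} {1} refl))

      next : List ℕ → List ℕ
      next cand = fromMaybe [] (decrement N cand)

      run-query : ∀ {x xs c q qs} → let cand = (x List.∷ xs) in
        Small N cand → Small N (next cand) →
        drop c (CheckIndex cand) ≡ q ∷ qs →
        (holds (mapQuery (lookup ps) q) ≡ true → Goal (at [] cand (suc c) 0)) →
        (holds (mapQuery (lookup ps) q) ≢ true → Goal (at [] (next cand) 0 0)) →
        Goal (at [] cand c 0)
      run-query {x} {xs} {c} {q} {qs} small small′ at-c succeed fail′ = query q at-c succeed fail′
        where
        cand : List ℕ
        cand = x ∷ xs
        S = state ph ws cand c 0
        c< : suc c ℕ.≤ 3 ℕ.+ N ℕ.+ N ℕ.* N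
        c< = ℕₚ.≤-trans (proj₂ (drop-suc c at-c)) (≡.subst (λ t → length (CheckIndex cand) ℕ.≤ 3 ℕ.+ t ℕ.+ t ℕ.* t)
          (Listₚ.length-tabulate {n = N} id) (length-checks k z index ph ws cand))
        fits₀ : ∀ {rs} → length rs ℕ.≤ 4 → Fits V M prog m b (at rs cand c 0)
        fits₀ {rs} rs≤ = fits {is} {ps} {rs} {ph} {ws} {cand} {c} {0} bounded rs≤ small (ℕₚ.<⇒≤ c<) ℕ.z≤n
        exec-ask : ∀ q′ → drop c (CheckIndex cand) ≡ q′ ∷ qs → ∀ s → exec k z N s S ≡ ask s S q′
        exec-ask q′ eq s rewrite eq = refl
        -- The argument that transports goals stands for the clearing of the reals: the identity
        -- after an independence query, `clean` after a comparison.
        after : ∀ {h} rs d → length rs ℕ.≤ 4 → d ℕ.≤ 1 →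
          (∀ {cand c} → Small N cand → c ℕ.≤ 3 ℕ.+ N ℕ.+ N ℕ.* N → Goal (at [] cand c 0) → Goal (at rs cand c d)) →
          (h ≡ true → Goal (at [] cand (suc c) 0)) → (h ≢ true → Goal (at [] (next cand) 0 0)) →
          Goal ⟨ is , ps , rs , advance N S d h ⟩
        after {true}  rs d rs≤ d≤ cl succeed fail′ = cl small c< (succeed refl)
        after {false} rs d rs≤ d≤ cl succeed fail′ = cl small′ ℕ.z≤n (fail′ λ ())
        query : ∀ q → drop c (CheckIndex cand) ≡ q ∷ qs →
          (holds (mapQuery (lookup ps) q) ≡ true → Goal (at [] cand (suc c) 0)) →
          (holds (mapQuery (lookup ps) q) ≢ true → Goal (at [] (next cand) 0 0)) →
          Goal (at [] cand c 0)
        query (ind e xs) eq succeed fail′ =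
          continue {at [] cand c 0} {⟨ is , ps , [] , advance N S 0 h ⟩} (fits₀ {[]} ℕ.z≤n)
            (step-independent {is} {ps} {[]} {encode S} {λ b → advance N S 0 (agree e b)} {xs}
              (fetch {[]} {cand} {c} {0} (exec-ask _ eq 0)))
            (after {h} [] 0 ℕ.z≤n ℕ.z≤n (λ _ _ g → g) succeed fail′)
          where h = holds (mapQuery (lookup ps) (ind e xs))
        query (cmp strict α x₁ y₁ x₂ y₂) eq succeed fail′ =
          continue {at rs₀ cand c 0} {at rs₁ cand c 0} (fits₀ {rs₀} ℕ.z≤n)
            (step-distance {is} {ps} {rs₀} {encode S} {stay} {x₁} {y₁} (fetch {rs₀} {cand} {c} {0} (exec-ask _ eq 0)))
          (continue {at rs₁ cand c 0} {at rs₂ cand c 0} (fits₀ {rs₁} (ℕ.s≤s ℕ.z≤n))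
            (step-constant {is} {ps} {rs₁} {encode S} {stay} {fromℕ α} (fetch {rs₁} {cand} {c} {0} (exec-ask _ eq 1)))
          (continue {at rs₂ cand c 0} {at rs₃ cand c 0} (fits₀ {rs₂} (ℕ.s≤s (ℕ.s≤s ℕ.z≤n)))
            (step-mul {is} {ps} {rs₂} {encode S} {stay} {Fin.suc Fin.zero} {Fin.zero} (fetch {rs₂} {cand} {c} {0} (exec-ask _ eq 2)))
          (continue {at rs₃ cand c 0} {at rs₄ cand c 0} (fits₀ {rs₃} (ℕ.s≤s (ℕ.s≤s (ℕ.s≤s ℕ.z≤n))))
            (step-distance {is} {ps} {rs₃} {encode S} {stay} {x₂} {y₂} (fetch {rs₃} {cand} {c} {0} (exec-ask _ eq 3)))
          (compared strict eq succeed fail′))))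
          where
          r₁ = d (lookup ps x₁) (lookup ps y₁)
          r₂ = d (lookup ps x₂) (lookup ps y₂)
          rs₀ rs₁ rs₂ rs₃ rs₄ : List Carrier
          rs₀ = []
          rs₁ = r₁ ∷ []
          rs₂ = r₁ ∷ fromℕ α ∷ []
          rs₃ = r₁ ∷ fromℕ α ∷ fromℕ α * r₁ ∷ []
          rs₄ = r₁ ∷ fromℕ α ∷ fromℕ α * r₁ ∷ r₂ ∷ []
          stay : Bool → List ℕ
          stay _ = encode S
          2nd 3rd : Fin 4
          2nd = Fin.suc (Fin.suc Fin.zero)
          3rd = Fin.suc (Fin.suc (Fin.suc Fin.zero))
          compared : ∀ strict → drop c (CheckIndex cand) ≡ cmp strict α x₁ y₁ x₂ y₂ ∷ qs →
            (holds (mapQuery (lookup ps) (cmp strict α x₁ y₁ x₂ y₂)) ≡ true → Goal (at [] cand (suc c) 0)) →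
            (holds (mapQuery (lookup ps) (cmp strict α x₁ y₁ x₂ y₂)) ≢ true → Goal (at [] (next cand) 0 0)) →
            Goal (at rs₄ cand c 0)
          compared false eq succeed fail′ =
            continue {at rs₄ cand c 0} {⟨ is , ps , rs₄ , advance N S 1 h ⟩} (fits₀ {rs₄} ℕₚ.≤-refl)
              (step-compare {is} {ps} {rs₄} {encode S} {advance N S 1} {2nd} {3rd} (fetch {rs₄} {cand} {c} {0} (exec-ask _ eq 4)))
              (after {h} rs₄ 1 ℕₚ.≤-refl ℕₚ.≤-refl (clean {rs₄} ℕₚ.≤-refl) succeed fail′)
            where h = does (fromℕ α * r₁ ≤? r₂)
          compared true eq succeed fail′ =
            continue {at rs₄ cand c 0} {⟨ is , ps , rs₄ , advance N S 1 h ⟩} (fits₀ {rs₄} ℕₚ.≤-refl)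
              (step-compare {is} {ps} {rs₄} {encode S} {λ b → advance N S 1 (not b)} {3rd} {2nd} (fetch {rs₄} {cand} {c} {0} (exec-ask _ eq 4)))
              (after {h} rs₄ 1 ℕₚ.≤-refl ℕₚ.≤-refl (clean {rs₄} ℕₚ.≤-refl) succeed fail′)
            where h = not (does (r₂ ≤? fromℕ α * r₁))

      run-checks : ∀ {x xs} → let cand = (x List.∷ xs) in
        Small N cand → Small N (next cand) →
        (∀ c → c ℕ.≤ 3 ℕ.+ N ℕ.+ N ℕ.* N → drop c (CheckIndex cand) ≡ [] → Passes cand → Goal (at [] cand c 0)) →
        (¬ Passes cand → Goal (at [] (next cand) 0 0)) →
        Goal (at [] cand 0 0)
      run-checks {x} {xs} small small′ succeed fail′ = loop 0 ℕ.z≤n (CheckIndex cand) refl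
          (λ all → succeed′ all) (λ ¬all → fail′ (¬all ∘ to-index))
        where
        cand : List ℕ
        cand = x ∷ xs
        Holds : List (Query (Fin N)) → Set
        Holds = All (λ q → holds (mapQuery (lookup ps) q) ≡ true)
        checks≡ : checks k z ps ph ws cand ≡ map (mapQuery (lookup ps)) (CheckIndex cand)
        checks≡ = ≡.trans (cong (λ t → checks k z t ph ws cand) (≡.sym allFin-lookup)) (checks-map (lookup ps) k z index ph ws cand)
        to-index : Passes cand → Holds (CheckIndex cand)
        to-index pass = Allₚ.map⁻ (≡.subst (All (λ q → holds q ≡ true)) checks≡ pass)
        succeed′ : Holds (CheckIndex cand) → ∀ c → c ℕ.≤ 3 ℕ.+ N ℕ.+ N ℕ.* N → drop c (CheckIndex cand) ≡ [] → Goal (at [] cand c 0)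
        succeed′ all c c≤ eq = succeed c c≤ eq (≡.subst (All (λ q → holds q ≡ true)) (≡.sym checks≡) (Allₚ.map⁺ all))
        loop : ∀ c → c ℕ.≤ 3 ℕ.+ N ℕ.+ N ℕ.* N → ∀ qs → drop c (CheckIndex cand) ≡ qs →
          (Holds qs → ∀ c → c ℕ.≤ 3 ℕ.+ N ℕ.+ N ℕ.* N → drop c (CheckIndex cand) ≡ [] → Goal (at [] cand c 0)) →
          (¬ Holds qs → Goal (at [] (next cand) 0 0)) → Goal (at [] cand c 0)
        loop c c≤ []       eq succeed fail′ = succeed [] c c≤ eq
        loop c c≤ (q ∷ qs) eq succeed fail′ = run-query small small′ eq
          (λ h → loop (suc c) (ℕₚ.≤-trans (proj₂ (drop-suc c eq)) len) qs (proj₁ (drop-suc c eq))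
             (λ all → succeed (h ∷ all)) (λ ¬all → fail′ λ { (_ ∷ all) → ¬all all }))
          (λ ¬h → fail′ λ { (h ∷ _) → ¬h h })
          where
          len = ≡.subst (λ t → length (CheckIndex cand) ℕ.≤ 3 ℕ.+ t ℕ.+ t ℕ.* t)
            (Listₚ.length-tabulate {n = N} id) (length-checks k z index ph ws cand)

      Digits : List ℕ → Set
      Digits xs = length xs ≡ N × All (ℕ._≤ N) xs

      -- The countdown from the largest list of digits passes through every other one, so that
      -- reaching its end refutes all candidates. The loop collects the refutations in its last
      -- argument, as a claim about all lists still reachable.
      search : (∀ cand c → Digits cand → c ℕ.≤ 3 ℕ.+ N ℕ.+ N ℕ.* N → drop c (CheckIndex cand) ≡ [] → Passes cand →
                 Goal (at [] cand c 0)) →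
        ((∀ cand → Digits cand → ¬ Passes cand) → Goal (at [] [] 0 0)) →
        Goal (at [] (replicate N N) 0 0)
      search success failure = loop (≡.subst (λ t → Star (Decrement N) (replicate t N) (replicate N 0)) (Listₚ.length-replicate N)
            (countdown N (replicate N 0) (Allₚ.replicate⁺ N ℕ.z≤n)))
          (Listₚ.length-replicate N , Allₚ.replicate⁺ N ℕₚ.≤-refl)
          (λ none → failure λ cand (len , cand≤) → none cand (≡.subst (λ t → Star (Decrement N) (replicate t N) cand) len (countdown N cand cand≤)))
        where
        loop : ∀ {cand} → Star (Decrement N) cand (replicate N 0) → Digits cand →
          ((∀ cand′ → Star (Decrement N) cand cand′ → ¬ Passes cand′) → Goal (at [] [] 0 0)) → Goal (at [] cand 0 0)
        loop {x ∷ xs} nil digits@(len , cand≤) none = run-checks {x} {xs} (small-digits (ℕₚ.≤-reflexive len) cand≤)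
          (≡.subst (Small N) (≡.sym next≡) (ℕ.z≤n , []))
          (λ c c≤ → success _ c digits c≤)
          (λ ¬pass → ≡.subst (λ t → Goal (at [] t 0 0)) (≡.sym next≡) (none λ cand′ → λ
            { nil → ¬pass
            ; (step ◅ _) → ⊥-elim (no-step step) }))
          where
          dec≡ : decrement N (x ∷ xs) ≡ nothing
          dec≡ = decrement-zeros N N
          next≡ : next (x ∷ xs) ≡ []
          next≡ = cong (fromMaybe []) dec≡
          no-step : ∀ {ys} → ¬ Decrement N (x ∷ xs) ys
          no-step step with () ← ≡.trans (≡.sym step) dec≡
        loop {[]} (() ◅ _)
        loop {x ∷ xs} (_◅_ {j = ys} step steps) digits@(len , cand≤) none = run-checks {x} {xs}
          (small-digits (ℕₚ.≤-reflexive len) cand≤) (≡.subst (Small N) (≡.sym next≡) (small-digits (ℕₚ.≤-reflexive (proj₁ digits′)) (proj₂ digits′)))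
          (λ c c≤ → success _ c digits c≤)
          (λ ¬pass → ≡.subst (λ t → Goal (at [] t 0 0)) (≡.sym next≡) (loop steps digits′ λ none′ → none λ cand′ → λ
            { nil → ¬pass
            ; (step′ ◅ steps′) → none′ cand′ (≡.subst (λ t → Star (Decrement N) t cand′) (same step′) steps′) }))
          where
          next≡ : next (x ∷ xs) ≡ ys
          next≡ = cong (fromMaybe []) step
          digits′ : Digits ys
          digits′ = ≡.trans (decrement-length N (x ∷ xs) step) len , decrement-≤ N (x ∷ xs) cand≤ step
          same : ∀ {ys′} → Decrement N (x ∷ xs) ys′ → ys′ ≡ ys
          same step′ with refl ← ≡.trans (≡.sym step′) step = refl

-- Stored points and their weights

∈-select : ∀ fs {x} {xs : List A} → x ∈ˡ select fs xs → x ∈ˡ xs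
∈-select (zero  ∷ fs) {xs = _ ∷ _} x∈          = there (∈-select fs x∈)
∈-select (suc _ ∷ fs) {xs = _ ∷ _} (here eq)   = here eq
∈-select (suc _ ∷ fs) {xs = _ ∷ _} (there x∈)  = there (∈-select fs x∈)

indicator : Bool → ℕ
indicator true  = 1
indicator false = 0

indicator≤1 : ∀ b → indicator b ℕ.≤ 1
indicator≤1 true  = ℕₚ.≤-refl
indicator≤1 false = ℕ.z≤n

-- Turns a subset given by a Boolean function into a candidate. A candidate has a digit for every
-- entry, even when only the first l entries are eligible, and the surplus digits have no effect.
select-indicator : ∀ (χ : A → Bool) l xs →
  select (map (indicator ∘ χ) xs) (take l xs) ≡ filterᵇ χ (take l xs)
select-indicator χ zero    []       = refl
select-indicator χ zero    (x ∷ xs) with χ x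
... | true  = refl
... | false = refl
select-indicator χ (suc l) []       = refl
select-indicator χ (suc l) (x ∷ xs) with χ x
... | true  = cong (x ∷_) (select-indicator χ l xs)
... | false = select-indicator χ l xs

get-∈ : ∀ {x} {xs : List A} → x ∈ˡ xs → ∃ λ i → i ℕ.≤ length xs × get xs i ≡ just x
get-∈ (here refl) = 0 , ℕ.z≤n , refl
get-∈ (there x∈) with get-∈ x∈
... | i , i≤ , eq = suc i , ℕ.s≤s i≤ , eq

nth-∈ : ∀ {x₀ x} {xs : List A} → x ∈ˡ xs → ∃ λ i → i ℕ.≤ length xs × nth x₀ xs i ≡ x
nth-∈ {x₀ = x₀} x∈ with get-∈ x∈
... | i , i≤ , eq = i , i≤ , cong (fromMaybe x₀) eq

get-length : ∀ (xs : List A) → get xs (length xs) ≡ nothing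
get-length []       = refl
get-length (x ∷ xs) = get-length xs

pairs⁺ : ∀ {R : A → A → Set p} {xs} → AllPairs R xs → All (λ (x , y) → R x y) (pairs xs)
pairs⁺ []         = []
pairs⁺ (rx ∷ rxs) = Allₚ.++⁺ (Allₚ.map⁺ rx) (pairs⁺ rxs)

pairs⁻ : ∀ {R : A → A → Set p} xs → All (λ (x , y) → R x y) (pairs xs) → AllPairs R xs
pairs⁻ []       _   = []
pairs⁻ (x ∷ xs) all = Allₚ.map⁻ (Allₚ.++⁻ˡ (map (x ,_) xs) all) ∷ pairs⁻ xs (Allₚ.++⁻ʳ (map (x ,_) xs) all)

∈-pairs : ∀ {x y} (xs : List A) → (x , y) ∈ˡ pairs xs → x ∈ˡ xs × y ∈ˡ xs
∈-pairs (z ∷ xs) xy∈ with ∈-++⁻ (map (z ,_) xs) xy∈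
... | inj₂ xy∈′ = Product.map there there (∈-pairs xs xy∈′)
... | inj₁ xy∈′ with ∈-map⁻ (z ,_) xy∈′
...   | y , y∈ , refl = here refl , there y∈

-- The element x is counted on the right only. Both termination measures decrease by this.
filter-< : ∀ {a} {A : Set a} {P : Pred A p} {Q : Pred A q} (P? : Decidable P) (Q? : Decidable Q) {x} xs →
  (∀ {y} → Q y → P y) → x ∈ˡ xs → P x → ¬ Q x → length (filter Q? xs) ℕ.< length (filter P? xs)
filter-< {P = P} {Q} P? Q? (y ∷ xs) Q⇒P x∈ Px ¬Qx = go x∈
  where
  weak : ∀ xs → length (filter Q? xs) ℕ.≤ length (filter P? xs)
  weak [] = ℕ.z≤n
  weak (y ∷ xs) with Q? y | P? y
  ... | yes _  | yes _  = ℕ.s≤s (weak xs)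
  ... | no _   | yes _  = ℕₚ.m≤n⇒m≤1+n (weak xs)
  ... | no _   | no _   = weak xs
  ... | yes Qy | no ¬Py = ⊥-elim (¬Py (Q⇒P Qy))
  go : _ ∈ˡ y ∷ xs → length (filter Q? (y ∷ xs)) ℕ.< length (filter P? (y ∷ xs))
  go (here refl) with Q? y | P? y
  ... | yes Qy | _      = ⊥-elim (¬Qx Qy)
  ... | no _   | no ¬Py = ⊥-elim (¬Py Px)
  ... | no _   | yes _  = ℕ.s≤s (weak xs)
  go (there x∈) with Q? y | P? y
  ... | yes _  | yes _  = ℕ.s≤s (filter-< P? Q? xs Q⇒P x∈ Px ¬Qx)
  ... | no _   | yes _  = ℕₚ.m≤n⇒m≤1+n (filter-< P? Q? xs Q⇒P x∈ Px ¬Qx)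
  ... | no _   | no _   = filter-< P? Q? xs Q⇒P x∈ Px ¬Qx
  ... | yes Qy | no ¬Py = ⊥-elim (¬Py (Q⇒P Qy))

-- An entry is a stored point with the points of the stream it stands for.

Entry : ℕ → Set
Entry n = Fin n × List (Fin n)

points : List (Entry n) → List (Fin n)
points = map proj₁

weights : List (Entry n) → List ℕ
weights = map (length ∘ proj₂)

fibers : List (Entry n) → List (Fin n)
fibers E = concat (map proj₂ E)

fibers-++ : ∀ (D E : List (Entry n)) → fibers (D ++ E) ≡ fibers D ++ fibers E
fibers-++ []      E = refl
fibers-++ (e ∷ D) E = ≡.trans (cong (proj₂ e ++_) (fibers-++ D E)) (≡.sym (Listₚ.++-assoc (proj₂ e) (fibers D) (fibers E)))

weights≤ : ∀ (E : List (Entry n)) → All (ℕ._≤ length (fibers E)) (weights E)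
weights≤ []            = []
weights≤ ((_ , F) ∷ E) = ≤₁ ∷ All.map (λ w≤ → ℕₚ.≤-trans w≤ ≤₂) (weights≤ E)
  where
  eq = Listₚ.length-++ F {fibers E}
  ≤₁ = ℕₚ.≤-trans (ℕₚ.m≤m+n (length F) _) (ℕₚ.≤-reflexive (≡.sym eq))
  ≤₂ = ℕₚ.≤-trans (ℕₚ.m≤n+m _ (length F)) (ℕₚ.≤-reflexive (≡.sym eq))

-- The counterpart for fibers of `addToFirst`. The machine stores only the lengths of the fibers;
-- the fibers themselves exist in the proof.
addFiber : List ℕ → List (Fin n) → List (Entry n) → List (Entry n)
addFiber (zero  ∷ fs) F (e ∷ D)        = e ∷ addFiber fs F D
addFiber (suc _ ∷ fs) F ((p , F′) ∷ D) = (p , F′ ++ F) ∷ D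
addFiber _            F D              = D

points-addFiber : ∀ fs F (D : List (Entry n)) → points (addFiber fs F D) ≡ points D
points-addFiber []           F D       = refl
points-addFiber (zero  ∷ fs) F []      = refl
points-addFiber (suc _ ∷ fs) F []      = refl
points-addFiber (zero  ∷ fs) F (e ∷ D) = cong (proj₁ e ∷_) (points-addFiber fs F D)
points-addFiber (suc _ ∷ fs) F (e ∷ D) = refl

weights-addFiber : ∀ fs F (D : List (Entry n)) → weights (addFiber fs F D) ≡ addToFirst fs (length F) (weights D)
weights-addFiber []           F D       = refl
weights-addFiber (zero  ∷ fs) F []      = refl
weights-addFiber (suc _ ∷ fs) F []      = refl
weights-addFiber (zero  ∷ fs) F (e ∷ D) = cong (_ ∷_) (weights-addFiber fs F D)
weights-addFiber (suc _ ∷ fs) F ((_ , F′) ∷ D) = cong (_∷ weights D) (Listₚ.length-++ F′)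

-- If no entry were selected, `F` would have no recipient and its points would be lost.
fibers-addFiber : ∀ fs F (D : List (Entry n)) → select fs (points D) ≢ [] →
  fibers (addFiber fs F D) ↭ F ++ fibers D
fibers-addFiber []           F D       ≢[] = ⊥-elim (≢[] refl)
fibers-addFiber (zero  ∷ fs) F []      ≢[] = ⊥-elim (≢[] refl)
fibers-addFiber (suc _ ∷ fs) F []      ≢[] = ⊥-elim (≢[] refl)
fibers-addFiber (zero  ∷ fs) F ((p , F′) ∷ D) ≢[] =
  ↭-trans (Permₚ.++⁺ˡ F′ (fibers-addFiber fs F D ≢[])) (Permₚ.shifts F′ F)
fibers-addFiber (suc _ ∷ fs) F ((p , F′) ∷ D) ≢[] =
  ↭-trans (↭-reflexive (Listₚ.++-assoc F′ F (fibers D))) (Permₚ.shifts F′ F)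

FibersSatisfy : (Fin n → Fin n → Set p) → List (Entry n) → Set p
FibersSatisfy R = All λ (q , F) → All (λ y → R y q) F

fibersSatisfy-addFiber : ∀ {R : Fin n → Fin n → Set p} fs F D →
  (∀ {q} → q ∈ˡ select fs (points D) → All (λ y → R y q) F) → FibersSatisfy R D → FibersSatisfy R (addFiber fs F D)
fibersSatisfy-addFiber []           F D       F-ok D-ok = D-ok
fibersSatisfy-addFiber (zero  ∷ fs) F []      F-ok D-ok = D-ok
fibersSatisfy-addFiber (suc _ ∷ fs) F []      F-ok D-ok = D-ok
fibersSatisfy-addFiber (zero  ∷ fs) F (e ∷ D) F-ok (ok ∷ D-ok) = ok ∷ fibersSatisfy-addFiber fs F D F-ok D-ok
fibersSatisfy-addFiber (suc _ ∷ fs) F (e ∷ D) F-ok (ok ∷ D-ok) = Allₚ.++⁺ ok (F-ok (here refl)) ∷ D-ok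

outliers : List (Entry n) → List (Maybe A) → List (Fin n)
outliers (_       ∷ E) (just _  ∷ σ) = outliers E σ
outliers ((_ , F) ∷ E) (nothing ∷ σ) = F ++ outliers E σ
outliers _             _             = []

length-outliers : ∀ (E : List (Entry n)) (σ : List (Maybe A)) → length (outliers E σ) ≡ outlierWeight (weights E) σ
length-outliers []      []            = refl
length-outliers []      (_ ∷ _)       = refl
length-outliers (_ ∷ E) []            = refl
length-outliers (_ ∷ E) (just _  ∷ σ) = length-outliers E σ
length-outliers ((_ , F) ∷ E) (nothing ∷ σ) =
  ≡.trans (Listₚ.length-++ F) (cong (length F ℕ.+_) (length-outliers E σ))

assigned-∈ : ∀ (ps : List A) (σ : List (Maybe A)) {p s} → (p , s) ∈ˡ assigned ps σ → p ∈ˡ ps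
assigned-∈ (p ∷ ps) (just s  ∷ σ) (here refl) = here refl
assigned-∈ (p ∷ ps) (just s  ∷ σ) (there ps∈) = there (assigned-∈ ps σ ps∈)
assigned-∈ (p ∷ ps) (nothing ∷ σ) ps∈         = there (assigned-∈ ps σ ps∈)

outlier-or-assigned : ∀ {R : Fin n → Fin n → Set p} E (σ : List (Maybe (Fin n))) → length σ ≡ length E →
  FibersSatisfy R E → ∀ {y} → y ∈ˡ fibers E →
  y ∈ˡ outliers E σ ⊎ ∃ λ ps → ps ∈ˡ assigned (points E) σ × R y (proj₁ ps)
outlier-or-assigned ((p , F) ∷ E) (m ∷ σ) eq (ok ∷ oks) y∈ with ∈-++⁻ F y∈
outlier-or-assigned ((p , F) ∷ E) (just s  ∷ σ) eq (ok ∷ oks) y∈ | inj₁ y∈F = inj₂ ((p , s) , here refl , All.lookup ok y∈F)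
outlier-or-assigned ((p , F) ∷ E) (nothing ∷ σ) eq (ok ∷ oks) y∈ | inj₁ y∈F = inj₁ (∈-++⁺ˡ y∈F)
outlier-or-assigned ((p , F) ∷ E) (m ∷ σ) eq (ok ∷ oks) y∈ | inj₂ y∈E
  with outlier-or-assigned E σ (ℕₚ.suc-injective eq) oks y∈E
outlier-or-assigned ((p , F) ∷ E) (just s  ∷ σ) eq (ok ∷ oks) y∈ | inj₂ y∈E | inj₁ y∈O = inj₁ y∈O
outlier-or-assigned ((p , F) ∷ E) (nothing ∷ σ) eq (ok ∷ oks) y∈ | inj₂ y∈E | inj₁ y∈O = inj₁ (∈-++⁺ʳ F y∈O)
outlier-or-assigned ((p , F) ∷ E) (just s  ∷ σ) eq (ok ∷ oks) y∈ | inj₂ y∈E | inj₂ (ps , ps∈ , r) = inj₂ (ps , there ps∈ , r)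
outlier-or-assigned ((p , F) ∷ E) (nothing ∷ σ) eq (ok ∷ oks) y∈ | inj₂ y∈E | inj₂ r = inj₂ r

-- Points whose fiber avoids Q become outliers.
assignment-exists : ∀ {Q : Fin n → Set q} (Q? : Decidable Q) {R : Fin n → Fin n → Set p} (pts : List (Fin n)) (E : List (Entry n)) →
  All (λ (p , F) → ∀ {y} → y ∈ˡ F → Q y → ∃ λ s → s ∈ˡ pts × R p s) E →
  ∃ λ fs → length fs ≡ length E × All (ℕ._≤ length pts) fs ×
    All (λ (p , s) → R p s) (assigned (points E) (map (get pts) fs)) ×
    outlierWeight (weights E) (map (get pts) fs) ℕ.≤ length (filter (¬? ∘ Q?) (fibers E))
assignment-exists Q? pts [] [] = [] , refl , [] , [] , ℕ.z≤n
assignment-exists {Q = Q} Q? {R} pts ((p , F) ∷ E) (near ∷ nears) with assignment-exists Q? {R} pts E nears | Any.any? Q? F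
... | fs , len , fs≤ , ok , weight≤ | no none
  rewrite Listₚ.filter-++ (¬? ∘ Q?) F (fibers E) | Listₚ.filter-all (¬? ∘ Q?) (Allₚ.¬Any⇒All¬ F none)
        | Listₚ.length-++ F {filter (¬? ∘ Q?) (fibers E)} =
  -- The first position past the end, where `get` returns `nothing`.
  length pts ∷ fs , cong suc len , ℕₚ.≤-refl ∷ fs≤ , outlier-ok , outlier-weight
  where
  outlier-ok : All (λ (p , s) → R p s) (assigned (points ((p , F) ∷ E)) (get pts (length pts) ∷ map (get pts) fs))
  outlier-ok rewrite get-length pts = ok
  outlier-weight : outlierWeight (weights ((p , F) ∷ E)) (get pts (length pts) ∷ map (get pts) fs)
    ℕ.≤ length F ℕ.+ length (filter (¬? ∘ Q?) (fibers E))
  outlier-weight rewrite get-length pts = ℕₚ.+-monoʳ-≤ (length F) weight≤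
... | fs , len , fs≤ , ok , weight≤ | yes some with near (proj₁ (proj₂ found′)) (proj₂ (proj₂ found′))
  where
  found′ : ∃ λ y → y ∈ˡ F × Q y
  found′ = Membership.find some
... | s , s∈ , r with get-∈ s∈
... | i , i≤ , eq = i ∷ fs , cong suc len , i≤ ∷ fs≤ , assigned-ok , assigned-weight
  where
  assigned-ok : All (λ (p , s) → R p s) (assigned (points ((p , F) ∷ E)) (get pts i ∷ map (get pts) fs))
  assigned-ok rewrite eq = r ∷ ok
  assigned-weight : outlierWeight (weights ((p , F) ∷ E)) (get pts i ∷ map (get pts) fs)
    ℕ.≤ length (filter (¬? ∘ Q?) (F ++ fibers E))
  assigned-weight rewrite eq | Listₚ.filter-++ (¬? ∘ Q?) F (fibers E)
    | Listₚ.length-++ (filter (¬? ∘ Q?) F) {filter (¬? ∘ Q?) (fibers E)} = ℕₚ.≤-trans weight≤ (ℕₚ.m≤n+m _ _)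

-- Scanning from the end, a point is selected unless a selected one is already within reach. The
-- result is separated and, being maximal, also a net.
greedy : ∀ {R : A → A → Set p} (R? : ∀ x y → Dec (R x y)) (R-refl : ∀ x → R x x) xs →
  ∃ λ fs → length fs ≡ length xs × All (ℕ._≤ 1) fs ×
    AllPairs (λ x y → ¬ R x y) (select fs xs) × All (λ x → Any (R x) (select fs xs)) xs
greedy R? R-refl [] = [] , refl , [] , [] , []
greedy R? R-refl (x ∷ xs) with greedy R? R-refl xs
... | fs , len , fs≤ , sep , cov with Any.any? (R? x) (select fs xs)
...   | yes near = 0 ∷ fs , cong suc len , ℕ.z≤n ∷ fs≤ , sep , near ∷ cov
...   | no far   = 1 ∷ fs , cong suc len , ℕₚ.≤-refl ∷ fs≤ , Allₚ.¬Any⇒All¬ _ far ∷ sep ,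
                   here (R-refl x) ∷ All.map there cov

-- Inequalities between multiples of distances

module ScaledInequalities {c ℓ₁ ℓ₂ : Level} (𝓡 : ArchimedeanField c ℓ₁ ℓ₂) where

  open ArchimedeanField 𝓡
  open OrderedField 𝓡
  open ≤-Reasoning

  -- Fractions of the scale are written with integer multiples on the other side, which is also the
  -- form of the machine's comparisons.
  eighths-+ : ∀ {x y t} → fromℕ 8 * x ≤ t → fromℕ 8 * y ≤ t → fromℕ 4 * (x + y) ≤ t
  eighths-+ {x} {y} {t} 8x≤t 8y≤t = halve-≤ (begin
    fromℕ 4 * (x + y) + fromℕ 4 * (x + y)  ≈⟨ fromℕ-double 4 (x + y) ⟨
    fromℕ 8 * (x + y)                      ≈⟨ distribˡ (fromℕ 8) x y ⟩
    fromℕ 8 * x + fromℕ 8 * y              ≤⟨ +-mono-≤ 8x≤t 8y≤t ⟩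
    t + t                                  ∎)

  fourth≤eighth : ∀ {x t} → 0# ≤ x → fromℕ 8 * x ≤ t → fromℕ 4 * x ≤ t
  fourth≤eighth {x} 0≤x = ≤-trans (*-monoˡ-≤ x 0≤x (fromℕ-mono {4} {8} (ℕₚ.m≤m+n 4 4)))

  -- The step that keeps the errors bounded: what is a quarter of the old scale is at most an eighth
  -- of the new one.
  fourth⇒eighth : ∀ {x s t} → fromℕ 4 * x ≤ s → fromℕ 2 * s ≤ t → fromℕ 8 * x ≤ t
  fourth⇒eighth {x} {s} {t} 4x≤s 2s≤t = begin
    fromℕ 8 * x                ≈⟨ fromℕ-double 4 x ⟩
    fromℕ 4 * x + fromℕ 4 * x  ≤⟨ +-mono-≤ 4x≤s 4x≤s ⟩
    s + s                      ≈⟨ fromℕ-2-* s ⟨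
    fromℕ 2 * s                ≤⟨ 2s≤t ⟩
    t                          ∎

  fourth-* : ∀ x → fromℕ 4 * x ≈ (x + x) + (x + x)
  fourth-* x = Eq.trans (fromℕ-double 2 x) (+-cong (fromℕ-2-* x) (fromℕ-2-* x))

  -- For the path from a stored point to a point of its fiber (x), on to that point's optimal center
  -- (s) and then to the replacement of the center (y): its length is at most s + t/2.
  +-fourths : ∀ {x y s t} → fromℕ 4 * x ≤ t → fromℕ 4 * y ≤ t → fromℕ 2 * (x + (s + y)) ≤ fromℕ 2 * s + t
  +-fourths {x} {y} {s} {t} 4x≤t 4y≤t = begin
    fromℕ 2 * (x + (s + y))        ≈⟨ fromℕ-2-* _ ⟩
    (x + (s + y)) + (x + (s + y))  ≈⟨ solve 3 (λ x y s → (x :+ (s :+ y)) :+ (x :+ (s :+ y)) := (s :+ s) :+ ((x :+ x) :+ (y :+ y))) Eq.refl x y s ⟩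
    (s + s) + ((x + x) + (y + y))  ≤⟨ +-mono-≤ (≤-reflexive (Eq.sym (fromℕ-2-* s))) (halve-≤ (begin
        ((x + x) + (y + y)) + ((x + x) + (y + y))  ≈⟨ solve 2 (λ x y → ((x :+ x) :+ (y :+ y)) :+ ((x :+ x) :+ (y :+ y)) := ((x :+ x) :+ (x :+ x)) :+ ((y :+ y) :+ (y :+ y))) Eq.refl x y ⟩
        ((x + x) + (x + x)) + ((y + y) + (y + y))  ≈⟨ +-cong (fourth-* x) (fourth-* y) ⟨
        fromℕ 4 * x + fromℕ 4 * y                  ≤⟨ +-mono-≤ 4x≤t 4y≤t ⟩
        t + t                                      ∎)) ⟩
    fromℕ 2 * s + t                ∎

  -- For a point at distance x from its stored representative, which is at distance y from a center:
  -- x ≤ t/4 ≤ s/2 and y ≤ s + t/2 ≤ 2s, where s is the optimum.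
  three-times : ∀ {x y s t} → fromℕ 4 * x ≤ t → fromℕ 2 * y ≤ fromℕ 2 * s + t → t ≤ s + s → 0# ≤ s → x + y ≤ fromℕ 3 * s
  three-times {x} {y} {s} {t} 4x≤t 2y≤ t≤ 0≤s = begin
    x + y            ≤⟨ +-mono-≤ x≤s y≤ ⟩
    s + (s + s)      ≈⟨ +-cong (fromℕ-1-* s) (fromℕ-2-* s) ⟨
    fromℕ 1 * s + fromℕ 2 * s  ≈⟨ distribʳ s (fromℕ 1) (fromℕ 2) ⟨
    (fromℕ 1 + fromℕ 2) * s    ≈⟨ *-congʳ (+-cong fromℕ-1 Eq.refl) ⟩
    fromℕ 3 * s      ∎
    where
    x≤s : x ≤ s
    x≤s = halve-≤ (halve-≤ (begin
      (x + x) + (x + x)  ≈⟨ fourth-* x ⟨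
      fromℕ 4 * x        ≤⟨ 4x≤t ⟩
      t                  ≤⟨ t≤ ⟩
      s + s              ≤⟨ ≤-+ˡ (≤-trans 0≤s (≤-+ˡ 0≤s)) ⟩
      (s + s) + (s + s)  ∎))
    y≤ : y ≤ s + s
    y≤ = halve-≤ (begin
      y + y              ≈⟨ fromℕ-2-* y ⟨
      fromℕ 2 * y        ≤⟨ 2y≤ ⟩
      fromℕ 2 * s + t    ≤⟨ +-mono-≤ (≤-reflexive (fromℕ-2-* s)) t≤ ⟩
      (s + s) + (s + s)  ∎)

-- Invariants of the stored points

AllPairs-remove : ∀ {R : A → A → Set p} xs {y ys} → AllPairs R (xs ++ y ∷ ys) → AllPairs R (xs ++ ys)
AllPairs-remove []       (_ ∷ rs) = rs
AllPairs-remove (x ∷ xs) (r ∷ rs) =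
  Allₚ.++⁺ (Allₚ.++⁻ˡ xs r) (All.tail (Allₚ.++⁻ʳ xs r)) ∷ AllPairs-remove xs rs

AllPairs-snoc : ∀ {R : A → A → Set p} {xs y} → AllPairs R xs → All (λ x → R x y) xs → AllPairs R (xs ++ y ∷ [])
AllPairs-snoc []       []         = [] ∷ []
AllPairs-snoc (r ∷ rs) (rxy ∷ ry) = Allₚ.++⁺ r (rxy ∷ []) ∷ AllPairs-snoc rs ry

Unique-resp-↭ : {xs ys : List A} → xs ↭ ys → Unique xs → Unique ys
Unique-resp-↭ {A = A} xs↭ys = Permₛ.Unique-resp-↭ (≡.setoid A) (Permutation.↭⇒↭ₛ xs↭ys)

module Invariants {c ℓ₁ ℓ₂ : Level} (𝓡 : ArchimedeanField c ℓ₁ ℓ₂) {n : ℕ} (V : RMC.Metric 𝓡 n) (M : Matroid n)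
  (k z : ℕ) (z<n : z ℕ.< n) (rank : Matroid.IsRank M k) (singletons : ∀ j → Matroid.Indep M ⁅ j ⁆)
  {opt : ArchimedeanField.Carrier 𝓡} (isOptimum : RMC.IsOptimum 𝓡 V M z opt) where

  open ArchimedeanField 𝓡
  open OrderedField 𝓡
  open ≤-Reasoning
  open ScaledInequalities 𝓡
  open RMC 𝓡
  open MetricGeometry 𝓡 V
  open Matroid M

  Close : Carrier → List (Fin n) → Set ℓ₂
  Close t J = ∀ {x y} → x ∈ˡ J → y ∈ˡ J → fromℕ 8 * d x y ≤ t

  Near : Fin n → Fin n → List (Entry n) → List (Entry n) → Fin n → Fin n → Set ℓ₂
  Near u v D Q y q = (q ∈ˡ points D × fromℕ 4 * d y q ≤ d u v) ⊎ (q ∈ˡ points Q × fromℕ 8 * d y q ≤ d u v)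

  -- ys is the part of the stream read so far, D holds the kept entries and Q
  -- those still to be inserted at the current scale d(u,v).
  record Invariant (u v : Fin n) (D Q : List (Entry n)) (ys : List (Fin n)) : Set (c ⊔ ℓ₁ ⊔ ℓ₂) where
    field
      fibers-↭     : fibers (D ++ Q) ↭ ys
      kept-near    : FibersSatisfy (λ y q → fromℕ 4 * d y q ≤ d u v) D
      pending-near : FibersSatisfy (λ y q → fromℕ 8 * d y q ≤ d u v) Q
      -- Distances start at y itself, so that a chain of exchanges through several discarded points
      -- does not accumulate their distances.
      spanned      : ∀ {y} → y ∈ˡ ys → Exchangeable M y (Near u v D Q y)
      -- Subsets are given by filters because this is the form in which candidates select them.
      scattered    : ∀ χ → Close (d u v) (filterᵇ χ (points D)) → Indep (set (filterᵇ χ (points D)))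
      scale≤       : d u v ≤ opt + opt
      unique       : Unique (points (D ++ Q))
      -- Ensures that the next point of the stream is not yet stored, which `unique` depends on.
      seen         : ∀ {p} → p ∈ˡ points (D ++ Q) → p ∈ˡ ys

  points-++ : ∀ D Q → points {n} (D ++ Q) ≡ points D ++ points Q
  points-++ = Listₚ.map-++ proj₁

  indep-singleton : ∀ p → Indep (set (p ∷ []))
  indep-singleton p = hereditary ⊆p (singletons p)
    where
    ⊆p : set (p ∷ []) ⊆ ⁅ p ⁆
    ⊆p x∈ with x∈p∪q⁻ ⁅ p ⁆ ⊥ x∈
    ... | inj₁ x∈p = x∈p
    ... | inj₂ x∈⊥ = ⊥-elim (∉⊥ x∈⊥)

  fourth-via : ∀ {y p q t} → fromℕ 8 * d y p ≤ t → fromℕ 8 * d p q ≤ t → fromℕ 4 * d y q ≤ t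
  fourth-via {y} {p} {q} le₁ le₂ = ≤-trans (*-monoʳ-≤ (fromℕ 4) (0≤fromℕ 4) (triangle y p q)) (eighths-+ le₁ le₂)

  -- The fibers move by at most an eighth of the scale, which adds to the
  -- eighth allowed while pending.
  discard : ∀ {u v D p F Q ys} → Invariant u v D ((p , F) ∷ Q) ys → ∀ fs → let J = select fs (points D) in
    Indep (set J) → ¬ Indep (set (p ∷ J)) → All (λ q → fromℕ 8 * d p q ≤ d u v) J →
    Invariant u v (addFiber fs F D) Q ys
  discard {u} {v} {D} {p} {F} {Q} {ys} inv fs J-ind pJ-dep J-near = record
    { fibers-↭     = ↭-trans
        (↭-reflexive (fibers-++ D′ Q))
        (↭-trans (Permₚ.++⁺ʳ (fibers Q) (fibers-addFiber fs F D J≢[]))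
        (↭-trans (↭-reflexive (Listₚ.++-assoc F (fibers D) (fibers Q)))
        (↭-trans (Permₚ.shifts F (fibers D))
        (↭-trans (↭-reflexive (≡.sym (fibers-++ D ((p , F) ∷ Q)))) fibers-↭))))
    ; kept-near    = fibersSatisfy-addFiber fs F D F-near kept-near
    ; pending-near = All.tail pending-near
    ; spanned      = λ y∈ → exchangeable-trans M (spanned y∈) respan
    ; scattered    = ≡.subst (λ P → ∀ χ → Close (d u v) (filterᵇ χ P) → Indep (set (filterᵇ χ P))) (≡.sym points≡) scattered
    ; scale≤       = scale≤
    ; unique       = ≡.subst Unique (≡.sym points-++′)
        (AllPairs-remove (points D) (≡.subst Unique (points-++ D ((p , F) ∷ Q)) unique))
    ; seen         = λ {x} x∈ → seen (≡.subst (x ∈ˡ_) (≡.sym (points-++ D ((p , F) ∷ Q)))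
        (insert (∈-++⁻ (points D) (≡.subst (x ∈ˡ_) points-++′ x∈))))
    }
    where
    open Invariant inv
    D′ = addFiber fs F D
    J  = select fs (points D)
    points≡ : points D′ ≡ points D
    points≡ = points-addFiber fs F D
    points-++′ : points (D′ ++ Q) ≡ points D ++ points Q
    points-++′ = ≡.trans (points-++ D′ Q) (cong (_++ points Q) points≡)
    insert : ∀ {x} → x ∈ˡ points D ⊎ x ∈ˡ points Q → x ∈ˡ points D ++ p ∷ points Q
    insert (inj₁ x∈) = ∈-++⁺ˡ x∈
    insert (inj₂ x∈) = ∈-++⁺ʳ (points D) (there x∈)
    -- A single point is independent, so a set that spans p cannot be empty, and the fiber of p
    -- finds a recipient.
    J≢[] : J ≢ []
    J≢[] eq = pJ-dep (≡.subst (λ J → Indep (set (p ∷ J))) (≡.sym eq) (indep-singleton p))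
    F-near : ∀ {q} → q ∈ˡ J → All (λ y → fromℕ 4 * d y q ≤ d u v) F
    F-near q∈ = All.map (λ {y} y-p → fourth-via {y} {p} y-p (All.lookup J-near q∈)) (All.head pending-near)
    respan : ∀ {y x} → Near u v D ((p , F) ∷ Q) y x → Exchangeable M x (Near u v D′ Q y)
    respan {y} {x} (inj₁ (x∈ , y-x)) = exchangeable-refl M (inj₁ (≡.subst (x ∈ˡ_) (≡.sym points≡) x∈ , y-x))
    respan {y} (inj₂ (there x∈ , y-x)) = exchangeable-refl M (inj₂ (x∈ , y-x))
    respan {y} (inj₂ (here refl , y-p)) = exchangeable-trans M (dependent⇒exchangeable M {p} {J} J-ind pJ-dep)
      λ {q} q∈J → exchangeable-refl M (inj₁
        (≡.subst (q ∈ˡ_) (≡.sym points≡) (∈-select fs q∈J) , fourth-via {y} {p} y-p (All.lookup J-near q∈J)))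

  -- The hypothesis is what a failed search gives: no independent set of kept points within an
  -- eighth of the scale spans p. A close set of stored points that includes p is thus independent
  -- as soon as the rest of it is.
  keep : ∀ {u v D p F Q ys} → Invariant u v D ((p , F) ∷ Q) ys →
    (∀ χ → let J = filterᵇ χ (points D) in
      Indep (set J) → All (λ q → fromℕ 8 * d p q ≤ d u v) J → Indep (set (p ∷ J))) →
    Invariant u v (D ++ (p , F) ∷ []) Q ys
  keep {u} {v} {D} {p} {F} {Q} {ys} inv extend = record
    { fibers-↭     = ≡.subst (λ E → fibers E ↭ ys) assoc fibers-↭
    ; kept-near    = Allₚ.++⁺ kept-near (All.map (fourth≤eighth 0≤d) (All.head pending-near) ∷ [])
    ; pending-near = All.tail pending-near
    ; spanned      = λ y∈ → exchangeable-trans M (spanned y∈) (exchangeable-refl M ∘ respan)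
    ; scattered    = λ χ → ≡.subst (λ P → Close (d u v) (filterᵇ χ P) → Indep (set (filterᵇ χ P)))
        (≡.sym (points-++ D ((p , F) ∷ []))) (scattered′ χ)
    ; scale≤       = scale≤
    ; unique       = ≡.subst (Unique ∘ points) assoc unique
    ; seen         = λ {x} x∈ → seen (≡.subst (λ E → x ∈ˡ points E) (≡.sym assoc) x∈)
    }
    where
    open Invariant inv
    assoc : D ++ (p , F) ∷ Q ≡ (D ++ (p , F) ∷ []) ++ Q
    assoc = ≡.sym (Listₚ.++-assoc D ((p , F) ∷ []) Q)
    in-kept : ∀ {x} → x ∈ˡ points D ++ p ∷ [] → x ∈ˡ points (D ++ (p , F) ∷ [])
    in-kept {x} = ≡.subst (x ∈ˡ_) (≡.sym (points-++ D ((p , F) ∷ [])))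
    respan : ∀ {y x} → Near u v D ((p , F) ∷ Q) y x → Near u v (D ++ (p , F) ∷ []) Q y x
    respan (inj₁ (x∈ , y-x))         = inj₁ (in-kept (∈-++⁺ˡ x∈) , y-x)
    respan (inj₂ (there x∈ , y-x))   = inj₂ (x∈ , y-x)
    respan (inj₂ (here refl , y-x))  = inj₁ (in-kept (∈-++⁺ʳ (points D) (here refl)) , fourth≤eighth 0≤d y-x)
    filterᵇ-++ : ∀ (χ : Fin n → Bool) xs ys → filterᵇ χ (xs ++ ys) ≡ filterᵇ χ xs ++ filterᵇ χ ys
    filterᵇ-++ χ []       ys = refl
    filterᵇ-++ χ (x ∷ xs) ys with χ x
    ... | true  = cong (x ∷_) (filterᵇ-++ χ xs ys)
    ... | false = filterᵇ-++ χ xs ys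
    last : ∀ χ → let J = filterᵇ χ (points D) in ∀ L → L ≡ [] ⊎ L ≡ p ∷ [] →
      Close (d u v) (J ++ L) → Indep (set (J ++ L))
    last χ _ (inj₁ refl) close = ≡.subst (λ xs → Indep (set xs)) (≡.sym (Listₚ.++-identityʳ (filterᵇ χ (points D))))
      (scattered χ λ x∈ y∈ → close (∈-++⁺ˡ x∈) (∈-++⁺ˡ y∈))
    last χ _ (inj₂ refl) close = indep-⊆ M {J ++ p ∷ []} {p ∷ J} swap (extend χ
        (scattered χ λ x∈ y∈ → close (∈-++⁺ˡ x∈) (∈-++⁺ˡ y∈))
        (All.tabulate λ q∈ → close (∈-++⁺ʳ J (here refl)) (∈-++⁺ˡ q∈)))
      where
      J = filterᵇ χ (points D)
      swap : ∀ {x} → x ∈ˡ J ++ p ∷ [] → x ∈ˡ p ∷ J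
      swap x∈ with ∈-++⁻ J x∈
      ... | inj₁ x∈J        = there x∈J
      ... | inj₂ (here eq)  = here eq
    last-filter : ∀ (χ : Fin n → Bool) → filterᵇ χ (p ∷ []) ≡ [] ⊎ filterᵇ χ (p ∷ []) ≡ p ∷ []
    last-filter χ with χ p
    ... | true  = inj₂ refl
    ... | false = inj₁ refl
    scattered′ : ∀ χ → Close (d u v) (filterᵇ χ (points D ++ p ∷ [])) → Indep (set (filterᵇ χ (points D ++ p ∷ [])))
    scattered′ χ rewrite filterᵇ-++ χ (points D) (p ∷ []) = last χ (filterᵇ χ (p ∷ [])) (last-filter χ)

  -- All entries become pending, and the larger scale absorbs their error. With nothing kept,
  -- `scattered` only concerns the empty set.
  raise : ∀ {u v x y D ys} → Invariant u v D [] ys → fromℕ 2 * d u v ≤ d x y → d x y ≤ opt + opt → Invariant x y [] D ys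
  raise {u} {v} {x} {y} {D} inv 2μ≤ν ν≤ = record
    { fibers-↭     = ≡.subst (λ E → fibers E ↭ _) (Listₚ.++-identityʳ D) fibers-↭
    ; kept-near    = []
    ; pending-near = All.map (All.map λ 4d≤ → fourth⇒eighth 4d≤ 2μ≤ν) kept-near
    ; spanned      = λ y∈ → exchangeable-trans M (spanned y∈) (exchangeable-refl M ∘ respan)
    ; scattered    = λ _ _ → ∅-indep
    ; scale≤       = ν≤
    ; unique       = ≡.subst (Unique ∘ points) (Listₚ.++-identityʳ D) unique
    ; seen         = λ {p} p∈ → seen (≡.subst (λ E → p ∈ˡ points E) (≡.sym (Listₚ.++-identityʳ D)) p∈)
    }
    where
    open Invariant inv
    respan : ∀ {w q} → Near u v D [] w q → Near x y [] D w q
    respan (inj₁ (q∈ , 4d≤)) = inj₂ (q∈ , fourth⇒eighth 4d≤ 2μ≤ν)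
    respan (inj₂ (() , _))

  eighth-self : ∀ x {u v} → fromℕ 8 * d x x ≤ d u v
  eighth-self x {u} {v} = begin
    fromℕ 8 * d x x  ≈⟨ *-congˡ (≈⇒0 refl) ⟩
    fromℕ 8 * 0#     ≈⟨ zeroʳ (fromℕ 8) ⟩
    0#               ≤⟨ 0≤d ⟩
    d u v            ∎

  receive : ∀ {u v D ys} x → Invariant u v D [] ys → x ∉ˡ ys → Invariant u v D ((x , x ∷ []) ∷ []) (ys ++ x ∷ [])
  receive {u} {v} {D} {ys} x inv x∉ = record
    { fibers-↭     = ↭-trans (↭-reflexive (fibers-++ D ((x , x ∷ []) ∷ [])))
        (Permₚ.++⁺ʳ (x ∷ []) (≡.subst (λ E → fibers E ↭ ys) (Listₚ.++-identityʳ D) fibers-↭))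
    ; kept-near    = kept-near
    ; pending-near = (eighth-self x ∷ []) ∷ []
    ; spanned      = λ y∈ → span (∈-++⁻ ys y∈)
    ; scattered    = scattered
    ; scale≤       = scale≤
    ; unique       = ≡.subst Unique (≡.sym (points-++ D ((x , x ∷ []) ∷ [])))
        (AllPairs-snoc (≡.subst (Unique ∘ points) (Listₚ.++-identityʳ D) unique)
          (All.tabulate λ { p∈ refl → x∉ (seen′ p∈) }))
    ; seen         = λ {p} p∈ → see (∈-++⁻ (points D) (≡.subst (p ∈ˡ_) (points-++ D ((x , x ∷ []) ∷ [])) p∈))
    }
    where
    open Invariant inv
    seen′ : ∀ {p} → p ∈ˡ points D → p ∈ˡ ys
    seen′ {p} p∈ = seen (≡.subst (λ E → p ∈ˡ points E) (≡.sym (Listₚ.++-identityʳ D)) p∈)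
    see : ∀ {p} → p ∈ˡ points D ⊎ p ∈ˡ x ∷ [] → p ∈ˡ ys ++ x ∷ []
    see (inj₁ p∈) = ∈-++⁺ˡ (seen′ p∈)
    see (inj₂ p∈) = ∈-++⁺ʳ ys p∈
    respan : ∀ {w q} → Near u v D [] w q → Near u v D ((x , x ∷ []) ∷ []) w q
    respan (inj₁ near)     = inj₁ near
    respan (inj₂ (() , _))
    span : ∀ {y} → y ∈ˡ ys ⊎ y ∈ˡ x ∷ [] → Exchangeable M y (Near u v D ((x , x ∷ []) ∷ []) y)
    span (inj₁ y∈)          = exchangeable-trans M (spanned y∈) (exchangeable-refl M ∘ respan)
    span (inj₂ (here refl)) = exchangeable-refl M (inj₂ (here refl , eighth-self x))

  S* : Subset n
  S* = proj₁ (proj₁ isOptimum)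

  S*-indep : Indep S*
  S*-indep = proj₁ (proj₂ (proj₁ isOptimum))

  optimum-covers : ∃ λ (X : Subset n) → n ℕ.∸ z ℕ.≤ ∣ X ∣ × Covers S* opt X
  optimum-covers = IsCost⇒Covers z z<n {S*} {opt} (proj₂ (proj₂ (proj₁ isOptimum)))

  X* = proj₁ optimum-covers

  X*-large : n ℕ.∸ z ℕ.≤ ∣ X* ∣
  X*-large = proj₁ (proj₂ optimum-covers)

  X*-covered : Covers S* opt X*
  X*-covered = proj₂ (proj₂ optimum-covers)

  |∁X*|≤z : ∣ ∁ X* ∣ ℕ.≤ z
  |∁X*|≤z = large⇒∣∁∣≤z z z<n X* X*-large

  0≤opt : 0# ≤ opt
  0≤opt with large⇒nonempty z z<n X* X*-large
  ... | x , x∈ with X*-covered x∈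
  ...   | s , s∈ , x-s = ≤-trans 0≤d x-s

  initial-invariant : ∀ x → Invariant x x [] ((x , x ∷ []) ∷ []) (x ∷ [])
  initial-invariant x = record
    { fibers-↭     = ↭-refl
    ; kept-near    = []
    ; pending-near = (eighth-self x ∷ []) ∷ []
    ; spanned      = λ { (here refl) → exchangeable-refl M (inj₂ (here refl , eighth-self x)) }
    ; scattered    = λ _ _ → ∅-indep
    ; scale≤       = d-self x (≤-trans 0≤opt (≤-+ˡ 0≤opt))
    ; unique       = [] ∷ []
    ; seen         = id
    }

  scale-bound : ∀ {u v x y} S → ¬ (d x y ≤ fromℕ 2 * d u v) → AllPairs (λ a b → d x y ≤ d a b) S →
    k ℕ.+ z ℕ.< length S → d x y ≤ opt + opt
  scale-bound {u} {v} S large sep = packing-bound z z<n S* X* S (proj₂ rank S* S*-indep) X*-large X*-covered sep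
    -- A distance above twice the scale is positive, as the packing argument demands.
    λ ≤0 → large (≤-trans ≤0 (*-nonNegative (0≤fromℕ 2) 0≤d))

  1≤k : 1 ℕ.≤ k
  1≤k with large⇒nonempty z z<n X* X*-large
  ... | x , _ = ≡.subst (ℕ._≤ k) (∣⁅x⁆∣≡1 x) (proj₂ rank ⁅ x ⁆ (singletons x))

  fromℕ-halvings : ∀ j r → fromℕ (2 ℕ.^ j) * halvings j r ≈ r
  fromℕ-halvings zero    r = fromℕ-1-* r
  fromℕ-halvings (suc j) r = begin-equality
    fromℕ (2 ℕ.* 2 ℕ.^ j) * h            ≈⟨ *-congʳ (fromℕ-* 2 (2 ℕ.^ j)) ⟩
    (fromℕ 2 * fromℕ (2 ℕ.^ j)) * h      ≈⟨ *-assoc (fromℕ 2) (fromℕ (2 ℕ.^ j)) h ⟩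
    fromℕ 2 * (fromℕ (2 ℕ.^ j) * h)      ≈⟨ *-congˡ (fromℕ-halvings j _) ⟩
    fromℕ 2 * (r * fromℕ 2 ⁻¹)           ≈⟨ fromℕ-2-* _ ⟩
    r * fromℕ 2 ⁻¹ + r * fromℕ 2 ⁻¹      ≈⟨ half+half r ⟩
    r                                    ∎
    where h = halvings j (r * fromℕ 2 ⁻¹)

  -- Five halvings of 2t give the radius t/16, and two points of such a ball are within t/8 of each
  -- other.
  small-ball-close : ∀ {c x y t} → d x c ≤ halvings 5 (fromℕ 2 * t) → d y c ≤ halvings 5 (fromℕ 2 * t) → fromℕ 8 * d x y ≤ t
  small-ball-close {c} {x} {y} {t} x∈ y∈ = halve-≤ (begin
    fromℕ 8 * d x y + fromℕ 8 * d x y                  ≤⟨ +-mono-≤ 8d≤ 8d≤ ⟩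
    (fromℕ 16 * r + fromℕ 16 * r)                      ≈⟨ fromℕ-double 16 r ⟨
    fromℕ 32 * r                                       ≈⟨ fromℕ-halvings 5 (fromℕ 2 * t) ⟩
    fromℕ 2 * t                                        ≈⟨ fromℕ-2-* t ⟩
    t + t                                              ∎)
    where
    r = halvings 5 (fromℕ 2 * t)
    8d≤ : fromℕ 8 * d x y ≤ fromℕ 16 * r
    8d≤ = begin
      fromℕ 8 * d x y            ≤⟨ *-monoʳ-≤ (fromℕ 8) (0≤fromℕ 8) (d-via c x∈ (d-swap y∈)) ⟩
      fromℕ 8 * (r + r)          ≈⟨ distribˡ (fromℕ 8) r r ⟩
      fromℕ 8 * r + fromℕ 8 * r  ≈⟨ fromℕ-double 8 r ⟨
      fromℕ 16 * r               ∎

  closest : ∀ S → 2 ℕ.≤ length S → ∃ λ x → ∃ λ y → (x , y) ∈ˡ pairs S × All (λ (a , b) → d x y ≤ d a b) (pairs S)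
  closest (a ∷ [])     (ℕ.s≤s ())
  closest S@(a ∷ b ∷ _) _ = proj₁ best , proj₂ best ,
    argmin-all key {P = _∈ˡ pairs S} (here refl) (All.tabulate id) , f[argmin]≤f[xs] {f = key} (a , b) (pairs S)
    where
    open Extrema ≤-totalOrder using (argmin; argmin-all; f[argmin]≤f[xs])
    key : Fin n × Fin n → Carrier
    key (x , y) = d x y
    best : Fin n × Fin n
    best = argmin key (a , b) (pairs S)

  -- A maximal set of stored points at distances above 2μ has at most k + z
  -- elements, so that as many balls of radius 2μ cover the stored points.
  -- Halving them five times gives balls of radius μ/16, each of which holds at
  -- most k stored points as these are independent.
  size-bound : ∀ {Λ u v D ys} → HalfBallCover V Λ → Invariant u v D [] ys →
    (∀ fs x y → length fs ≡ length D → All (ℕ._≤ 1) fs → x ∈ˡ points D → y ∈ˡ points D →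
      k ℕ.+ z ℕ.< length (select fs (points D)) → ¬ (d x y ≤ fromℕ 2 * d u v) →
      ¬ All (λ (a , b) → d x y ≤ d a b) (pairs (select fs (points D)))) →
    length D ℕ.≤ (k ℕ.+ z) ℕ.* Λ ℕ.^ 5 ℕ.* k
  size-bound {Λ} {u} {v} {D} {ys} cover inv none = bound
    where
    open Invariant inv
    P = points D
    t = fromℕ 2 * d u v
    0≤t : 0# ≤ t
    0≤t = *-nonNegative (0≤fromℕ 2) 0≤d
    net = greedy (λ x y → d x y ≤? t) (λ x → d-self x 0≤t) P
    fs = proj₁ net
    S = select fs P
    S-sep : AllPairs (λ x y → ¬ (d x y ≤ t)) S
    S-sep = proj₁ (proj₂ (proj₂ (proj₂ net)))
    crowded : k ℕ.+ z ℕ.< length S → False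
    -- Since 1 ≤ k, more than k + z points are at least two, so a closest pair exists. Together with
    -- the net it would have been a successful candidate.
    crowded long with closest S (ℕₚ.≤-trans (ℕ.s≤s (ℕₚ.≤-trans 1≤k (ℕₚ.m≤m+n k z))) long)
    ... | x , y , xy∈ , least = none fs x y (≡.trans (proj₁ (proj₂ net)) (Listₚ.length-map proj₁ D))
      (proj₁ (proj₂ (proj₂ net))) (∈-select fs (proj₁ (∈-pairs S xy∈))) (∈-select fs (proj₂ (∈-pairs S xy∈)))
      long (All.lookup (pairs⁺ S-sep) xy∈) least
    balls : ∃ λ cs → length cs ℕ.≤ length S ℕ.* Λ ℕ.^ 5 ×
      (∀ {x} → x ∈ˡ P → Any (λ c → InBall V c (halvings 5 t) x) cs)
    balls = cover-balls-iterated cover 5 (_∈ˡ P) S t (All.lookup (proj₂ (proj₂ (proj₂ (proj₂ net)))))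
    unique-P : Unique P
    unique-P = ≡.subst (Unique ∘ points) (Listₚ.++-identityʳ D) unique
    in-ball : Fin n → Fin n → Bool
    in-ball c x = ⌊ d x c ≤? halvings 5 t ⌋
    close : ∀ c {x} → x ∈ˡ filterᵇ (in-ball c) P → d x c ≤ halvings 5 t
    close c x∈ = toWitness (proj₂ (∈-filter⁻ (T? ∘ in-ball c) {xs = P} x∈))
    small : ∀ c → length (filterᵇ (in-ball c) P) ℕ.≤ k
    small c = ℕₚ.≤-trans (length-Unique-≤ {S = set J} (Uniqueₚ.filter⁺ (T? ∘ in-ball c) unique-P) ∈-set⁺)
      (proj₂ rank (set J) (scattered (in-ball c) λ x∈ y∈ → small-ball-close (close c x∈) (close c y∈)))
      where J = filterᵇ (in-ball c) P
    bound : length D ℕ.≤ (k ℕ.+ z) ℕ.* Λ ℕ.^ 5 ℕ.* k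
    bound with ℕₚ.≤-<-connex (length S) (k ℕ.+ z)
    ... | inj₂ long = ⊥-elim (crowded long)
    ... | inj₁ |S|≤ = ℕₚ.≤-trans (ℕₚ.≤-reflexive (≡.sym (Listₚ.length-map proj₁ D)))
      (ℕₚ.≤-trans (length≤-cover (λ c → T? ∘ in-ball c) (proj₁ balls) k P
          (All.tabulate λ x∈ → Any.map (λ x-c → fromWitness x-c) (proj₂ (proj₂ balls) x∈)) small)
      (ℕₚ.*-monoˡ-≤ k (ℕₚ.≤-trans (proj₁ (proj₂ balls)) (ℕₚ.*-monoˡ-≤ (Λ ℕ.^ 5) |S|≤))))

-- Feasible assignments and the cost of their centers

module Solutions {c ℓ₁ ℓ₂ : Level} (𝓡 : ArchimedeanField c ℓ₁ ℓ₂) {n : ℕ} (V : RMC.Metric 𝓡 n) (M : Matroid n)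
  (k z : ℕ) (z<n : z ℕ.< n) (rank : Matroid.IsRank M k) (singletons : ∀ j → Matroid.Indep M ⁅ j ⁆)
  {opt : ArchimedeanField.Carrier 𝓡} (isOptimum : RMC.IsOptimum 𝓡 V M z opt) where

  open ArchimedeanField 𝓡
  open OrderedField 𝓡
  open ≤-Reasoning
  open ScaledInequalities 𝓡
  open RMC 𝓡
  open MetricGeometry 𝓡 V
  open Matroid M
  open Invariants 𝓡 V M k z z<n rank singletons isOptimum

  record Feasible (u v : Fin n) (D : List (Entry n)) (x y : Fin n) (fs : List ℕ) : Set ℓ₂ where
    pts : List (Fin n)
    pts = u ∷ v ∷ points D
    field
      length-fs : length fs ≡ length D
      light     : outlierWeight (weights D) (map (get pts) fs) ℕ.≤ z
      indep     : Indep (set (map proj₂ (assigned (points D) (map (get pts) fs))))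
      radius    : All (λ (p , s) → d p s ≤ d x y) (assigned (points D) (map (get pts) fs))

  module _ {u v : Fin n} {D : List (Entry n)} {ys : List (Fin n)}
    (inv : Invariant u v D [] ys) (complete : ∀ y → y ∈ˡ ys) (ys-unique : Unique ys) where

    open Invariant inv

    private
      pts : List (Fin n)
      pts = u ∷ v ∷ points D

      fibers-D : fibers D ↭ ys
      fibers-D = ≡.subst (λ E → fibers E ↭ ys) (Listₚ.++-identityʳ D) fibers-↭

    zero-radius : fromℕ 2 * d u u ≤ fromℕ 2 * opt + d u v
    zero-radius = begin
      fromℕ 2 * d u u        ≈⟨ *-congˡ (≈⇒0 refl) ⟩
      fromℕ 2 * 0#           ≈⟨ zeroʳ (fromℕ 2) ⟩
      0#                     ≤⟨ *-nonNegative (0≤fromℕ 2) 0≤opt ⟩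
      fromℕ 2 * opt          ≤⟨ ≤-+ˡ 0≤d ⟩
      fromℕ 2 * opt + d u v  ∎

    FeasibleExists : Set ℓ₂
    FeasibleExists = ∃ λ (i : ℕ) → ∃ λ (j : ℕ) → ∃ λ (fs : List ℕ) → (i ℕ.≤ length pts × j ℕ.≤ length pts × All (ℕ._≤ length pts) fs) ×
      Feasible u v D (nth u pts i) (nth u pts j) fs ×
      fromℕ 2 * d (nth u pts i) (nth u pts j) ≤ fromℕ 2 * opt + d u v

    -- The witness comes from the optimal solution by exchanging its centers for stored points. If
    -- the fiber of a stored point meets `X*`, the replacement of the optimal center of such a point
    -- serves the stored point. Otherwise the stored point is an outlier; all these fibers lie
    -- outside `X*` and, being disjoint, contain at most z points.
    feasible-exists : FeasibleExists
    feasible-exists = assemble (independent-exchange M {A = Near u v D []} S*-indep (λ {o} _ → spanned (complete o)))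
      where
      open Extrema ≤-totalOrder using (argmax; argmax-all; f[xs]≤f[argmax])
      assemble : (∃ λ S → Indep (set S) × (∀ {o} → o ∈ S* → Any (Near u v D [] o) S) ×
          All (λ q → ∃ λ o → Near u v D [] o q) S) → FeasibleExists
      assemble (S , S-ind , reach , from) =
        i , j , fs , (proj₁ (proj₂ position-x) , proj₁ (proj₂ position-y) , fs≤) ,
        ≡.subst₂ (λ x y → Feasible u v D x y fs) (≡.sym (proj₂ (proj₂ position-x))) (≡.sym (proj₂ (proj₂ position-y))) feasible ,
        ≡.subst₂ (λ x y → fromℕ 2 * d x y ≤ fromℕ 2 * opt + d u v) (≡.sym (proj₂ (proj₂ position-x))) (≡.sym (proj₂ (proj₂ position-y))) radius≤
        where
        R : Fin n → Fin n → Set ℓ₂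
        R p s = s ∈ˡ S × s ∈ˡ pts × fromℕ 2 * d p s ≤ fromℕ 2 * opt + d u v
        in-pts : ∀ {q} → (∃ λ o → Near u v D [] o q) → q ∈ˡ pts
        in-pts (_ , inj₁ (q∈ , _)) = there (there q∈)
        in-pts (_ , inj₂ (() , _))
        near≤ : ∀ {o q} → Near u v D [] o q → fromℕ 4 * d o q ≤ d u v
        near≤ (inj₁ (_ , le))  = le
        near≤ (inj₂ (() , _))
        serve : ∀ {p F} → All (λ y → fromℕ 4 * d y p ≤ d u v) F → ∀ {y} → y ∈ˡ F → y ∈ X* → ∃ λ s → s ∈ˡ pts × R p s
        serve {p} F-near {y} y∈F y∈X = s , s∈pts , s∈ , s∈pts ,
          ≤-trans (*-monoʳ-≤ (fromℕ 2) (0≤fromℕ 2) (d-via y (≤-reflexive (d-sym p y)) (d-via o y-o ≤-refl)))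
            (+-fourths {d y p} {d o s} {opt} {d u v} (All.lookup F-near y∈F) (near≤ o-s))
          where
          center : ∃ λ o → o ∈ S* × d y o ≤ opt
          center = X*-covered y∈X
          o = proj₁ center
          y-o = proj₂ (proj₂ center)
          substitute : ∃ λ s → s ∈ˡ S × Near u v D [] o s
          substitute = Membership.find (reach (proj₁ (proj₂ center)))
          s = proj₁ substitute
          s∈ = proj₁ (proj₂ substitute)
          o-s = proj₂ (proj₂ substitute)
          s∈pts : s ∈ˡ pts
          s∈pts = in-pts (All.lookup from s∈)
        plan : ∃ λ fs → length fs ≡ length D × All (ℕ._≤ length pts) fs ×
          All (λ (p , s) → R p s) (assigned (points D) (map (get pts) fs)) ×
          outlierWeight (weights D) (map (get pts) fs) ℕ.≤ length (filter (¬? ∘ (_∈? X*)) (fibers D))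
        plan = assignment-exists (_∈? X*) {R} pts D (All.map serve kept-near)
        fs = proj₁ plan
        σ = map (get pts) fs
        τ = assigned (points D) σ
        fs≤ : All (ℕ._≤ length pts) fs
        fs≤ = proj₁ (proj₂ (proj₂ plan))
        τ-ok : All (λ (p , s) → R p s) τ
        τ-ok = proj₁ (proj₂ (proj₂ (proj₂ plan)))
        key : Fin n × Fin n → Carrier
        key (p , s) = d p s
        xy : Fin n × Fin n
        -- The radius is the largest assigned distance; the pair (u , u), at distance 0, is there
        -- for the case of an empty assignment.
        xy = argmax key (u , u) τ
        members : proj₁ xy ∈ˡ pts × proj₂ xy ∈ˡ pts
        members = argmax-all key {P = λ (p , s) → p ∈ˡ pts × s ∈ˡ pts} {xs = τ} (here refl , here refl)
          (All.tabulate λ ps∈ → there (there (assigned-∈ (points D) σ ps∈)) , proj₁ (proj₂ (All.lookup τ-ok ps∈)))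
        radius≤ : fromℕ 2 * d (proj₁ xy) (proj₂ xy) ≤ fromℕ 2 * opt + d u v
        radius≤ = argmax-all key {P = λ (p , s) → fromℕ 2 * d p s ≤ fromℕ 2 * opt + d u v} {xs = τ}
          zero-radius (All.map (proj₂ ∘ proj₂) τ-ok)
        position-x : ∃ λ i → i ℕ.≤ length pts × nth u pts i ≡ proj₁ xy
        position-x = nth-∈ (proj₁ members)
        position-y : ∃ λ i → i ℕ.≤ length pts × nth u pts i ≡ proj₂ xy
        position-y = nth-∈ (proj₂ members)
        i j : ℕ
        i = proj₁ position-x
        j = proj₁ position-y
        ∉X? : Decidable (λ y → ¬ (y ∈ X*))
        ∉X? y = ¬? (y ∈? X*)
        few : length (filter ∉X? (fibers D)) ℕ.≤ z
        few = ℕₚ.≤-trans (length-Unique-≤ {S = ∁ X*} (Uniqueₚ.filter⁺ ∉X? fibers-unique)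
          (λ y∈ → x∉p⇒x∈∁p (proj₂ (∈-filter⁻ ∉X? {xs = fibers D} y∈)))) |∁X*|≤z
          where
          fibers-unique : Unique (fibers D)
          fibers-unique = Unique-resp-↭ (↭-sym fibers-D) ys-unique
        feasible : Feasible u v D (proj₁ xy) (proj₂ xy) fs
        feasible = record
          { length-fs = proj₁ (proj₂ plan)
          ; light     = ℕₚ.≤-trans (proj₂ (proj₂ (proj₂ (proj₂ plan)))) few
          ; indep     = indep-⊆ M {map proj₂ τ} {S} in-S S-ind
          ; radius    = f[xs]≤f[argmax] {f = key} (u , u) τ
          }
          where
          in-S : ∀ {x} → x ∈ˡ map proj₂ τ → x ∈ˡ S
          in-S {x} x∈ = ≡.subst (_∈ˡ S) (≡.sym (proj₂ (proj₂ preimage))) (proj₁ (All.lookup τ-ok (proj₁ (proj₂ preimage))))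
            where
            preimage : ∃ λ ps → ps ∈ˡ τ × x ≡ proj₂ ps
            preimage = ∈-map⁻ proj₂ x∈

    -- The weights count the points in the fibers, so a feasible assignment leaves out at most z
    -- points of the whole stream. Every other point reaches a center by way of the stored point
    -- that represents it.
    feasible⇒cost : ∀ {x y fs} → Feasible u v D x y fs → fromℕ 2 * d x y ≤ fromℕ 2 * opt + d u v →
      let S = set (map proj₂ (assigned (points D) (map (get pts) fs))) in
      ∃ λ cost → IsCost V z S cost × cost ≤ fromℕ 3 * opt
    feasible⇒cost {x} {y} {fs} feasible radius≤ =
      proj₁ cost , proj₂ cost , Covers⇒IsCost≤ z z<n {S} {proj₁ cost} {fromℕ 3 * opt} X (proj₂ cost) X-large covered
      where
      open Feasible feasible hiding (pts)
      σ = map (get pts) fs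
      τ = assigned (points D) σ
      S = set (map proj₂ τ)
      O = outliers D σ
      X = ∁ (set O)
      X-large : n ℕ.∸ z ℕ.≤ ∣ X ∣
      X-large = ℕₚ.≤-trans
        (ℕₚ.∸-monoʳ-≤ n (ℕₚ.≤-trans (∣set∣≤length O (∈-set⁻ O)) (ℕₚ.≤-trans (ℕₚ.≤-reflexive (length-outliers D σ)) light)))
        (ℕₚ.≤-reflexive (≡.sym (∣∁p∣≡n∸∣p∣ (set O))))
      covered : Covers S (fromℕ 3 * opt) X
      covered {i} i∈ with outlier-or-assigned {R = λ y q → fromℕ 4 * d y q ≤ d u v} D σ
        (≡.trans (Listₚ.length-map (get pts) fs) length-fs) kept-near (Permₚ.∈-resp-↭ (↭-sym fibers-D) (complete i))
      ... | inj₁ i∈O = ⊥-elim (x∈∁p⇒x∉p i∈ (∈-set⁺ i∈O))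
      ... | inj₂ ((p , s) , ps∈ , i-p) = s , ∈-set⁺ (∈-map⁺ proj₂ ps∈) ,
        ≤-trans (d-via p ≤-refl (All.lookup radius ps∈)) (three-times i-p radius≤ scale≤ 0≤opt)
      -- As z < n, some point is not an outlier, and it has a center.
      S≢∅ : Nonempty S
      S≢∅ with large⇒nonempty z z<n X X-large
      ... | i , i∈ with covered i∈
      ...   | s , s∈ , _ = s , s∈
      cost : ∃ (IsCost V z S)
      cost = IsCost-exists z z<n {S} X X-large S≢∅

-- Correctness and memory

does⇒ : {P : Set p} (P? : Dec P) → does P? ≡ true → P
does⇒ (yes p) _ = p

not-does⇒ : {P : Set p} (P? : Dec P) → not (does P?) ≡ true → ¬ P
not-does⇒ (no ¬p) _ = ¬p

module Correctness {c ℓ₁ ℓ₂ : Level} (𝓡 : ArchimedeanField c ℓ₁ ℓ₂) {n : ℕ} (V : RMC.Metric 𝓡 n) (M : Matroid n)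
  (k z : ℕ) (z<n : z ℕ.< n) (rank : Matroid.IsRank M k) (singletons : ∀ j → Matroid.Indep M ⁅ j ⁆)
  {opt : ArchimedeanField.Carrier 𝓡} (isOptimum : RMC.IsOptimum 𝓡 V M z opt)
  {Λ : ℕ} (cover : RMC.HalfBallCover 𝓡 V Λ) (m b K : ℕ) (K≡ : (k ℕ.+ z) ℕ.* Λ ℕ.^ 5 ℕ.* k ≡ K)
  (m-room : 4 ℕ.* (3 ℕ.+ K) ℕ.+ 10 ℕ.≤ m) (b-room : 3 ℕ.+ (3 ℕ.+ K) ℕ.+ (3 ℕ.+ K) ℕ.* (3 ℕ.+ K) ℕ.≤ b) (n≤b : n ℕ.≤ b)
  (prog : RMC.Program 𝓡)
  (prog-exec : ∀ N s S → prog (2 ℕ.+ N) s (encode S) ≡ Algorithm.exec 𝓡 k z (2 ℕ.+ N) s S)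
  (prog-0 : prog 0 0 [] ≡ (RMC.read , λ _ → []))
  (prog-1 : prog 1 0 [] ≡ (RMC.keepPoints (Fin.zero ∷ Fin.zero ∷ Fin.zero ∷ []) , λ _ → fresh 3 (ins 0) (1 ∷ []))) where

  open ArchimedeanField 𝓡
  open OrderedField 𝓡
  open RMC 𝓡
  open Algorithm 𝓡
  open MetricGeometry 𝓡 V
  open Matroid M
  open Invariants 𝓡 V M k z z<n rank singletons isOptimum
  open Solutions 𝓡 V M k z z<n rank singletons isOptimum

  Post : List (Fin n) → Set (c ⊔ ℓ₁ ⊔ ℓ₂)
  Post out = Indep (set out) × ∃ λ cost → IsCost V z (set out) cost × cost ≤ fromℕ 3 * opt

  open Execution 𝓡 V M k z m b Post prog prog-exec

  holds-indep⁻ : ∀ xs → holds (ind true xs) ≡ true → Indep (set xs)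
  holds-indep⁻ xs = does⇒ (indep? (set xs))

  holds-indep⁺ : ∀ xs → Indep (set xs) → holds (ind true xs) ≡ true
  holds-indep⁺ xs = dec-true (indep? (set xs))

  holds-dep⁻ : ∀ xs → holds (ind false xs) ≡ true → ¬ Indep (set xs)
  holds-dep⁻ xs = not-does⇒ (indep? (set xs))

  holds-dep⁺ : ∀ xs → ¬ Indep (set xs) → holds (ind false xs) ≡ true
  holds-dep⁺ xs dep = cong not (dec-false (indep? (set xs)) dep)

  holds-≤⁻ : ∀ α x y x′ y′ → holds (cmp false α x y x′ y′) ≡ true → fromℕ α * d x y ≤ d x′ y′
  holds-≤⁻ α x y x′ y′ = does⇒ (fromℕ α * d x y ≤? d x′ y′)

  holds-≤⁺ : ∀ α x y x′ y′ → fromℕ α * d x y ≤ d x′ y′ → holds (cmp false α x y x′ y′) ≡ true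
  holds-≤⁺ α x y x′ y′ = dec-true (fromℕ α * d x y ≤? d x′ y′)

  holds-<⁻ : ∀ α x y x′ y′ → holds (cmp true α x y x′ y′) ≡ true → ¬ (d x′ y′ ≤ fromℕ α * d x y)
  holds-<⁻ α x y x′ y′ = not-does⇒ (d x′ y′ ≤? fromℕ α * d x y)

  holds-<⁺ : ∀ α x y x′ y′ → ¬ (d x′ y′ ≤ fromℕ α * d x y) → holds (cmp true α x y x′ y′) ≡ true
  holds-<⁺ α x y x′ y′ ≰ = cong not (dec-false (d x′ y′ ≤? fromℕ α * d x y) ≰)

  Pass : List (Query (Fin n)) → Set
  Pass = All (λ q → holds q ≡ true)

  fail-fails : ¬ Pass fail
  fail-fails (h ∷ []) = holds-dep⁻ [] h ∅-indep

  size : List (Entry n) → ℕ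
  size E = 2 ℕ.+ length (points E)

  conf : List (Fin n) → Fin n → Fin n → List (Entry n) → Phase → Config n
  conf is u v E ph = ⟨ is , u ∷ v ∷ points E , [] , fresh (size E) ph (weights E) ⟩

  -- Gathers the list identities that relate the memory after an instruction to the entries of the
  -- next invariant.
  conf-≡ : ∀ {is ps ws N ph u v E} → ps ≡ u ∷ v ∷ points E → ws ≡ weights E → N ≡ size E →
    Goal (conf is u v E ph) → Goal ⟨ is , ps , [] , fresh N ph ws ⟩
  conf-≡ refl refl refl goal = goal

  size≤ : ∀ {E} → length E ℕ.≤ suc K → size E ℕ.≤ 3 ℕ.+ K
  size≤ {E} len = ℕ.s≤s (ℕ.s≤s (≡.subst (ℕ._≤ suc K) (≡.sym (Listₚ.length-map proj₁ E)) len))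

  bounded : ∀ {E ph} → length E ℕ.≤ suc K → length (fibers E) ℕ.≤ n → arg ph ℕ.≤ size E →
    Small (size E) (incumbent ph) → Bounded (size E) ph (weights E)
  bounded {E} {ph} len fib arg≤ small = record
    { N-room     = ℕₚ.≤-trans (ℕₚ.+-monoˡ-≤ 10 (ℕₚ.*-monoʳ-≤ 4 N≤)) m-room
    ; b-room     = ℕₚ.≤-trans (ℕₚ.+-mono-≤ (ℕₚ.+-monoʳ-≤ 3 N≤) (ℕₚ.*-mono-≤ N≤ N≤)) b-room
    ; arg≤       = arg≤
    ; ws-small   = ℕₚ.≤-trans (ℕₚ.≤-reflexive (≡.trans (Listₚ.length-map _ E) (≡.sym (Listₚ.length-map proj₁ E)))) (ℕₚ.m≤n+m _ 2) ,
                   All.map (λ w≤ → ℕₚ.≤-trans w≤ (ℕₚ.≤-trans fib n≤b)) (weights≤ E)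
    ; best-small = small
    }
    where
    N≤ = size≤ {E} len

  module _ {is : List (Fin n)} {u v : Fin n} {E : List (Entry n)} {ph : Phase} (bd : Bounded (size E) ph (weights E)) where

    private
      P : List (Fin n)
      P = points E

      ps : List (Fin n)
      ps = u ∷ v ∷ P

      N : ℕ
      N = size E

      index : List (Fin N)
      index = allFin N

      index≡ : map (lookup ps) index ≡ ps
      index≡ = allFin-lookup is u v P ph (weights E)

    fits-at : ∀ {cand c} → Small N cand → c ℕ.≤ 3 ℕ.+ N ℕ.+ N ℕ.* N →
      Fits V M prog m b (at is u v P ph (weights E) [] cand c 0)
    fits-at {cand} {c} small c≤ = fits {is} {ps} {[]} {ph} {weights E} {cand} {c} {0} bd ℕ.z≤n small c≤ ℕ.z≤n

    exec-found : ∀ {x xs c} → drop c (CheckIndex is u v P ph (weights E) (x ∷ xs)) ≡ [] →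
      exec k z N 0 (state ph (weights E) (x ∷ xs) c 0) ≡ found index ph (weights E) (x ∷ xs)
    exec-found eq rewrite eq = refl

    fetch-found : ∀ {x xs c} → drop c (CheckIndex is u v P ph (weights E) (x ∷ xs)) ≡ [] →
      prog N 0 (encode (state ph (weights E) (x ∷ xs) c 0)) ≡ found index ph (weights E) (x ∷ xs)
    fetch-found {x} {xs} {c} eq = fetch is u v P ph (weights E) {[]} {x ∷ xs} {c} {0} (exec-found {x} {xs} {c} eq)

    fetch-exhausted : prog N 0 (encode (state ph (weights E) [] 0 0)) ≡ exhausted index ph (weights E)
    fetch-exhausted = fetch is u v P ph (weights E) {[]} {[]} {0} {0} refl

  module _ {u v : Fin n} {D : List (Entry n)} {pt : Fin n} {F : List (Fin n)} {Q : List (Entry n)} {ys : List (Fin n)}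
    (inv : Invariant u v D ((pt , F) ∷ Q) ys) (ys≤n : length ys ℕ.≤ n) (is : List (Fin n))
    (len : length (D ++ (pt , F) ∷ Q) ℕ.≤ suc K) where

    private
      E : List (Entry n)
      E = D ++ (pt , F) ∷ Q

      P : List (Fin n)
      P = points E

      ps : List (Fin n)
      ps = u ∷ v ∷ P

      N l : ℕ
      N = size E
      l = length D

      index : List (Fin N)
      index = allFin N

      P≡ : P ≡ points D ++ pt ∷ points Q
      P≡ = points-++ D ((pt , F) ∷ Q)

      ws≡ : weights E ≡ weights D ++ length F ∷ weights Q
      ws≡ = Listₚ.map-++ _ D ((pt , F) ∷ Q)

      takeP : take l P ≡ points D
      takeP = ≡.trans (cong₂ take (≡.sym (Listₚ.length-map proj₁ D)) P≡) (take-length-++ (points D) _)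

      dropP : drop l P ≡ pt ∷ points Q
      dropP = ≡.trans (cong₂ drop (≡.sym (Listₚ.length-map proj₁ D)) P≡) (drop-length-++ (points D) _)

      takeW : take l (weights E) ≡ weights D
      takeW = ≡.trans (cong₂ take (≡.sym (Listₚ.length-map _ D)) ws≡) (take-length-++ (weights D) _)

      dropW : drop l (weights E) ≡ length F ∷ weights Q
      dropW = ≡.trans (cong₂ drop (≡.sym (Listₚ.length-map _ D)) ws≡) (drop-length-++ (weights D) _)

      l≤|E| : suc l ℕ.≤ length E
      l≤|E| = ≡.subst (suc l ℕ.≤_) (≡.sym (Listₚ.length-++ D)) (≡.subst (ℕ._≤ l ℕ.+ suc (length Q)) (ℕₚ.+-comm l 1) (ℕₚ.+-monoʳ-≤ l (ℕ.s≤s ℕ.z≤n)))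

      bd : Bounded N (ins l) (weights E)
      bd = bounded {E} {ins l} len (ℕₚ.≤-trans (ℕₚ.≤-reflexive (Permₚ.↭-length (Invariant.fibers-↭ inv))) ys≤n)
        (ℕₚ.≤-trans (ℕₚ.<⇒≤ l≤|E|) (ℕₚ.≤-trans (ℕₚ.≤-reflexive (≡.sym (Listₚ.length-map proj₁ E))) (ℕₚ.m≤n+m _ 2)))
        (ℕ.z≤n , [])

      checks≡ : ∀ i j fs → checks k z ps (ins l) (weights E) (i ∷ j ∷ fs) ≡
        insChecks u v (pt ∷ points Q) (select fs (points D))
      checks≡ i j fs rewrite takeP | dropP = refl

      merged : ∀ fs → mergeWeights fs (take l (weights E)) (drop l (weights E)) ≡ weights (addFiber fs F D ++ Q)
      merged fs rewrite takeW | dropW = ≡.sym (≡.trans (Listₚ.map-++ _ (addFiber fs F D) Q)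
        (cong (_++ weights Q) (weights-addFiber fs F D)))

      points′ : ∀ fs → points (addFiber fs F D ++ Q) ≡ points D ++ points Q
      points′ fs = ≡.trans (points-++ (addFiber fs F D) Q) (cong (_++ points Q) (points-addFiber fs F D))

      remaining : ∀ fs → map (lookup ps) (take (2 ℕ.+ l) index ++ drop (3 ℕ.+ l) index) ≡
        u ∷ v ∷ points (addFiber fs F D ++ Q)
      remaining fs = begin
        map (lookup ps) (take (2 ℕ.+ l) index ++ drop (3 ℕ.+ l) index)
          ≡⟨ Listₚ.map-++ (lookup ps) (take (2 ℕ.+ l) index) (drop (3 ℕ.+ l) index) ⟩
        map (lookup ps) (take (2 ℕ.+ l) index) ++ map (lookup ps) (drop (3 ℕ.+ l) index)
          ≡⟨ cong₂ _++_ (≡.sym (Listₚ.take-map (2 ℕ.+ l) index)) (≡.sym (Listₚ.drop-map (3 ℕ.+ l) index)) ⟩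
        take (2 ℕ.+ l) (map (lookup ps) index) ++ drop (3 ℕ.+ l) (map (lookup ps) index)
          ≡⟨ cong (λ xs → take (2 ℕ.+ l) xs ++ drop (3 ℕ.+ l) xs) (allFin-lookup is u v P (ins l) (weights E)) ⟩
        u ∷ v ∷ (take l P ++ drop (suc l) P)
          ≡⟨ cong (λ xs → u ∷ v ∷ xs) (cong₂ _++_ takeP (proj₁ (drop-suc l dropP))) ⟩
        u ∷ v ∷ (points D ++ points Q)
          ≡⟨ cong (λ xs → u ∷ v ∷ xs) (points′ fs) ⟨
        u ∷ v ∷ points (addFiber fs F D ++ Q) ∎
        where open ≡.≡-Reasoning

      size-pred : ∀ fs → ℕ.pred N ≡ size (addFiber fs F D ++ Q)
      size-pred fs = cong suc (≡.trans (cong length P≡) (≡.trans (Listₚ.length-++ (points D))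
        (≡.trans (ℕₚ.+-suc (length (points D)) (length (points Q)))
        (cong suc (≡.trans (≡.sym (Listₚ.length-++ (points D))) (cong length (≡.sym (points′ fs))))))))

      length-addFiber : ∀ fs → length (addFiber fs F D) ≡ l
      length-addFiber fs = ≡.trans (≡.sym (Listₚ.length-map proj₁ (addFiber fs F D)))
        (≡.trans (cong length (points-addFiber fs F D)) (Listₚ.length-map proj₁ D))

    -- One continuation serves both outcomes, because the next position is the number of kept
    -- entries in either case: it is unchanged by a discard and one larger after p has been kept.
    insert-next : (∀ {D′} → Invariant u v D′ Q ys → length (D′ ++ Q) ℕ.≤ suc K → Goal (conf is u v (D′ ++ Q) (ins (length D′)))) →
      Goal (conf is u v E (ins l))
    insert-next proceed = search is u v P (ins l) (weights E) bd discarded kept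
      where
      discarded : ∀ cand c → Digits is u v P (ins l) (weights E) bd cand → c ℕ.≤ 3 ℕ.+ N ℕ.+ N ℕ.* N →
        drop c (CheckIndex is u v P (ins l) (weights E) cand) ≡ [] → Passes is u v P (ins l) (weights E) cand →
        Goal (at is u v P (ins l) (weights E) [] cand c 0)
      discarded []           c (() , _)
      discarded (_ ∷ [])     c (() , _)
      discarded (i ∷ j ∷ fs) c (len-cand , cand≤) c≤ at-end passes =
        continue {at is u v P (ins l) (weights E) [] (i ∷ j ∷ fs) c 0}
          {⟨ is , map (lookup ps) (take (2 ℕ.+ l) index ++ drop (3 ℕ.+ l) index) , [] ,
             fresh (ℕ.pred N) (ins l) (mergeWeights fs (take l (weights E)) (drop l (weights E))) ⟩}
          (fits-at {is} {u} {v} {E} {ins l} bd {i ∷ j ∷ fs} {c}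
            (small-digits is u v P (ins l) (weights E) bd (ℕₚ.≤-reflexive len-cand) cand≤) c≤)
          (step-keepPoints {is} {ps} {[]} {encode (state (ins l) (weights E) (i ∷ j ∷ fs) c 0)}
            {λ _ → fresh (ℕ.pred N) (ins l) (mergeWeights fs (take l (weights E)) (drop l (weights E)))}
            {take (2 ℕ.+ l) index ++ drop (3 ℕ.+ l) index}
            (fetch-found {is} {u} {v} {E} {ins l} bd {i} {j ∷ fs} {c} at-end))
          (conf-≡ {E = addFiber fs F D ++ Q} (remaining fs) (merged fs) (size-pred fs)
            (≡.subst (λ a → Goal (conf is u v (addFiber fs F D ++ Q) (ins a))) (length-addFiber fs)
              (proceed {addFiber fs F D} (inv′ (≡.subst Pass (checks≡ i j fs) passes)) shorter)))
        where
        J : List (Fin n)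
        J = select fs (points D)
        inv′ : Pass (insChecks u v (pt ∷ points Q) J) → Invariant u v (addFiber fs F D) Q ys
        inv′ (J-ind ∷ pJ-dep ∷ near) = discard inv fs (holds-indep⁻ J J-ind) (holds-dep⁻ (pt ∷ J) pJ-dep)
          (All.map (λ {q} → holds-≤⁻ 8 pt q u v) (Allₚ.map⁻ near))
        shorter : length (addFiber fs F D ++ Q) ℕ.≤ suc K
        shorter = ℕₚ.≤-trans (ℕₚ.≤-trans (ℕₚ.≤-reflexive (≡.trans (Listₚ.length-++ (addFiber fs F D))
            (cong (ℕ._+ length Q) (length-addFiber fs))))
          (ℕₚ.≤-trans (ℕₚ.+-monoʳ-≤ l (ℕₚ.n≤1+n (length Q))) (ℕₚ.≤-reflexive (≡.sym (Listₚ.length-++ D))))) len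
      kept : (∀ cand → Digits is u v P (ins l) (weights E) bd cand → ¬ Passes is u v P (ins l) (weights E) cand) →
        Goal (at is u v P (ins l) (weights E) [] [] 0 0)
      kept none = continue {at is u v P (ins l) (weights E) [] [] 0 0} {conf is u v E (ins (suc l))}
          (fits-at {is} {u} {v} {E} {ins l} bd {[]} {0} (ℕ.z≤n , []) ℕ.z≤n)
          (≡.subst (λ ph → step V M prog (at is u v P (ins l) (weights E) [] [] 0 0) ≡ inj₂ (conf is u v E ph)) phase≡
            (step-skip {is} {ps} {[]} {encode (state (ins l) (weights E) [] 0 0)}
              {λ _ → fresh N (if l ℕ.<ᵇ length (weights E) then ins (suc l) else rai) (weights E)}
              (fetch-exhausted {is} {u} {v} {E} {ins l} bd)))
          (≡.subst₂ (λ E a → Goal (conf is u v E (ins a))) (≡.sym assoc) (≡.trans (Listₚ.length-++ D) (ℕₚ.+-comm l 1))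
            (proceed {D ++ (pt , F) ∷ []} (keep inv extend) (≡.subst (λ E → length E ℕ.≤ suc K) assoc len)))
        where
        assoc : E ≡ (D ++ (pt , F) ∷ []) ++ Q
        assoc = ≡.sym (Listₚ.++-assoc D ((pt , F) ∷ []) Q)
        phase≡ : (if l ℕ.<ᵇ length (weights E) then ins (suc l) else rai) ≡ ins (suc l)
        phase≡ rewrite dec-true (l ℕₚ.<? length (weights E)) (ℕₚ.≤-trans l≤|E| (ℕₚ.≤-reflexive (≡.sym (Listₚ.length-map _ E)))) = refl
        extend : ∀ χ → let J = filterᵇ χ (points D) in
          Indep (set J) → All (λ q → fromℕ 8 * d pt q ≤ d u v) J → Indep (set (pt ∷ J))
        -- If p together with J were dependent, the indicator of χ would be a successful candidate.
        extend χ J-ind near = decidable-stable (indep? (set (pt ∷ J))) λ dep → none (0 ∷ 0 ∷ fs) digits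
          (≡.subst Pass (≡.sym (≡.trans (checks≡ 0 0 fs) (cong (insChecks u v (pt ∷ points Q)) J≡)))
            (holds-indep⁺ J J-ind ∷ holds-dep⁺ (pt ∷ J) dep ∷ Allₚ.map⁺ (All.map (λ {q} → holds-≤⁺ 8 pt q u v) near)))
          where
          J : List (Fin n)
          J = filterᵇ χ (points D)
          fs : List ℕ
          fs = map (indicator ∘ χ) P
          digits : Digits is u v P (ins l) (weights E) bd (0 ∷ 0 ∷ fs)
          digits = cong (2 ℕ.+_) (Listₚ.length-map _ P) , ℕ.z≤n ∷ ℕ.z≤n ∷
            Allₚ.map⁺ (All.tabulate λ {x} _ → ℕₚ.≤-trans (indicator≤1 (χ x)) (ℕ.s≤s ℕ.z≤n))
          J≡ : select fs (points D) ≡ J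
          J≡ = ≡.trans (cong (select fs) (≡.sym takeP)) (≡.trans (select-indicator χ l P) (cong (filterᵇ χ) takeP))

  insert-all : ∀ Q {u v D ys} → Invariant u v D Q ys → length ys ℕ.≤ n → ∀ is → length (D ++ Q) ℕ.≤ suc K →
    (∀ {D′} → Invariant u v D′ [] ys → length D′ ℕ.≤ suc K → Goal (conf is u v D′ rai)) →
    Goal (conf is u v (D ++ Q) (ins (length D)))
  insert-all ((pt , F) ∷ Q) {u} {v} {D} inv ys≤n is len proceed =
    insert-next {u} {v} {D} {pt} {F} {Q} inv ys≤n is len λ {D′} inv′ len′ → insert-all Q {D = D′} inv′ ys≤n is len′ proceed
  -- With nothing pending the position is past the end and every candidate fails, which leads to
  -- `rai`.
  insert-all [] {u} {v} {D} {ys} inv ys≤n is len proceed =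
    ≡.subst (λ E → Goal (conf is u v E (ins (length D)))) (≡.sym (Listₚ.++-identityʳ D))
      (search is u v P (ins l) (weights D) bd
        (λ cand c digits c≤ at-end passes → ⊥-elim (impossible cand digits passes))
        (λ _ → continue {at is u v P (ins l) (weights D) [] [] 0 0} {conf is u v D rai}
          (fits-at {is} {u} {v} {D} {ins l} bd {[]} {0} (ℕ.z≤n , []) ℕ.z≤n)
          (≡.subst (λ ph → step V M prog (at is u v P (ins l) (weights D) [] [] 0 0) ≡ inj₂ (conf is u v D ph)) phase≡
            (step-skip {is} {u ∷ v ∷ P} {[]} {encode (state (ins l) (weights D) [] 0 0)}
              {λ _ → fresh (size D) (if l ℕ.<ᵇ length (weights D) then ins (suc l) else rai) (weights D)}
              (fetch-exhausted {is} {u} {v} {D} {ins l} bd)))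
          (proceed inv len-D)))
    where
    P : List (Fin n)
    P = points D
    l : ℕ
    l = length D
    len-D : length D ℕ.≤ suc K
    len-D = ≡.subst (λ E → length E ℕ.≤ suc K) (Listₚ.++-identityʳ D) len
    fibers≤ : length (fibers D) ℕ.≤ n
    fibers≤ = ≡.subst (λ E → length (fibers E) ℕ.≤ n) (Listₚ.++-identityʳ D)
      (ℕₚ.≤-trans (ℕₚ.≤-reflexive (Permₚ.↭-length (Invariant.fibers-↭ inv))) ys≤n)
    bd : Bounded (size D) (ins l) (weights D)
    bd = bounded {D} {ins l} len-D fibers≤
      (ℕₚ.≤-trans (ℕₚ.≤-reflexive (≡.sym (Listₚ.length-map proj₁ D))) (ℕₚ.m≤n+m _ 2)) (ℕ.z≤n , [])
    phase≡ : (if l ℕ.<ᵇ length (weights D) then ins (suc l) else rai) ≡ rai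
    phase≡ rewrite dec-false (l ℕₚ.<? length (weights D)) (ℕₚ.≤⇒≯ (ℕₚ.≤-reflexive (Listₚ.length-map _ D))) = refl
    impossible : ∀ cand → Digits is u v P (ins l) (weights D) bd cand → ¬ Passes is u v P (ins l) (weights D) cand
    impossible []           (() , _)
    impossible (_ ∷ [])     (() , _)
    impossible (i ∷ j ∷ fs) _ passes = fail-fails (≡.subst Pass checks≡ passes)
      where
      checks≡ : checks k z (u ∷ v ∷ P) (ins l) (weights D) (i ∷ j ∷ fs) ≡ fail
      checks≡ rewrite ≡.sym (Listₚ.length-map proj₁ D) | Listₚ.drop-all (length P) P ℕₚ.≤-refl = refl

  afterRead : List (Fin n) → Fin n → Fin n → List (Entry n) → Config n
  afterRead []       u v D = conf [] u v D (fin [])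
  afterRead (x ∷ is) u v D = conf is u v (D ++ (x , x ∷ []) ∷ []) (ins (length D))

  module _ {u v : Fin n} {D : List (Entry n)} {ys : List (Fin n)} (inv : Invariant u v D [] ys) (ys≤n : length ys ℕ.≤ n)
    (len : length D ℕ.≤ suc K) where

    private
      P : List (Fin n)
      P = points D

      ps : List (Fin n)
      ps = u ∷ v ∷ P

      N : ℕ
      N = size D

      index : List (Fin N)
      index = allFin N

      fibers≤ : length (fibers D) ℕ.≤ n
      fibers≤ = ≡.subst (λ E → length (fibers E) ℕ.≤ n) (Listₚ.++-identityʳ D)
        (ℕₚ.≤-trans (ℕₚ.≤-reflexive (Permₚ.↭-length (Invariant.fibers-↭ inv))) ys≤n)

    module _ (is : List (Fin n)) where

      private
        bd : Bounded N rai (weights D)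
        bd = bounded {D} {rai} len fibers≤ ℕ.z≤n (ℕ.z≤n , [])

        index≡ : map (lookup ps) index ≡ ps
        index≡ = allFin-lookup is u v P rai (weights D)

        kept-points : List (Fin N)
        kept-points = drop 2 index

        nth-index : ∀ i → lookup ps (nth Fin.zero index i) ≡ nth u ps i
        nth-index i = ≡.trans (≡.sym (nth-map (lookup ps) Fin.zero index i)) (cong (λ xs → nth u xs i) index≡)

        rescaled : ∀ i j → map (lookup ps) (nth Fin.zero index i ∷ nth Fin.zero index j ∷ kept-points) ≡
          nth u ps i ∷ nth u ps j ∷ P
        rescaled i j = cong₂ _∷_ (nth-index i) (cong₂ _∷_ (nth-index j)
          (≡.trans (≡.sym (Listₚ.drop-map {f = lookup ps} 2 index)) (cong (drop 2) index≡)))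

        raiChecks-many : ∀ {s x y S} → s ℕ.< length S →
          raiChecks s u v x y S ≡ cmp true 2 u v x y ∷ map (λ (a , b) → cmp false 1 x y a b) (pairs S)
        raiChecks-many {s} {S = S} lt rewrite dec-true (s ℕₚ.<? length S) lt = refl

        raiChecks-few : ∀ {s x y S} → ¬ (s ℕ.< length S) → raiChecks s u v x y S ≡ fail
        raiChecks-few {s} {S = S} ≮ rewrite dec-false (s ℕₚ.<? length S) ≮ = refl

        raiChecks⁻ : ∀ s x y S → Pass (raiChecks s u v x y S) → s ℕ.< length S ×
          ¬ (d x y ≤ fromℕ 2 * d u v) × All (λ (a , b) → d x y ≤ d a b) (pairs S)
        raiChecks⁻ s x y S pass with s ℕₚ.<? length S
        ... | no ≮  = ⊥-elim (fail-fails (≡.subst Pass (raiChecks-few {s} {x} {y} {S} ≮) pass))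
        ... | yes lt with ≡.subst Pass (raiChecks-many {s} {x} {y} {S} lt) pass
        ...   | far ∷ least = lt , holds-<⁻ 2 u v x y far ,
          All.map (λ {(a , b)} h → ≤-trans (≤-reflexive (Eq.sym (fromℕ-1-* (d x y)))) (holds-≤⁻ 1 x y a b h)) (Allₚ.map⁻ least)

        raiChecks⁺ : ∀ s x y S → s ℕ.< length S → ¬ (d x y ≤ fromℕ 2 * d u v) →
          All (λ (a , b) → d x y ≤ d a b) (pairs S) → Pass (raiChecks s u v x y S)
        raiChecks⁺ s x y S lt far least = ≡.subst Pass (≡.sym (raiChecks-many {s} {x} {y} {S} lt))
          (holds-<⁺ 2 u v x y far ∷ Allₚ.map⁺ (All.map (λ {(a , b)} le → holds-≤⁺ 1 x y a b (≤-trans (≤-reflexive (fromℕ-1-* (d x y))) le)) least))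

      -- A failed search means that the scale cannot be raised, which brings the number of entries
      -- down to K before anything is read. Hence the bound K + 1 elsewhere: one more entry arrives
      -- with each reading.
      raise-or-read : (∀ {x y} → Invariant x y [] D ys → ¬ (d x y ≤ fromℕ 2 * d u v) → Goal (conf is x y D (ins 0))) →
        (length D ℕ.≤ K → Goal (afterRead is u v D)) → Goal (conf is u v D rai)
      raise-or-read raised proceed = search is u v P rai (weights D) bd raising reading
        where
        raising : ∀ cand c → Digits is u v P rai (weights D) bd cand → c ℕ.≤ 3 ℕ.+ N ℕ.+ N ℕ.* N →
          drop c (CheckIndex is u v P rai (weights D) cand) ≡ [] → Passes is u v P rai (weights D) cand →
          Goal (at is u v P rai (weights D) [] cand c 0)
        raising []           c (() , _)
        raising (_ ∷ [])     c (() , _)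
        raising (i ∷ j ∷ fs) c (len-cand , cand≤) c≤ at-end passes =
          continue {at is u v P rai (weights D) [] (i ∷ j ∷ fs) c 0}
            {⟨ is , map (lookup ps) (nth Fin.zero index i ∷ nth Fin.zero index j ∷ kept-points) , [] , fresh N (ins 0) (weights D) ⟩}
            (fits-at {is} {u} {v} {D} {rai} bd {i ∷ j ∷ fs} {c}
              (small-digits is u v P rai (weights D) bd (ℕₚ.≤-reflexive len-cand) cand≤) c≤)
            (step-keepPoints {is} {ps} {[]} {encode (state rai (weights D) (i ∷ j ∷ fs) c 0)}
              {λ _ → fresh N (ins 0) (weights D)} {nth Fin.zero index i ∷ nth Fin.zero index j ∷ kept-points}
              (fetch-found {is} {u} {v} {D} {rai} bd {i} {j ∷ fs} {c} at-end))
            (conf-≡ {E = D} (rescaled i j) refl refl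
              (raised (raise inv (≰⇒≥ (proj₁ (proj₂ facts))) bound) (proj₁ (proj₂ facts))))
          where
          x y : Fin n
          x = nth u ps i
          y = nth u ps j
          S : List (Fin n)
          S = select fs P
          facts : k ℕ.+ z ℕ.< length S × ¬ (d x y ≤ fromℕ 2 * d u v) × All (λ (a , b) → d x y ≤ d a b) (pairs S)
          facts = raiChecks⁻ (k ℕ.+ z) x y S passes
          bound : d x y ≤ opt + opt
          bound = scale-bound {u} {v} {x} {y} S (proj₁ (proj₂ facts)) (pairs⁻ S (proj₂ (proj₂ facts))) (proj₁ facts)
        reading : (∀ cand → Digits is u v P rai (weights D) bd cand → ¬ Passes is u v P rai (weights D) cand) →
          Goal (at is u v P rai (weights D) [] [] 0 0)
        reading none = read-next is refl (proceed (≡.subst (length D ℕ.≤_) K≡ (size-bound cover inv uncrowded)))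
          where
          uncrowded : ∀ fs x y → length fs ≡ length D → All (ℕ._≤ 1) fs → x ∈ˡ P → y ∈ˡ P →
            k ℕ.+ z ℕ.< length (select fs P) → ¬ (d x y ≤ fromℕ 2 * d u v) →
            ¬ All (λ (a , b) → d x y ≤ d a b) (pairs (select fs P))
          uncrowded fs x y len-fs fs≤ x∈ y∈ long far least = none (i ∷ j ∷ fs) digits passes
            where
            pos-x : ∃ λ i → i ℕ.≤ length ps × nth u ps i ≡ x
            pos-x = nth-∈ (there (there x∈))
            pos-y : ∃ λ i → i ℕ.≤ length ps × nth u ps i ≡ y
            pos-y = nth-∈ (there (there y∈))
            i j : ℕ
            i = proj₁ pos-x
            j = proj₁ pos-y
            digits : Digits is u v P rai (weights D) bd (i ∷ j ∷ fs)
            digits = cong (2 ℕ.+_) (≡.trans len-fs (≡.sym (Listₚ.length-map proj₁ D))) ,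
              proj₁ (proj₂ pos-x) ∷ proj₁ (proj₂ pos-y) ∷ All.map (λ f≤ → ℕₚ.≤-trans f≤ (ℕ.s≤s ℕ.z≤n)) fs≤
            passes : Pass (raiChecks (k ℕ.+ z) u v (nth u ps i) (nth u ps j) (select fs P))
            passes = ≡.subst₂ (λ x y → Pass (raiChecks (k ℕ.+ z) u v x y (select fs P)))
              (≡.sym (proj₂ (proj₂ pos-x))) (≡.sym (proj₂ (proj₂ pos-y)))
              (raiChecks⁺ (k ℕ.+ z) x y (select fs P) long far least)
          fits′ : Fits V M prog m b (at is u v P rai (weights D) [] [] 0 0)
          fits′ = fits-at {is} {u} {v} {D} {rai} bd {[]} {0} (ℕ.z≤n , []) ℕ.z≤n
          read-next : ∀ is′ → is ≡ is′ → Goal (afterRead is′ u v D) → Goal (at is u v P rai (weights D) [] [] 0 0)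
          read-next [] eq goal = continue {at is u v P rai (weights D) [] [] 0 0} {conf [] u v D (fin [])} fits′
            (step-read-[] {is} {ps} {[]} {encode (state rai (weights D) [] 0 0)} {_} eq
              (fetch-exhausted {is} {u} {v} {D} {rai} bd)) goal
          read-next (x ∷ is′) eq goal = continue {at is u v P rai (weights D) [] [] 0 0}
            {⟨ is′ , u ∷ v ∷ (P ++ x ∷ []) , [] , fresh (suc N) (ins (length (weights D))) (weights D ++ 1 ∷ []) ⟩} fits′
            (step-read-∷ {is} {ps} {[]} {encode (state rai (weights D) [] 0 0)} {_} eq
              (fetch-exhausted {is} {u} {v} {D} {rai} bd))
            (conf-≡ {E = D ++ (x , x ∷ []) ∷ []} (cong (λ xs → u ∷ v ∷ xs) (≡.sym (points-++ D ((x , x ∷ []) ∷ []))))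
              (≡.sym (Listₚ.map-++ _ D ((x , x ∷ []) ∷ [])))
              (cong (2 ℕ.+_) (≡.trans (ℕₚ.+-comm 1 (length P)) (≡.sym (≡.trans (cong length (points-++ D ((x , x ∷ []) ∷ []))) (Listₚ.length-++ P)))))
              (≡.subst (λ l → Goal (conf is′ u v (D ++ (x , x ∷ []) ∷ []) (ins l))) (≡.sym (Listₚ.length-map _ D)) goal))

    data Incumbent : List ℕ → Set (c ⊔ ℓ₁ ⊔ ℓ₂) where
      none : Incumbent []
      some : ∀ {i j fs} → length (i ∷ j ∷ fs) ≡ N → All (ℕ._≤ N) (i ∷ j ∷ fs) →
             Feasible u v D (nth u ps i) (nth u ps j) fs → Incumbent (i ∷ j ∷ fs)

    Improves : Fin n → Fin n → List ℕ → Set ℓ₂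
    Improves x y (i ∷ j ∷ _) = ¬ (d (nth u ps i) (nth u ps j) ≤ d x y)
    Improves x y _           = Lift ℓ₂ ⊤

    module _ (complete : ∀ y → y ∈ˡ ys) (ys-unique : Unique ys) (witness : FeasibleExists inv complete ys-unique) where

      private
        assignment : List ℕ → List (Fin n × Fin n)
        assignment fs = assigned P (map (get ps) fs)

        improvement⁻ : ∀ {x y} best → Pass (better u ps x y best) → Improves x y best
        improvement⁻ []          _          = lift tt
        improvement⁻ (_ ∷ [])    _          = lift tt
        improvement⁻ {x} {y} (i ∷ j ∷ _) (h ∷ []) le =
          holds-<⁻ 1 x y (nth u ps i) (nth u ps j) h (≤-trans le (≤-reflexive (Eq.sym (fromℕ-1-* (d x y)))))

        improvement⁺ : ∀ {x y} best → Improves x y best → Pass (better u ps x y best)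
        improvement⁺ []          _   = []
        improvement⁺ (_ ∷ [])    _   = []
        improvement⁺ {x} {y} (i ∷ j ∷ _) imp =
          holds-<⁺ 1 x y (nth u ps i) (nth u ps j) (λ le → imp (≤-trans le (≤-reflexive (fromℕ-1-* (d x y))))) ∷ []

        finChecks-light : ∀ {imp x y fs} → outlierWeight (weights D) (map (get ps) fs) ℕ.≤ z →
          finChecks z imp x y P (weights D) (map (get ps) fs) ≡
            ind true (map proj₂ (assignment fs)) ∷ imp ++ map (λ (p , s) → cmp false 1 p s x y) (assignment fs)
        finChecks-light {fs = fs} le rewrite dec-true (outlierWeight (weights D) (map (get ps) fs) ℕₚ.≤? z) le = refl

        finChecks-heavy : ∀ {imp x y fs} → ¬ (outlierWeight (weights D) (map (get ps) fs) ℕ.≤ z) →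
          finChecks z imp x y P (weights D) (map (get ps) fs) ≡ fail
        finChecks-heavy {fs = fs} ≰ rewrite dec-false (outlierWeight (weights D) (map (get ps) fs) ℕₚ.≤? z) ≰ = refl

        finChecks⁻ : ∀ best x y fs → length fs ≡ length D →
          Pass (finChecks z (better u ps x y best) x y P (weights D) (map (get ps) fs)) →
          Feasible u v D x y fs × Improves x y best
        finChecks⁻ best x y fs len-fs pass with outlierWeight (weights D) (map (get ps) fs) ℕₚ.≤? z
        ... | no heavy  = ⊥-elim (fail-fails (≡.subst Pass (finChecks-heavy {better u ps x y best} {x} {y} {fs} heavy) pass))
        ... | yes light with ≡.subst Pass (finChecks-light {better u ps x y best} {x} {y} {fs} light) pass
        ...   | S-ind ∷ rest = record
            { length-fs = len-fs
            ; light     = light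
            ; indep     = holds-indep⁻ (map proj₂ (assignment fs)) S-ind
            ; radius    = All.map (λ {(p , s)} h → ≤-trans (≤-reflexive (Eq.sym (fromℕ-1-* (d p s)))) (holds-≤⁻ 1 p s x y h))
                (Allₚ.map⁻ (Allₚ.++⁻ʳ (better u ps x y best) rest))
            } , improvement⁻ best (Allₚ.++⁻ˡ (better u ps x y best) rest)

        finChecks⁺ : ∀ best x y fs → Feasible u v D x y fs → Improves x y best →
          Pass (finChecks z (better u ps x y best) x y P (weights D) (map (get ps) fs))
        finChecks⁺ best x y fs feasible imp = ≡.subst Pass (≡.sym (finChecks-light {better u ps x y best} {x} {y} {fs} light))
          (holds-indep⁺ (map proj₂ (assignment fs)) indep ∷ Allₚ.++⁺ (improvement⁺ best imp)
            (Allₚ.map⁺ (All.map (λ {(p , s)} le → holds-≤⁺ 1 p s x y (≤-trans (≤-reflexive (fromℕ-1-* (d p s))) le)) radius)))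
          where open Feasible feasible

        i* j* : ℕ
        i* = proj₁ witness
        j* = proj₁ (proj₂ witness)

        fs* : List ℕ
        fs* = proj₁ (proj₂ (proj₂ witness))

        x* y* : Fin n
        x* = nth u ps i*
        y* = nth u ps j*

        feasible* : Feasible u v D x* y* fs*
        feasible* = proj₁ (proj₂ (proj₂ (proj₂ (proj₂ witness))))

        radius* : fromℕ 2 * d x* y* ≤ fromℕ 2 * opt + d u v
        radius* = proj₂ (proj₂ (proj₂ (proj₂ (proj₂ witness))))

      -- When the search fails, the witness is no improvement either, so the incumbent's radius is
      -- at most that of the witness. For the same reason there is an incumbent: without one the
      -- witness would have been accepted.
      improve-or-halt : ∀ best → Incumbent best →
        (∀ {i j fs} → Incumbent (i ∷ j ∷ fs) → Improves (nth u ps i) (nth u ps j) best → Goal (conf [] u v D (fin (i ∷ j ∷ fs)))) →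
        Goal (conf [] u v D (fin best))
      improve-or-halt best incumbent-ok improved = search [] u v P (fin best) (weights D) bd improving halting
        where
        small-incumbent : ∀ best → Incumbent best → Small N best
        small-incumbent _ none             = ℕ.z≤n , []
        small-incumbent _ (some len-best ≤N _) = ℕₚ.≤-reflexive len-best , All.map (λ x≤ → ℕₚ.≤-trans x≤ N≤b) ≤N
          where
          N≤b : N ℕ.≤ b
          N≤b = ℕₚ.≤-trans (size≤ {D} len) (ℕₚ.≤-trans (ℕₚ.m≤n+m (3 ℕ.+ K) 3) (ℕₚ.≤-trans (ℕₚ.m≤m+n _ _) b-room))
        bd : Bounded N (fin best) (weights D)
        bd = bounded {D} {fin best} len fibers≤ ℕ.z≤n (small-incumbent best incumbent-ok)
        tail-length : ∀ {i j : ℕ} {fs} → length (i ∷ j ∷ fs) ≡ N → length fs ≡ length D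
        tail-length eq = ≡.trans (ℕₚ.suc-injective (ℕₚ.suc-injective eq)) (Listₚ.length-map proj₁ D)
        improving : ∀ cand c → Digits [] u v P (fin best) (weights D) bd cand → c ℕ.≤ 3 ℕ.+ N ℕ.+ N ℕ.* N →
          drop c (CheckIndex [] u v P (fin best) (weights D) cand) ≡ [] → Passes [] u v P (fin best) (weights D) cand →
          Goal (at [] u v P (fin best) (weights D) [] cand c 0)
        improving []           c (() , _)
        improving (_ ∷ [])     c (() , _)
        improving (i ∷ j ∷ fs) c (len-cand , cand≤) c≤ at-end passes =
          continue {at [] u v P (fin best) (weights D) [] (i ∷ j ∷ fs) c 0} {conf [] u v D (fin (i ∷ j ∷ fs))}
            (fits-at {[]} {u} {v} {D} {fin best} bd {i ∷ j ∷ fs} {c}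
              (small-digits [] u v P (fin best) (weights D) bd (ℕₚ.≤-reflexive len-cand) cand≤) c≤)
            (step-skip {[]} {ps} {[]} {encode (state (fin best) (weights D) (i ∷ j ∷ fs) c 0)}
              {λ _ → fresh N (fin (i ∷ j ∷ fs)) (weights D)}
              (fetch-found {[]} {u} {v} {D} {fin best} bd {i} {j ∷ fs} {c} at-end))
            (improved {i} {j} {fs} (some len-cand cand≤ (proj₁ facts)) (proj₂ facts))
          where
          facts : Feasible u v D (nth u ps i) (nth u ps j) fs × Improves (nth u ps i) (nth u ps j) best
          facts = finChecks⁻ best (nth u ps i) (nth u ps j) fs (tail-length {i} {j} {fs} len-cand) passes
        halting : (∀ cand → Digits [] u v P (fin best) (weights D) bd cand → ¬ Passes [] u v P (fin best) (weights D) cand) →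
          Goal (at [] u v P (fin best) (weights D) [] [] 0 0)
        halting no-better = finish {at [] u v P (fin best) (weights D) [] [] 0 0} {map (lookup ps) (solution index best)}
            (fits-at {[]} {u} {v} {D} {fin best} bd {[]} {0} (ℕ.z≤n , []) ℕ.z≤n)
            (step-halt {[]} {ps} {[]} {encode (state (fin best) (weights D) [] 0 0)} {λ _ → []} {solution index best}
              (fetch-exhausted {[]} {u} {v} {D} {fin best} bd))
            (≡.subst Post (≡.trans (cong (λ t → solution t best) (≡.sym (allFin-lookup [] u v P (fin best) (weights D))))
              (solution-map (lookup ps) index best)) (post best incumbent-ok (not-improved best no-better′)))
          where
          no-better′ : ¬ Improves x* y* best
          no-better′ imp = no-better (i* ∷ j* ∷ fs*)
            (cong (2 ℕ.+_) (≡.trans (Feasible.length-fs feasible*) (≡.sym (Listₚ.length-map proj₁ D))) ,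
             proj₁ bounds ∷ proj₁ (proj₂ bounds) ∷ proj₂ (proj₂ bounds))
            (finChecks⁺ best x* y* fs* feasible* imp)
            where
            bounds : i* ℕ.≤ N × j* ℕ.≤ N × All (ℕ._≤ N) fs*
            bounds = proj₁ (proj₂ (proj₂ (proj₂ witness)))
          NotImproved : List ℕ → Set ℓ₂
          NotImproved (i ∷ j ∷ _) = d (nth u ps i) (nth u ps j) ≤ d x* y*
          NotImproved _           = Lift ℓ₂ False
          not-improved : ∀ best → ¬ Improves x* y* best → NotImproved best
          not-improved []          ¬imp = ⊥-elim (¬imp (lift tt))
          not-improved (_ ∷ [])    ¬imp = ⊥-elim (¬imp (lift tt))
          not-improved (i ∷ j ∷ _) ¬imp = decidable-stable (d (nth u ps i) (nth u ps j) ≤? d x* y*) ¬imp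
          post : ∀ best → Incumbent best → NotImproved best → Post (solution ps best)
          post _ none (lift ())
          post (i ∷ j ∷ fs) (some len-best _ feasible) le = Feasible.indep feasible ,
            feasible⇒cost inv complete ys-unique {nth u ps i} {nth u ps j} {fs} feasible
              (≤-trans (*-monoʳ-≤ (fromℕ 2) (0≤fromℕ 2) le) radius*)

  distances : List Carrier
  distances = map (λ (x , y) → d x y) (cartesianProduct (allFin n) (allFin n))

  ∈-distances : ∀ x y → d x y ∈ˡ distances
  ∈-distances x y = ∈-map⁺ (λ (x , y) → d x y) (∈-cartesianProduct⁺ (∈-allFin x) (∈-allFin y))

  -- Termination measures, counted in a fixed finite list of distances: `above` drops when the scale
  -- grows, `below` when the radius of the incumbent shrinks.
  above below : Fin n → Fin n → ℕ
  above x y = length (filter (d x y ≤?_) distances)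
  below x y = length (filter (_≤? d x y) distances)

  above-< : ∀ {u v x y} → ¬ (d x y ≤ fromℕ 2 * d u v) → above x y ℕ.< above u v
  above-< {u} {v} {x} {y} far = filter-< (d u v ≤?_) (d x y ≤?_) distances (≤-trans (≰⇒≥ ≰)) (∈-distances u v) ≤-refl ≰
    where
    ≰ : ¬ (d x y ≤ d u v)
    ≰ le = far (≤-trans le (≤-trans (≤-+ˡ 0≤d) (≤-reflexive (Eq.sym (fromℕ-2-* (d u v))))))

  below-< : ∀ {x y x′ y′} → ¬ (d x′ y′ ≤ d x y) → below x y ℕ.< below x′ y′
  below-< {x} {y} {x′} {y′} ≰ = filter-< (_≤? d x′ y′) (_≤? d x y) distances
    (λ le → ≤-trans le (≰⇒≥ ≰)) (∈-distances x′ y′) ≤-refl ≰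

  module _ {u v : Fin n} {D : List (Entry n)} {ys : List (Fin n)} (inv : Invariant u v D [] ys) (ys≤n : length ys ℕ.≤ n)
    (len : length D ℕ.≤ suc K) (complete : ∀ y → y ∈ˡ ys) (ys-unique : Unique ys) where

    private
      ps : List (Fin n)
      ps = u ∷ v ∷ points D

    optimise : ∀ fuel {i j fs} → below (nth u ps i) (nth u ps j) ℕ.≤ fuel → Incumbent inv ys≤n len (i ∷ j ∷ fs) →
      Goal (conf [] u v D (fin (i ∷ j ∷ fs)))
    optimise fuel {i} {j} {fs} ≤fuel incumbent-ok =
      improve-or-halt inv ys≤n len complete ys-unique (feasible-exists inv complete ys-unique) (i ∷ j ∷ fs) incumbent-ok (λ {i′} {j′} {fs′} → descend fuel ≤fuel {i′} {j′} {fs′})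
      where
      descend : ∀ fuel → below (nth u ps i) (nth u ps j) ℕ.≤ fuel → ∀ {i′ j′ fs′} → Incumbent inv ys≤n len (i′ ∷ j′ ∷ fs′) →
        ¬ (d (nth u ps i) (nth u ps j) ≤ d (nth u ps i′) (nth u ps j′)) → Goal (conf [] u v D (fin (i′ ∷ j′ ∷ fs′)))
      descend zero       ≤0    {i′} {j′} _   imp = ⊥-elim (ℕₚ.n≮0 (ℕₚ.<-≤-trans (below-< {nth u ps i′} {nth u ps j′} {nth u ps i} {nth u ps j} imp) ≤0))
      descend (suc fuel) ≤fuel {i′} {j′} inc imp = optimise fuel (ℕ.s≤s⁻¹ (ℕₚ.<-≤-trans (below-< {nth u ps i′} {nth u ps j′} {nth u ps i} {nth u ps j} imp) ≤fuel)) inc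

    solve-stored : Goal (conf [] u v D (fin []))
    solve-stored = improve-or-halt inv ys≤n len complete ys-unique (feasible-exists inv complete ys-unique) [] none
      λ {i} {j} {fs} inc _ → optimise (below (nth u ps i) (nth u ps j)) {i} {j} {fs} ℕₚ.≤-refl inc

  -- Lexicographic recursion on the rest of the stream and the fuel. A raise consumes fuel at the
  -- same point of the stream; a reading shortens the stream and renews the fuel.
  stream-run : ∀ is fuel {u v D Q ys} → ys ++ is ↭ allFin n → above u v ℕ.≤ fuel → Invariant u v D Q ys →
    length (D ++ Q) ℕ.≤ suc K → Goal (conf is u v (D ++ Q) (ins (length D)))
  stream-run is fuel {u} {v} {D} {Q} {ys} stream ≤fuel inv len =
    insert-all Q {D = D} inv ys≤n is len λ {D′} inv′ len′ →
      raise-or-read inv′ ys≤n len′ is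
        (λ {x} {y} → raised fuel ≤fuel {D′} {x} {y} len′)
        (λ len″ → proceed is stream {D′} inv′ len″)
    where
    ys≤n : length ys ℕ.≤ n
    ys≤n = ℕₚ.≤-trans (ℕₚ.m≤m+n (length ys) (length is)) (ℕₚ.≤-reflexive (≡.trans (≡.sym (Listₚ.length-++ ys))
      (≡.trans (Permₚ.↭-length stream) (Listₚ.length-tabulate {n = n} id))))
    raised : ∀ fuel → above u v ℕ.≤ fuel → ∀ {D′ x y} → length D′ ℕ.≤ suc K → Invariant x y [] D′ ys →
      ¬ (d x y ≤ fromℕ 2 * d u v) → Goal (conf is x y D′ (ins 0))
    raised zero       ≤0    {D′} {x} {y} _    _    far = ⊥-elim (ℕₚ.n≮0 (ℕₚ.<-≤-trans (above-< {u} {v} {x} {y} far) ≤0))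
    raised (suc fuel) ≤fuel {D′} {x} {y} len′ inv′ far =
      stream-run is fuel {x} {y} {[]} {D′} stream (ℕ.s≤s⁻¹ (ℕₚ.<-≤-trans (above-< {u} {v} {x} {y} far) ≤fuel)) inv′ len′
    proceed : ∀ is → ys ++ is ↭ allFin n → ∀ {D′} → Invariant u v D′ [] ys → length D′ ℕ.≤ K → Goal (afterRead is u v D′)
    proceed [] stream {D′} inv′ len′ = solve-stored inv′ ys≤n (ℕₚ.m≤n⇒m≤1+n len′)
      (λ y → Permₚ.∈-resp-↭ (↭-sym stream′) (∈-allFin y)) (Unique-resp-↭ (↭-sym stream′) (Uniqueₚ.allFin⁺ n))
      where
      stream′ : ys ↭ allFin n
      stream′ = ≡.subst (_↭ allFin n) (Listₚ.++-identityʳ ys) stream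
    proceed (x ∷ is) stream {D′} inv′ len′ = stream-run is (above u v) {u} {v} {D′} {(x , x ∷ []) ∷ []}
      (≡.subst (_↭ allFin n) (≡.sym (Listₚ.++-assoc ys (x ∷ []) is)) stream) ℕₚ.≤-refl
      (receive x inv′ (fresh-point ys (Unique-resp-↭ (↭-sym stream) (Uniqueₚ.allFin⁺ n))))
      (ℕₚ.≤-trans (ℕₚ.≤-reflexive (Listₚ.length-++ D′)) (≡.subst (ℕ._≤ suc K) (ℕₚ.+-comm 1 (length D′)) (ℕ.s≤s len′)))
      where
      fresh-point : ∀ ys → Unique (ys ++ x ∷ is) → x ∉ˡ ys
      fresh-point (y ∷ ys) (y∉ ∷ _) (here refl) = All.lookup y∉ (∈-++⁺ʳ ys (here refl)) refl
      fresh-point (y ∷ ys) (_ ∷ u)  (there x∈)  = fresh-point ys u x∈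

  run-from-start : ∀ {x is} → x ∷ is ↭ allFin n → Goal (initial (x ∷ is))
  run-from-start {x} {is} stream =
    continue {initial (x ∷ is)} {⟨ is , x ∷ [] , [] , [] ⟩} (ℕ.z≤n , [])
      (step-read-∷ {x ∷ is} {[]} {[]} {[]} {λ _ → []} refl prog-0)
    (continue {⟨ is , x ∷ [] , [] , [] ⟩} {conf is x x ((x , x ∷ []) ∷ []) (ins 0)}
      (ℕₚ.≤-trans (ℕ.s≤s ℕ.z≤n) (ℕₚ.≤-trans (ℕₚ.m≤n+m 10 (4 ℕ.* (3 ℕ.+ K))) m-room) , [])
      (step-keepPoints {is} {x ∷ []} {[]} {[]} {λ _ → fresh 3 (ins 0) (1 ∷ [])} {Fin.zero ∷ Fin.zero ∷ Fin.zero ∷ []} prog-1)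
      (stream-run is (above x x) {x} {x} {[]} {(x , x ∷ []) ∷ []} {x ∷ []} stream ℕₚ.≤-refl (initial-invariant x) (ℕ.s≤s ℕ.z≤n)))

-- Numerical bounds on memory and words

module Bounds where
  open ℕₚ.≤-Reasoning
  open +-*-Solver

  room-for-memory : ∀ K → 1 ℕ.≤ K → 4 ℕ.* (3 ℕ.+ K) ℕ.+ 10 ℕ.≤ 32 ℕ.* K
  room-for-memory K 1≤K = begin
    4 ℕ.* (3 ℕ.+ K) ℕ.+ 10  ≡⟨ solve 1 (λ K → con 4 :* (con 3 :+ K) :+ con 10 := con 4 :* K :+ con 22) refl K ⟩
    -- Rounding 22 up to 28 makes the factor 32, so that the same number serves as the constant of
    -- the theorem.
    4 ℕ.* K ℕ.+ 22          ≤⟨ ℕₚ.+-monoʳ-≤ (4 ℕ.* K) (ℕₚ.*-mono-≤ (ℕₚ.m≤m+n 22 6) 1≤K) ⟩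
    4 ℕ.* K ℕ.+ 28 ℕ.* K    ≡⟨ solve 1 (λ K → con 4 :* K :+ con 28 :* K := con 32 :* K) refl K ⟩
    32 ℕ.* K                ∎

  n≤n^ : ∀ {n} j → 1 ℕ.≤ n → n ℕ.≤ n ℕ.^ suc j
  n≤n^ {n} j 1≤n = begin
    n              ≡⟨ ℕₚ.*-identityʳ n ⟨
    n ℕ.* 1        ≤⟨ ℕₚ.*-monoʳ-≤ n (begin 1 ≡⟨ ℕₚ.^-zeroˡ j ⟨ 1 ℕ.^ j ≤⟨ ℕₚ.^-monoˡ-≤ j 1≤n ⟩ n ℕ.^ j ∎) ⟩
    n ℕ.^ suc j    ∎

  room-for-words : ∀ K n → 1 ℕ.≤ K → 3 ℕ.+ (3 ℕ.+ K) ℕ.+ (3 ℕ.+ K) ℕ.* (3 ℕ.+ K) ℕ.≤ (n ℕ.+ 32 ℕ.* K) ℕ.^ 32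
  room-for-words K n 1≤K = begin
    3 ℕ.+ (3 ℕ.+ K) ℕ.+ (3 ℕ.+ K) ℕ.* (3 ℕ.+ K)
      -- The summand K + 1 completes the square of K + 4.
      ≤⟨ ℕₚ.m≤m+n _ _ ⟩
    3 ℕ.+ (3 ℕ.+ K) ℕ.+ (3 ℕ.+ K) ℕ.* (3 ℕ.+ K) ℕ.+ (K ℕ.+ 1)
      ≡⟨ solve 1 (λ K → con 3 :+ (con 3 :+ K) :+ (con 3 :+ K) :* (con 3 :+ K) :+ (K :+ con 1) := (K :+ con 4) :* (K :+ con 4)) refl K ⟩
    (K ℕ.+ 4) ℕ.* (K ℕ.+ 4)
      ≤⟨ ℕₚ.*-mono-≤ K+4≤ K+4≤ ⟩
    M ℕ.* M
      ≤⟨ ℕₚ.*-monoʳ-≤ M (n≤n^ 30 1≤M) ⟩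
    M ℕ.^ 32 ∎
    where
    M = n ℕ.+ 32 ℕ.* K
    K+4≤ : K ℕ.+ 4 ℕ.≤ M
    K+4≤ = begin
      K ℕ.+ 4                   ≤⟨ ℕₚ.+-monoʳ-≤ K (ℕₚ.*-mono-≤ (ℕₚ.m≤m+n 4 27) 1≤K) ⟩
      K ℕ.+ 31 ℕ.* K            ≤⟨ ℕₚ.m≤n+m (32 ℕ.* K) n ⟩
      M                         ∎
    1≤M : 1 ℕ.≤ M
    1≤M = ℕₚ.≤-trans (ℕₚ.≤-trans (ℕ.s≤s ℕ.z≤n) (ℕₚ.m≤n+m 4 K)) K+4≤

  n≤words : ∀ K n → 1 ℕ.≤ K → n ℕ.≤ (n ℕ.+ 32 ℕ.* K) ℕ.^ 32
  n≤words K n 1≤K = ℕₚ.≤-trans (ℕₚ.m≤m+n n _)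
    (n≤n^ 31 (ℕₚ.≤-trans (ℕₚ.≤-trans 1≤K (ℕₚ.m≤m+n K (31 ℕ.* K))) (ℕₚ.m≤n+m (32 ℕ.* K) n)))

  memory-factors : ∀ k z Λ → 32 ℕ.* ((k ℕ.+ z) ℕ.* Λ ℕ.^ 5 ℕ.* k) ≡ 32 ℕ.* (k ℕ.* (k ℕ.+ z)) ℕ.* Λ ℕ.^ 5
  memory-factors k z Λ = solve 3 (λ k s l → con 32 :* (s :* l :* k) := con 32 :* (k :* s) :* l) refl k (k ℕ.+ z) (Λ ℕ.^ 5)

  ^-distrib-* : ∀ x y n → (x ℕ.* y) ℕ.^ n ≡ x ℕ.^ n ℕ.* y ℕ.^ n
  ^-distrib-* x y zero    = refl
  ^-distrib-* x y (suc n) = ≡.trans (cong (x ℕ.* y ℕ.*_) (^-distrib-* x y n))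
    (solve 4 (λ x y a b → x :* y :* (a :* b) := x :* a :* (y :* b)) refl x y (x ℕ.^ n) (y ℕ.^ n))

  -- This is Λ⁵ = 32^D in terms of rational upper bounds p/q of D: the power (Λ^q)⁵ is at most
  -- (2^p)⁵ = 32^p.
  memory-power : ∀ A Λ p q → Λ ℕ.^ q ℕ.≤ 2 ℕ.^ p → (A ℕ.* Λ ℕ.^ 5) ℕ.^ q ℕ.≤ A ℕ.^ q ℕ.* 32 ℕ.^ p
  memory-power A Λ p q Λ^q≤ = begin
    (A ℕ.* Λ ℕ.^ 5) ℕ.^ q        ≡⟨ ^-distrib-* A (Λ ℕ.^ 5) q ⟩
    A ℕ.^ q ℕ.* (Λ ℕ.^ 5) ℕ.^ q  ≡⟨ cong (A ℕ.^ q ℕ.*_) (swap Λ 5 q) ⟩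
    A ℕ.^ q ℕ.* (Λ ℕ.^ q) ℕ.^ 5  ≤⟨ ℕₚ.*-monoʳ-≤ (A ℕ.^ q) (ℕₚ.^-monoˡ-≤ 5 Λ^q≤) ⟩
    A ℕ.^ q ℕ.* (2 ℕ.^ p) ℕ.^ 5  ≡⟨ cong (A ℕ.^ q ℕ.*_) (swap 2 p 5) ⟩
    A ℕ.^ q ℕ.* 32 ℕ.^ p         ∎
    where
    swap : ∀ x i j → (x ℕ.^ i) ℕ.^ j ≡ (x ℕ.^ j) ℕ.^ i
    swap x i j = ≡.trans (ℕₚ.^-*-assoc x i j) (≡.trans (cong (x ℕ.^_) (ℕₚ.*-comm i j)) (≡.sym (ℕₚ.^-*-assoc x j i)))

module MemoryBound {c ℓ₁ ℓ₂ : Level} (𝓡 : ArchimedeanField c ℓ₁ ℓ₂) where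
  open ArchimedeanField 𝓡
  open OrderedField 𝓡
  open RMC 𝓡
  open ≤-Reasoning

  -- If L were 0, then 1/δ ≤ 1, against δ < 1.
  1≤ceil-log : ∀ {δ L} → 0# < δ → δ < 1# → IsCeilLog₂ (δ ⁻¹) L → 1# ≤ fromℕ L
  1≤ceil-log {L = suc L} _ _ _ = 1≤fromℕ-suc L
  1≤ceil-log {δ} {zero} (0≤δ , 0≉δ) (δ≤1 , δ≉1) (δ⁻¹≤1 , _) = ⊥-elim (δ≉1 (≤-antisym δ≤1 (begin
    1#        ≈⟨ *-inverseʳ (0≉δ ∘ Eq.sym) ⟨
    δ * δ ⁻¹  ≤⟨ *-monoʳ-≤ δ 0≤δ δ⁻¹≤1 ⟩
    δ * 1#    ≈⟨ *-identityʳ δ ⟩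
    δ         ∎)))

  -- Already 28 · 2 = 56 exceeds 32, while δ and 1/ε only enlarge the base.
  32≤base : ∀ {ε δ} → 0# < ε → ε < 1# → 0# < δ → fromℕ 32 ≤ fromℕ 28 * (fromℕ 2 + δ) * ε ⁻¹
  32≤base {ε} {δ} 0<ε (ε≤1 , _) (0≤δ , _) = begin
    fromℕ 32                              ≤⟨ fromℕ-mono {32} {56} (ℕₚ.m≤m+n 32 24) ⟩
    fromℕ (28 ℕ.* 2)                      ≈⟨ fromℕ-* 28 2 ⟩
    fromℕ 28 * fromℕ 2                    ≤⟨ *-monoʳ-≤ (fromℕ 28) (0≤fromℕ 28) (≤-+ˡ 0≤δ) ⟩
    fromℕ 28 * (fromℕ 2 + δ)              ≈⟨ *-identityʳ _ ⟨
    fromℕ 28 * (fromℕ 2 + δ) * 1#         ≤⟨ *-monoʳ-≤ _ (*-nonNegative (0≤fromℕ 28) (≤-trans (0≤fromℕ 2) (≤-+ˡ 0≤δ))) (1≤⁻¹ 0<ε ε≤1) ⟩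
    fromℕ 28 * (fromℕ 2 + δ) * ε ⁻¹       ∎

  memory-bound : ∀ {ε δ} k z Λ L → 0# < ε → ε < 1# → 0# < δ → δ < 1# → IsCeilLog₂ (δ ⁻¹) L →
    fromℕ (32 ℕ.* ((k ℕ.+ z) ℕ.* Λ ℕ.^ 5 ℕ.* k)) ≤ fromℕ 32 * (δ ⁻¹ * fromℕ L * fromℕ (k ℕ.* (k ℕ.+ z)))
      · (fromℕ 28 * (fromℕ 2 + δ) * ε ⁻¹) ^log₂ Λ
  memory-bound {ε} {δ} k z Λ L 0<ε ε<1 0<δ δ<1 ceil p q Λ^q≤2^p = begin
    fromℕ m ^ q                          ≈⟨ fromℕ-^ m q ⟨
    fromℕ (m ℕ.^ q)                      ≤⟨ fromℕ-mono (≡.subst (λ t → t ℕ.^ q ℕ.≤ 32kz ℕ.^ q ℕ.* 32 ℕ.^ p)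
                                              (≡.sym (Bounds.memory-factors k z Λ)) (Bounds.memory-power 32kz Λ p q Λ^q≤2^p)) ⟩
    fromℕ (32kz ℕ.^ q ℕ.* 32 ℕ.^ p)         ≈⟨ fromℕ-* (32kz ℕ.^ q) (32 ℕ.^ p) ⟩
    fromℕ (32kz ℕ.^ q) * fromℕ (32 ℕ.^ p)   ≈⟨ *-cong (fromℕ-^ 32kz q) (fromℕ-^ 32 p) ⟩
    fromℕ 32kz ^ q * fromℕ 32 ^ p           ≤⟨ *-mono-≤ (0≤^ q (0≤fromℕ 32kz)) (0≤^ p (≤-trans (0≤fromℕ 32) base≥))
                                              (^-mono-≤ q (0≤fromℕ 32kz) 32kz≤) (^-mono-≤ p (0≤fromℕ 32) base≥) ⟩
    (fromℕ 32 * (δ ⁻¹ * fromℕ L * fromℕ (k ℕ.* (k ℕ.+ z)))) ^ q * (fromℕ 28 * (fromℕ 2 + δ) * ε ⁻¹) ^ p ∎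
    where
    m = 32 ℕ.* ((k ℕ.+ z) ℕ.* Λ ℕ.^ 5 ℕ.* k)
    kz = k ℕ.* (k ℕ.+ z)
    32kz = 32 ℕ.* kz
    base≥ : fromℕ 32 ≤ fromℕ 28 * (fromℕ 2 + δ) * ε ⁻¹
    base≥ = 32≤base 0<ε ε<1 0<δ
    1≤δ⁻¹L : 1# ≤ δ ⁻¹ * fromℕ L
    1≤δ⁻¹L = begin
      1#              ≈⟨ *-identityʳ 1# ⟨
      1# * 1#         ≤⟨ *-mono-≤ 0≤1 (0≤fromℕ L) (1≤⁻¹ 0<δ (proj₁ δ<1)) (1≤ceil-log 0<δ δ<1 ceil) ⟩
      δ ⁻¹ * fromℕ L  ∎
    32kz≤ : fromℕ 32kz ≤ fromℕ 32 * (δ ⁻¹ * fromℕ L * fromℕ kz)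
    32kz≤ = begin
      fromℕ 32kz                               ≈⟨ fromℕ-* 32 kz ⟩
      fromℕ 32 * fromℕ kz                    ≤⟨ *-monoʳ-≤ (fromℕ 32) (0≤fromℕ 32) (begin
        fromℕ kz                      ≈⟨ *-identityˡ (fromℕ kz) ⟨
        1# * fromℕ kz                 ≤⟨ *-monoˡ-≤ (fromℕ kz) (0≤fromℕ kz) 1≤δ⁻¹L ⟩
        δ ⁻¹ * fromℕ L * fromℕ kz     ∎) ⟩
      fromℕ 32 * (δ ⁻¹ * fromℕ L * fromℕ kz) ∎

-- The algorithm on a given instance

module Main {c ℓ₁ ℓ₂ : Level} (𝓡 : ArchimedeanField c ℓ₁ ℓ₂) {n : ℕ} (V : RMC.Metric 𝓡 n) (M : Matroid n) (k z : ℕ)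
  (z<n : z ℕ.< n) (rank : Matroid.IsRank M k) (singletons : ∀ j → Matroid.Indep M ⁅ j ⁆)
  {Λ : ℕ} (cover : RMC.HalfBallCover 𝓡 V Λ) where

  open ArchimedeanField 𝓡
  open OrderedField 𝓡
  open RMC 𝓡
  open Algorithm 𝓡
  open MetricGeometry 𝓡 V

  memory : ℕ
  memory = 32 ℕ.* ((k ℕ.+ z) ℕ.* Λ ℕ.^ 5 ℕ.* k)

  Solves : Carrier → List (Fin n) → Set (c ⊔ ℓ₁ ⊔ ℓ₂)
  Solves α stream = ∃ λ out → Run V M (algorithm k z) memory ((n ℕ.+ memory) ℕ.^ 32) (initial stream) out ×
    IsApproxSolution V α M z (toSubset out)

  -- The optimum is a parameter of the analysis only; the program depends on k and z alone.
  run-relative-to : ∀ {ε opt x is} → 0# ≤ ε → IsOptimum V M z opt → x ∷ is ↭ allFin n → Solves (fromℕ 3 + ε) (x ∷ is)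
  run-relative-to {ε} {opt} {x} {is} 0≤ε isOptimum stream = conclude (run-from-start stream)
    where
    K : ℕ
    K = (k ℕ.+ z) ℕ.* Λ ℕ.^ 5 ℕ.* k
    open Invariants 𝓡 V M k z z<n rank singletons {opt} isOptimum using (1≤k; 0≤opt)
    1≤K : 1 ℕ.≤ K
    1≤K = ℕₚ.*-mono-≤ (ℕₚ.*-mono-≤ (ℕₚ.≤-trans 1≤k (ℕₚ.m≤m+n k z)) (ℕₚ.^-monoˡ-≤ 5 (1≤cover cover x))) 1≤k
    open Correctness 𝓡 V M k z z<n rank singletons {opt} isOptimum {Λ} cover memory ((n ℕ.+ memory) ℕ.^ 32) K refl
      (Bounds.room-for-memory K 1≤K) (Bounds.room-for-words K n 1≤K) (Bounds.n≤words K n 1≤K)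
      (algorithm k z) (λ N s S → cong (exec k z (2 ℕ.+ N) s) (decode-encode S)) refl refl
      using (Post; run-from-start)
    conclude : (∃ λ out → Run V M (algorithm k z) memory ((n ℕ.+ memory) ℕ.^ 32) (initial (x ∷ is)) out × Post out) →
      Solves (fromℕ 3 + ε) (x ∷ is)
    conclude (out , runs , S-ind , cost , is-cost , cost≤) =
      out , runs , S-ind , cost , opt , is-cost , isOptimum ,
      ≤-trans cost≤ (*-monoˡ-≤ opt 0≤opt (≤-+ˡ 0≤ε))

  run : ∀ {ε} → 0# ≤ ε → ∀ stream → stream ↭ allFin n → Solves (fromℕ 3 + ε) stream
  run 0≤ε [] stream = ⊥-elim (empty z<n stream)
    where
    empty : ∀ {n} → z ℕ.< n → [] ↭ allFin n → False
    empty {suc n} _ perm = Permₚ.¬x∷xs↭[] (↭-sym perm)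
  run {ε} 0≤ε (x ∷ is) stream = run-relative-to {ε} {proj₁ optimum} {x} {is} 0≤ε (proj₂ optimum) stream
    where
    -- A single center already has a finite cost, even with no outliers, so the minimum is over a
    -- nonempty finite family.
    optimum : ∃ (IsOptimum V M z)
    optimum = IsOptimum-exists z z<n M {⁅ x ⁆} full
      (ℕₚ.≤-trans (ℕₚ.m∸n≤m n z) (ℕₚ.≤-reflexive (≡.sym (∣⊤∣≡n n)))) (singletons x) (x , x∈⁅x⁆ x)

theorem5p3 : ∀ {c ℓ₁ ℓ₂} (𝓡 : ArchimedeanField c ℓ₁ ℓ₂) →
    let open ArchimedeanField 𝓡
        open RMC 𝓡
    in
    ∃ λ (C : ℕ) →
    ∀ (ε δ : Carrier) → 0# < ε → ε < 1# → 0# < δ → δ < 1# →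
    ∃ λ (algorithm : (k z : ℕ) → Program) →
    ∀ {n : ℕ} (V : Metric n) (M : Matroid n) (k z : ℕ) → z ℕ.< n →
    Matroid.IsRank M k → (∀ j → Matroid.Indep M ⁅ j ⁆) →
    ∀ (Λ : ℕ) → IsDoublingConstant V Λ →
    ∀ (L : ℕ) → IsCeilLog₂ (δ ⁻¹) L →
    ∀ (stream : List (Fin n)) → stream ↭ allFin n →
    ∃ λ (m : ℕ) → ∃ λ (out : List (Fin n)) →
      Run V M (algorithm k z) m ((n ℕ.+ m) ℕ.^ C) (initial stream) out
      × IsApproxSolution V (fromℕ 3 + ε) M z (toSubset out)
      × fromℕ m ≤ fromℕ C * (δ ⁻¹ * fromℕ L * fromℕ (k ℕ.* (k ℕ.+ z)))
                · (fromℕ 28 * (fromℕ 2 + δ) * ε ⁻¹) ^log₂ Λ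
theorem5p3 𝓡 = 32 , λ ε δ 0<ε ε<1 0<δ δ<1 → Algorithm.algorithm 𝓡 ,
  λ {n} V M k z z<n rank singletons Λ doubling L ceil stream perm →
    let solved = Main.run 𝓡 V M k z z<n rank singletons {Λ} (proj₁ doubling) {ε} (proj₁ 0<ε) stream perm in
    32 ℕ.* ((k ℕ.+ z) ℕ.* Λ ℕ.^ 5 ℕ.* k) , proj₁ solved , proj₁ (proj₂ solved) , proj₂ (proj₂ solved) ,
    MemoryBound.memory-bound 𝓡 {ε} {δ} k z Λ L 0<ε ε<1 0<δ δ<1 ceil
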